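{- For every real $k\in(0,1)$, $$\sum_{n=0}^\infty \binom{2n}{n}^2 P_n\!\left(\frac{ -k^4+6k^3-2k+1}{(k^2+1)(k^2+2k-1)}\right)\left(\frac{(k^2+1)(k^2+2k-1)}{16(k+1)^2}\right)^n\bigl(C_3n^3+C_2n^2+C_1n+C_0\bigr)=\frac{2(k+1)^3(k^2+1)}{\pi},$$ where $$C_3=4(k-1)^2k^2(k^2+3k+4)^2,$$ $$C_2=12(k-1)k(k^6+5k^5+10k^4+10k^3+5k^2-3k+4),$$ $$C_1=9k^8+36k^7+37k^6+8k^5-9k^4-56k^3+63k^2-28k+4,$$ $$C_0=(k^2+2k-1)^2(2k^4+3k^2-2k+1).$$ At the single value $k=\sqrt2-1$ (where $k^2+2k-1=0$), the product $P_n(\cdot)\,(\cdot)^n$ in each summand is understood as its limit as $k\to\sqrt2-1$.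
   Context: $P_n$ denotes the $n$-th Legendre polynomial, $P_n(x)={}_2F_1\bigl(-n,n+1;1;\tfrac{1-x}{2}\bigr)$, evaluated at any real $x$ (possibly $|x|>1$). -}

module Defs where

open import Agda.Builtin.FromNat using (Number)
open import Algebra.Bundles.Raw using (RawMonoid; RawRing)
import Algebra.Definitions.RawSemiring as RawSemiringDefs
open import Data.Integer as ℤ using (ℤ; +_) hiding (module ℤ)
open import Data.Nat as ℕ using (ℕ; zero; suc; _!)
import Data.Nat.Literals as ℕ-Literals
open import Data.Nat.Combinatorics using (_C_)
import Data.Nat.Properties as ℕₚ
open import Data.Product using (Σ; ∃; ∃-syntax; _×_; _,_; proj₁; proj₂)
open import Data.Rational as ℚ using (ℚ; 0ℚ; 1ℚ; ½; mkℚ) hiding (module ℚ)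
import Data.Rational.Properties as ℚₚ
open import Data.Rational.Solver using (module +-*-Solver)
open import Data.Rational.Unnormalised as ℚᵘ using (mkℚᵘ)
import Data.Rational.Unnormalised.Properties as ℚᵘₚ
import Data.Integer.Properties as ℤₚ
open import Data.Sum using (_⊎_; inj₁; inj₂)
open import Data.Unit using (⊤)
open import Level using (0ℓ)
open import Relation.Binary.PropositionalEquality
open import Relation.Nullary using (yes; no; contradiction)
open import Relation.Nullary.Decidable using (from-yes)

-- ∑< M n f = f 0 ∙ f 1 ∙ ⋯ ∙ f (n − 1)
∑< : (M : RawMonoid 0ℓ 0ℓ) → ℕ → (ℕ → RawMonoid.Carrier M) → RawMonoid.Carrier M
∑< M zero    f = RawMonoid.ε M
∑< M (suc n) f = RawMonoid._∙_ M (∑< M n f) (f n)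

module ℚ-Lemmas where
  open ℚ using (_+_; _*_; _-_; -_; ∣_∣; _<_; _≤_)
  open +-*-Solver
  open ℚₚ.≤-Reasoning

  *-pos : ∀ {p q} → 0ℚ < p → 0ℚ < q → 0ℚ < p * q
  *-pos {p} {q} 0<p 0<q =
    ℚₚ.positive⁻¹ (p * q) {{ℚₚ.pos*pos⇒pos p {{ℚ.positive 0<p}} q {{ℚ.positive 0<q}}}}

  0<½ : 0ℚ < ½
  0<½ = ℚₚ.positive⁻¹ ½

  half-pos : ∀ {ε} → 0ℚ < ε → 0ℚ < ½ * ε
  half-pos = *-pos 0<½

  half-sum : ∀ ε → ½ * ε + ½ * ε ≡ ε
  half-sum ε = trans (sym (ℚₚ.*-distribʳ-+ ε ½ ½)) (ℚₚ.*-identityˡ ε)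

  half< : ∀ {ε} → 0ℚ < ε → ½ * ε < ε
  half< {ε} 0<ε = begin-strict
    ½ * ε          ≡⟨ ℚₚ.+-identityʳ _ ⟨
    ½ * ε + 0ℚ     <⟨ ℚₚ.+-monoʳ-< (½ * ε) (half-pos 0<ε) ⟩
    ½ * ε + ½ * ε  ≡⟨ half-sum ε ⟩
    ε              ∎

  p≤∣p∣ : ∀ p → p ≤ ∣ p ∣
  p≤∣p∣ p with ℚₚ.≤-total 0ℚ p
  ... | inj₁ 0≤p = ℚₚ.≤-reflexive (sym (ℚₚ.0≤p⇒∣p∣≡p 0≤p))
  ... | inj₂ p≤0 = ℚₚ.≤-trans p≤0 (ℚₚ.0≤∣p∣ p)

  -p≤∣p∣ : ∀ p → - p ≤ ∣ p ∣
  -p≤∣p∣ p = ℚₚ.≤-trans (p≤∣p∣ (- p)) (ℚₚ.≤-reflexive (ℚₚ.∣-p∣≡∣p∣ p))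

  ∣∣-lub : ∀ {p r} → p ≤ r → - p ≤ r → ∣ p ∣ ≤ r
  ∣∣-lub {p} p≤r -p≤r with ℚₚ.∣p∣≡p∨∣p∣≡-p p
  ... | inj₁ eq = ℚₚ.≤-trans (ℚₚ.≤-reflexive eq) p≤r
  ... | inj₂ eq = ℚₚ.≤-trans (ℚₚ.≤-reflexive eq) -p≤r

  ∣p-q∣≡∣q-p∣ : ∀ p q → ∣ p - q ∣ ≡ ∣ q - p ∣
  ∣p-q∣≡∣q-p∣ p q = trans (sym (ℚₚ.∣-p∣≡∣p∣ (p - q)))
    (cong ∣_∣ (solve 2 (λ p q → :- (p :- q) := q :- p) refl p q))

  ∣p∣≤∣p-q∣+∣q∣ : ∀ p q → ∣ p ∣ ≤ ∣ p - q ∣ + ∣ q ∣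
  ∣p∣≤∣p-q∣+∣q∣ p q = begin
    ∣ p ∣              ≡⟨ cong ∣_∣ (solve 2 (λ p q → p := (p :- q) :+ q) refl p q) ⟩
    ∣ (p - q) + q ∣    ≤⟨ ℚₚ.∣p+q∣≤∣p∣+∣q∣ (p - q) q ⟩
    ∣ p - q ∣ + ∣ q ∣  ∎

  triangle : ∀ p q r → ∣ p - r ∣ ≤ ∣ p - q ∣ + ∣ r - q ∣
  triangle p q r = begin
    ∣ p - r ∣                  ≡⟨ cong ∣_∣ (solve 3 (λ p q r → p :- r := (p :- q) :- (r :- q)) refl p q r) ⟩
    ∣ (p - q) - (r - q) ∣      ≤⟨ ℚₚ.∣p-q∣≤∣p∣+∣q∣ (p - q) (r - q) ⟩
    ∣ p - q ∣ + ∣ r - q ∣      ∎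

  ∣∣p∣-∣q∣∣≤∣p-q∣ : ∀ p q → ∣ ∣ p ∣ - ∣ q ∣ ∣ ≤ ∣ p - q ∣
  ∣∣p∣-∣q∣∣≤∣p-q∣ p q = ∣∣-lub (move p q)
    (begin
      - (∣ p ∣ - ∣ q ∣)  ≡⟨ solve 2 (λ a b → :- (a :- b) := b :- a) refl ∣ p ∣ ∣ q ∣ ⟩
      ∣ q ∣ - ∣ p ∣      ≤⟨ move q p ⟩
      ∣ q - p ∣          ≡⟨ ∣p-q∣≡∣q-p∣ q p ⟩
      ∣ p - q ∣          ∎)
    where
    move : ∀ p q → ∣ p ∣ - ∣ q ∣ ≤ ∣ p - q ∣
    move p q = begin
      ∣ p ∣ - ∣ q ∣                ≤⟨ ℚₚ.+-monoˡ-≤ (- ∣ q ∣) (∣p∣≤∣p-q∣+∣q∣ p q) ⟩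
      (∣ p - q ∣ + ∣ q ∣) - ∣ q ∣  ≡⟨ solve 2 (λ a b → (a :+ b) :- b := a) refl ∣ p - q ∣ ∣ q ∣ ⟩
      ∣ p - q ∣                    ∎

  *-mono-≤∣∣ : ∀ {a b} (p : ℚ) → a ≤ b → ∣ p ∣ * a ≤ ∣ p ∣ * b
  *-mono-≤∣∣ p = ℚₚ.*-monoˡ-≤-nonNeg ∣ p ∣ {{ℚₚ.∣-∣-nonNeg p}}

  module _ {δ} (0<δ : 0ℚ < δ) where
    inverse : ℚ
    inverse = ℚ.1/_ δ {{ℚ.>-nonZero 0<δ}}

    inverseʳ : δ * inverse ≡ 1ℚ
    inverseʳ = ℚₚ.*-inverseʳ δ {{ℚ.>-nonZero 0<δ}}

    inverse-pos : 0ℚ < inverse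
    inverse-pos = ℚₚ.positive⁻¹ _ {{ℚₚ.1/pos⇒pos δ {{ℚ.positive 0<δ}}}}

  -- |p| < M and |q| < ε / M give |p| |q| < ε
  bounded-* : ∀ {M ε} p q (0<M : 0ℚ < M) → ∣ p ∣ < M →
              ∣ q ∣ < ε * inverse 0<M → ∣ p * q ∣ < ε
  bounded-* {M} {ε} p q 0<M p<M q<ε/M = begin-strict
    ∣ p * q ∣                ≡⟨ ℚₚ.∣p*q∣≡∣p∣*∣q∣ p q ⟩
    ∣ p ∣ * ∣ q ∣            ≤⟨ ℚₚ.*-monoʳ-≤-nonNeg ∣ q ∣ {{ℚₚ.∣-∣-nonNeg q}} (ℚₚ.<⇒≤ p<M) ⟩
    M * ∣ q ∣                <⟨ ℚₚ.*-monoʳ-<-pos M {{ℚ.positive 0<M}} q<ε/M ⟩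
    M * (ε * inverse 0<M)    ≡⟨ solve 3 (λ m e i → m :* (e :* i) := e :* (m :* i)) refl M ε (inverse 0<M) ⟩
    ε * (M * inverse 0<M)    ≡⟨ cong (ε *_) (inverseʳ 0<M) ⟩
    ε * 1ℚ                   ≡⟨ ℚₚ.*-identityʳ ε ⟩
    ε                        ∎

open ℚ-Lemmas

-- The real numbers, as Cauchy sequences of rationals with a modulus.
-- Real equality is _≈_, not _≡_.
record ℝ : Set where
  constructor mkℝ
  field
    seq    : ℕ → ℚ
    cauchy : ∀ ε → 0ℚ ℚ.< ε →
             ∃[ N ] ∀ m n → N ℕ.≤ m → N ℕ.≤ n → ℚ.∣ seq m ℚ.- seq n ∣ ℚ.< ε

open ℝ

infix 4 _≈_ _<_ _#_

_≈_ : ℝ → ℝ → Set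
x ≈ y = ∀ ε → 0ℚ ℚ.< ε → ∃[ N ] ∀ n → N ℕ.≤ n → ℚ.∣ seq x n ℚ.- seq y n ∣ ℚ.< ε

_<_ : ℝ → ℝ → Set
x < y = ∃[ ε ] 0ℚ ℚ.< ε × ∃[ N ] ∀ n → N ℕ.≤ n → seq x n ℚ.+ ε ℚ.< seq y n

-- Constructive inequality; division is only defined by y with y # 0.
_#_ : ℝ → ℝ → Set
x # y = x < y ⊎ y < x

fromℚ : ℚ → ℝ
fromℚ q = mkℝ (λ _ → q) λ ε 0<ε → 0 , λ _ _ _ _ →
  subst (λ d → ℚ.∣ d ∣ ℚ.< ε) (sym (ℚₚ.+-inverseʳ q)) 0<ε

fromℕ : ℕ → ℝ
fromℕ n = fromℚ (+ n ℚ./ 1)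

infix  8 -_
infixl 7 _*_
infixl 6 _+_ _-_

_+_ : ℝ → ℝ → ℝ
x + y = mkℝ (λ n → seq x n ℚ.+ seq y n) λ ε 0<ε →
  let M , p = cauchy x (½ ℚ.* ε) (half-pos 0<ε)
      N , q = cauchy y (½ ℚ.* ε) (half-pos 0<ε)
  in M ℕ.⊔ N , λ m n M⊔N≤m M⊔N≤n →
    let a = seq x m ; b = seq y m ; c = seq x n ; d = seq y n in begin-strict
    ℚ.∣ (a ℚ.+ b) ℚ.- (c ℚ.+ d) ∣
      ≡⟨ cong ℚ.∣_∣ (solve 4 (λ a b c d → (a :+ b) :- (c :+ d) := (a :- c) :+ (b :- d)) refl a b c d) ⟩
    ℚ.∣ (a ℚ.- c) ℚ.+ (b ℚ.- d) ∣
      ≤⟨ ℚₚ.∣p+q∣≤∣p∣+∣q∣ (a ℚ.- c) (b ℚ.- d) ⟩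
    ℚ.∣ a ℚ.- c ∣ ℚ.+ ℚ.∣ b ℚ.- d ∣
      <⟨ ℚₚ.+-mono-< (p m n (ℕₚ.m⊔n≤o⇒m≤o M N M⊔N≤m) (ℕₚ.m⊔n≤o⇒m≤o M N M⊔N≤n))
                     (q m n (ℕₚ.m⊔n≤o⇒n≤o M N M⊔N≤m) (ℕₚ.m⊔n≤o⇒n≤o M N M⊔N≤n)) ⟩
    ½ ℚ.* ε ℚ.+ ½ ℚ.* ε
      ≡⟨ half-sum ε ⟩
    ε ∎
  where open ℚₚ.≤-Reasoning; open +-*-Solver

-_ : ℝ → ℝ
- x = mkℝ (λ n → ℚ.- seq x n) λ ε 0<ε →
  let N , p = cauchy x ε 0<ε
  in N , λ m n N≤m N≤n → subst (ℚ._< ε)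
       (trans (sym (ℚₚ.∣-p∣≡∣p∣ (seq x m ℚ.- seq x n)))
              (cong ℚ.∣_∣ (ℚₚ.neg-distrib-+ (seq x m) (ℚ.- seq x n))))
       (p m n N≤m N≤n)

_-_ : ℝ → ℝ → ℝ
x - y = x + (- y)

∣_∣ : ℝ → ℝ
∣ x ∣ = mkℝ (λ n → ℚ.∣ seq x n ∣) λ ε 0<ε →
  let N , p = cauchy x ε 0<ε
  in N , λ m n N≤m N≤n →
       ℚₚ.≤-<-trans (∣∣p∣-∣q∣∣≤∣p-q∣ (seq x m) (seq x n)) (p m n N≤m N≤n)

eventually-bounded : ∀ x → ∃[ M ] 0ℚ ℚ.< M × ∃[ N ] ∀ n → N ℕ.≤ n → ℚ.∣ seq x n ∣ ℚ.< M
eventually-bounded x =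
  let N , p = cauchy x 1ℚ (ℚₚ.positive⁻¹ 1ℚ)
      c = ℚ.∣ seq x N ∣
  in 1ℚ ℚ.+ c
   , ℚₚ.+-mono-<-≤ (ℚₚ.positive⁻¹ 1ℚ) (ℚₚ.0≤∣p∣ (seq x N))
   , N
   , λ n N≤n → ℚₚ.≤-<-trans (∣p∣≤∣p-q∣+∣q∣ (seq x n) (seq x N))
                            (ℚₚ.+-monoˡ-< c (p n N N≤n ℕₚ.≤-refl))

_*_ : ℝ → ℝ → ℝ
x * y = mkℝ (λ n → seq x n ℚ.* seq y n) λ ε 0<ε →
  let K , 0<K , N₁ , x<K = eventually-bounded x
      L , 0<L , N₂ , y<L = eventually-bounded y
      N₃ , p = cauchy x (½ ℚ.* ε ℚ.* inverse 0<L) (*-pos (half-pos 0<ε) (inverse-pos 0<L))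
      N₄ , q = cauchy y (½ ℚ.* ε ℚ.* inverse 0<K) (*-pos (half-pos 0<ε) (inverse-pos 0<K))
  in (N₁ ℕ.⊔ N₂) ℕ.⊔ (N₃ ℕ.⊔ N₄) , λ m n N≤m N≤n →
    let a = seq x m ; b = seq y m ; c = seq x n ; d = seq y n
        m≥₁₂ = ℕₚ.m⊔n≤o⇒m≤o (N₁ ℕ.⊔ N₂) (N₃ ℕ.⊔ N₄) N≤m
        m≥₃₄ = ℕₚ.m⊔n≤o⇒n≤o (N₁ ℕ.⊔ N₂) (N₃ ℕ.⊔ N₄) N≤m
        n≥₁₂ = ℕₚ.m⊔n≤o⇒m≤o (N₁ ℕ.⊔ N₂) (N₃ ℕ.⊔ N₄) N≤n
        n≥₃₄ = ℕₚ.m⊔n≤o⇒n≤o (N₁ ℕ.⊔ N₂) (N₃ ℕ.⊔ N₄) N≤n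
    in begin-strict
    ℚ.∣ a ℚ.* b ℚ.- c ℚ.* d ∣
      ≡⟨ cong ℚ.∣_∣ (solve 4 (λ a b c d → a :* b :- c :* d := a :* (b :- d) :+ d :* (a :- c)) refl a b c d) ⟩
    ℚ.∣ a ℚ.* (b ℚ.- d) ℚ.+ d ℚ.* (a ℚ.- c) ∣
      ≤⟨ ℚₚ.∣p+q∣≤∣p∣+∣q∣ (a ℚ.* (b ℚ.- d)) (d ℚ.* (a ℚ.- c)) ⟩
    ℚ.∣ a ℚ.* (b ℚ.- d) ∣ ℚ.+ ℚ.∣ d ℚ.* (a ℚ.- c) ∣
      <⟨ ℚₚ.+-mono-<
           (bounded-* {ε = ½ ℚ.* ε} a (b ℚ.- d) 0<K (x<K m (ℕₚ.m⊔n≤o⇒m≤o N₁ N₂ m≥₁₂))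
             (q m n (ℕₚ.m⊔n≤o⇒n≤o N₃ N₄ m≥₃₄) (ℕₚ.m⊔n≤o⇒n≤o N₃ N₄ n≥₃₄)))
           (bounded-* {ε = ½ ℚ.* ε} d (a ℚ.- c) 0<L (y<L n (ℕₚ.m⊔n≤o⇒n≤o N₁ N₂ n≥₁₂))
             (p m n (ℕₚ.m⊔n≤o⇒m≤o N₃ N₄ m≥₃₄) (ℕₚ.m⊔n≤o⇒m≤o N₃ N₄ n≥₃₄))) ⟩
    ½ ℚ.* ε ℚ.+ ½ ℚ.* ε
      ≡⟨ half-sum ε ⟩
    ε ∎
  where open ℚₚ.≤-Reasoning; open +-*-Solver

-- The value at 0 is immaterial: a sequence representing a real # 0 is
-- eventually bounded away from 0.
recip : ℚ → ℚ
recip q with q ℚₚ.≟ 0ℚ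
... | yes _   = 0ℚ
... | no  q≢0 = ℚ.1/_ q {{ℚ.≢-nonZero q≢0}}

recip-inverseʳ : ∀ q → q ≢ 0ℚ → q ℚ.* recip q ≡ 1ℚ
recip-inverseʳ q q≢0 with q ℚₚ.≟ 0ℚ
... | yes q≡0 = contradiction q≡0 q≢0
... | no  q≢0′ = ℚₚ.*-inverseʳ q {{ℚ.≢-nonZero q≢0′}}

bounded-away : ∀ x → x # fromℚ 0ℚ →
               ∃[ δ ] 0ℚ ℚ.< δ × ∃[ N ] ∀ n → N ℕ.≤ n → δ ℚ.< ℚ.∣ seq x n ∣
bounded-away x (inj₂ (δ , 0<δ , N , p)) = δ , 0<δ , N , λ n N≤n →
  ℚₚ.<-≤-trans (subst (ℚ._< seq x n) (ℚₚ.+-identityˡ δ) (p n N≤n)) (p≤∣p∣ (seq x n))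
bounded-away x (inj₁ (δ , 0<δ , N , p)) = δ , 0<δ , N , λ n N≤n → begin-strict
  δ                              ≡⟨ solve 2 (λ d a → d := (a :+ d) :- a) refl δ (seq x n) ⟩
  (seq x n ℚ.+ δ) ℚ.- seq x n    <⟨ ℚₚ.+-monoˡ-< (ℚ.- seq x n) (p n N≤n) ⟩
  0ℚ ℚ.- seq x n                 ≡⟨ ℚₚ.+-identityˡ _ ⟩
  ℚ.- seq x n                    ≤⟨ -p≤∣p∣ (seq x n) ⟩
  ℚ.∣ seq x n ∣                  ∎
  where open ℚₚ.≤-Reasoning; open +-*-Solver

inv : (x : ℝ) → x # fromℚ 0ℚ → ℝ
inv x x#0 = mkℝ (λ n → recip (seq x n)) λ ε 0<ε →
  let δ , 0<δ , N₁ , δ<x = bounded-away x x#0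
      D   = inverse 0<δ
      0<D = inverse-pos 0<δ
      0<D*2 = *-pos 0<D 0<D
      N₂ , p = cauchy x (ε ℚ.* inverse 0<D*2) (*-pos 0<ε (inverse-pos 0<D*2))
  in N₁ ℕ.⊔ N₂ , λ m n N≤m N≤n →
    let a = seq x m ; b = seq x n
        δ<a = δ<x m (ℕₚ.m⊔n≤o⇒m≤o N₁ N₂ N≤m)
        δ<b = δ<x n (ℕₚ.m⊔n≤o⇒m≤o N₁ N₂ N≤n)
        a≢0 = away 0<δ a δ<a
        b≢0 = away 0<δ b δ<b
        A = recip a ; B = recip b
    in begin-strict
    ℚ.∣ A ℚ.- B ∣
      ≡⟨ cong ℚ.∣_∣ (cong₂ ℚ._-_ (trans (sym (ℚₚ.*-identityʳ A)) (cong (A ℚ.*_) (sym (recip-inverseʳ b b≢0))))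
                                 (trans (sym (ℚₚ.*-identityʳ B)) (cong (B ℚ.*_) (sym (recip-inverseʳ a a≢0))))) ⟩
    ℚ.∣ A ℚ.* (b ℚ.* B) ℚ.- B ℚ.* (a ℚ.* A) ∣
      ≡⟨ cong ℚ.∣_∣ (solve 4 (λ a b A B → A :* (b :* B) :- B :* (a :* A) := :- ((A :* B) :* (a :- b))) refl a b A B) ⟩
    ℚ.∣ ℚ.- ((A ℚ.* B) ℚ.* (a ℚ.- b)) ∣
      ≡⟨ ℚₚ.∣-p∣≡∣p∣ ((A ℚ.* B) ℚ.* (a ℚ.- b)) ⟩
    ℚ.∣ (A ℚ.* B) ℚ.* (a ℚ.- b) ∣
      ≡⟨ trans (ℚₚ.∣p*q∣≡∣p∣*∣q∣ (A ℚ.* B) (a ℚ.- b)) (cong (ℚ._* ℚ.∣ a ℚ.- b ∣) (ℚₚ.∣p*q∣≡∣p∣*∣q∣ A B)) ⟩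
    (ℚ.∣ A ∣ ℚ.* ℚ.∣ B ∣) ℚ.* ℚ.∣ a ℚ.- b ∣
      ≤⟨ ℚₚ.*-monoʳ-≤-nonNeg ℚ.∣ a ℚ.- b ∣ {{ℚₚ.∣-∣-nonNeg (a ℚ.- b)}}
           (ℚₚ.≤-trans (*-mono-≤∣∣ A (recip≤ 0<δ b δ<b))
                       (ℚₚ.*-monoʳ-≤-nonNeg D {{ℚ.nonNegative (ℚₚ.<⇒≤ 0<D)}} (recip≤ 0<δ a δ<a))) ⟩
    (D ℚ.* D) ℚ.* ℚ.∣ a ℚ.- b ∣
      <⟨ ℚₚ.*-monoʳ-<-pos (D ℚ.* D) {{ℚ.positive 0<D*2}}
           (p m n (ℕₚ.m⊔n≤o⇒n≤o N₁ N₂ N≤m) (ℕₚ.m⊔n≤o⇒n≤o N₁ N₂ N≤n)) ⟩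
    (D ℚ.* D) ℚ.* (ε ℚ.* inverse 0<D*2)
      ≡⟨ solve 3 (λ m e i → m :* (e :* i) := e :* (m :* i)) refl (D ℚ.* D) ε (inverse 0<D*2) ⟩
    ε ℚ.* ((D ℚ.* D) ℚ.* inverse 0<D*2)
      ≡⟨ trans (cong (ε ℚ.*_) (inverseʳ 0<D*2)) (ℚₚ.*-identityʳ ε) ⟩
    ε ∎
  where
  open ℚₚ.≤-Reasoning
  open +-*-Solver
  away : ∀ {δ} → 0ℚ ℚ.< δ → ∀ a → δ ℚ.< ℚ.∣ a ∣ → a ≢ 0ℚ
  away 0<δ a δ<a refl = ℚₚ.<-asym 0<δ δ<a
  recip≤ : ∀ {δ} (0<δ : 0ℚ ℚ.< δ) a → δ ℚ.< ℚ.∣ a ∣ → ℚ.∣ recip a ∣ ℚ.≤ inverse 0<δ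
  recip≤ {δ} 0<δ a δ<a = begin
    ℚ.∣ A ∣                          ≡⟨ ℚₚ.*-identityʳ _ ⟨
    ℚ.∣ A ∣ ℚ.* 1ℚ                   ≡⟨ cong (ℚ.∣ A ∣ ℚ.*_) (inverseʳ 0<δ) ⟨
    ℚ.∣ A ∣ ℚ.* (δ ℚ.* D)            ≤⟨ *-mono-≤∣∣ A (ℚₚ.*-monoʳ-≤-nonNeg D {{ℚ.nonNegative (ℚₚ.<⇒≤ (inverse-pos 0<δ))}} (ℚₚ.<⇒≤ δ<a)) ⟩
    ℚ.∣ A ∣ ℚ.* (ℚ.∣ a ∣ ℚ.* D)      ≡⟨ solve 3 (λ p q r → p :* (q :* r) := (q :* p) :* r) refl ℚ.∣ A ∣ ℚ.∣ a ∣ D ⟩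
    (ℚ.∣ a ∣ ℚ.* ℚ.∣ A ∣) ℚ.* D      ≡⟨ cong (ℚ._* D) (trans (sym (ℚₚ.∣p*q∣≡∣p∣*∣q∣ a A)) (cong ℚ.∣_∣ (recip-inverseʳ a (away 0<δ a δ<a)))) ⟩
    1ℚ ℚ.* D                         ≡⟨ ℚₚ.*-identityˡ D ⟩
    D                                ∎
    where
    A = recip a
    D = inverse 0<δ

ℝ-rawRing : RawRing 0ℓ 0ℓ
ℝ-rawRing = record
  { _≈_ = _≈_ ; _+_ = _+_ ; _*_ = _*_ ; -_ = -_ ; 0# = fromℚ 0ℚ ; 1# = fromℚ 1ℚ }

open RawSemiringDefs (RawRing.rawSemiring ℝ-rawRing) public using (_^_)

0ℝ 1ℝ : ℝ
0ℝ = RawRing.0# ℝ-rawRing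
1ℝ = RawRing.1# ℝ-rawRing

-- x / y [ y#0 ] is the quotient of x by y.
infixl 7 _/_[_]
_/_[_] : (x y : ℝ) → y # 0ℝ → ℝ
x / y [ y#0 ] = x * inv y y#0

0<⇒# : ∀ x → 0ℝ < x → x # 0ℝ
0<⇒# x = inj₂

0<fromℚ : ∀ q → 0ℚ ℚ.< q → 0ℝ < fromℚ q
0<fromℚ q 0<q = ½ ℚ.* q , half-pos 0<q , 0 , λ _ _ →
  subst (ℚ._< q) (sym (ℚₚ.+-identityˡ _)) (half< 0<q)

0<+ : ∀ x y → 0ℝ < x → 0ℝ < y → 0ℝ < x + y
0<+ x y (δ , 0<δ , M , p) (η , 0<η , N , q) =
  δ , 0<δ , M ℕ.⊔ N , λ n M⊔N≤n →
    subst (ℚ._< seq x n ℚ.+ seq y n) (ℚₚ.+-identityʳ _)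
      (ℚₚ.+-mono-< (p n (ℕₚ.m⊔n≤o⇒m≤o M N M⊔N≤n))
        (ℚₚ.<-trans (ℚₚ.<-respʳ-≡ (sym (ℚₚ.+-identityˡ η)) 0<η) (q n (ℕₚ.m⊔n≤o⇒n≤o M N M⊔N≤n))))

0<* : ∀ x y → 0ℝ < x → 0ℝ < y → 0ℝ < x * y
0<* x y (δ , 0<δ , M , p) (η , 0<η , N , q) =
  δ ℚ.* η , *-pos 0<δ 0<η , M ℕ.⊔ N , λ n M⊔N≤n →
    let δ<a = subst (ℚ._< seq x n) (ℚₚ.+-identityˡ δ) (p n (ℕₚ.m⊔n≤o⇒m≤o M N M⊔N≤n))
        η<b = subst (ℚ._< seq y n) (ℚₚ.+-identityˡ η) (q n (ℕₚ.m⊔n≤o⇒n≤o M N M⊔N≤n))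
    in begin-strict
    0ℚ ℚ.+ δ ℚ.* η       ≡⟨ ℚₚ.+-identityˡ _ ⟩
    δ ℚ.* η              <⟨ ℚₚ.*-monoʳ-<-pos δ {{ℚ.positive 0<δ}} η<b ⟩
    δ ℚ.* seq y n        <⟨ ℚₚ.*-monoˡ-<-pos (seq y n) {{ℚ.positive (ℚₚ.<-trans 0<η η<b)}} δ<a ⟩
    seq x n ℚ.* seq y n  ∎
  where open ℚₚ.≤-Reasoning

0<^ : ∀ x → 0ℝ < x → ∀ n → 0ℝ < x ^ n
0<^ x 0<x zero    = 0<fromℚ 1ℚ (ℚₚ.positive⁻¹ 1ℚ)
0<^ x 0<x (suc n) = 0<* x (x ^ n) 0<x (0<^ x 0<x n)

0<fromℕ : ∀ n .{{_ : ℕ.NonZero n}} → 0ℝ < fromℕ n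
0<fromℕ n = 0<fromℚ (+ n ℚ./ 1) (ℚₚ.positive⁻¹ (+ n ℚ./ 1) {{ℚₚ.normalize-pos n 1}})

-- ∑_{n ≥ 0} f n converges, with sum s
HasSum : (ℕ → ℝ) → ℝ → Set
HasSum f s = ∀ ε → 0ℝ < ε →
  ∃[ N ] ∀ n → N ℕ.≤ n → ∣ ∑< (RawRing.+-rawMonoid ℝ-rawRing) n f - s ∣ < ε

-- L is the limit at a of a function f defined on {x | D x}
HasLimit : (D : ℝ → Set) → (∀ x → D x → ℝ) → ℝ → ℝ → Set
HasLimit D f a L = ∀ ε → 0ℝ < ε →
  ∃[ δ ] 0ℝ < δ × (∀ x (d : D x) → x # a → ∣ x - a ∣ < δ → ∣ f x d - L ∣ < ε)

-- π, by Leibniz' series π / 4 = 1 − 1/3 + 1/5 − ⋯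
module Leibniz where
  open +-*-Solver
  open ℚₚ.≤-Reasoning
  open RawSemiringDefs ℚ.+-*-rawSemiring using () renaming (_^_ to _^ℚ_)

  term : ℕ → ℚ
  term i = + 1 ℚ./ suc (2 ℕ.* i)

  partialSum : ℕ → ℚ
  partialSum n = ∑< ℚ.+-0-rawMonoid n λ i → (ℚ.- 1ℚ) ^ℚ i ℚ.* term i

  unnorm : ∀ k → ℚ.toℚᵘ (+ 1 ℚ./ suc k) ℚᵘ.≃ mkℚᵘ (+ 1) k
  unnorm k = ℚₚ.toℚᵘ-fromℚᵘ (mkℚᵘ (+ 1) k)

  term-pos : ∀ i → 0ℚ ℚ.≤ term i
  term-pos i = ℚₚ.nonNegative⁻¹ (term i) {{ℚₚ.normalize-nonNeg 1 (suc (2 ℕ.* i))}}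

  term-anti : ∀ i → term (suc i) ℚ.≤ term i
  term-anti i = ℚₚ.toℚᵘ-cancel-≤
    (ℚᵘₚ.≤-respˡ-≃ (ℚᵘₚ.≃-sym (unnorm (2 ℕ.* suc i)))
      (ℚᵘₚ.≤-respʳ-≃ (ℚᵘₚ.≃-sym (unnorm (2 ℕ.* i)))
        (ℚᵘ.*≤* (ℤₚ.*-monoˡ-≤-nonNeg (+ 1) (ℤ.+≤+ (ℕ.s≤s (ℕₚ.*-monoʳ-≤ 2 (ℕₚ.n≤1+n i))))))))

  term-small : ∀ ε → 0ℚ ℚ.< ε → ∃[ N ] term N ℚ.< ε
  term-small (mkℚ (+ zero) d c) (ℚ.*<* p) = contradiction p (ℤₚ.<-irrefl refl)
  term-small (mkℚ (ℤ.-[1+ a ]) d c) (ℚ.*<* ())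
  term-small (mkℚ (+ suc a) d c) 0<ε = suc d , ℚₚ.toℚᵘ-cancel-<
    (ℚᵘₚ.<-respˡ-≃ (ℚᵘₚ.≃-sym (unnorm (2 ℕ.* suc d)))
      (ℚᵘ.*<* (ℤ.+<+ (ℕₚ.≤-trans (ℕ.s≤s (ℕ.s≤s (ℕₚ.≤-reflexive (ℕₚ.+-identityʳ d))))
                     (ℕₚ.≤-trans (ℕ.s≤s (ℕₚ.m≤m+n (suc d) _))
                       (ℕₚ.m≤n*m _ (suc a)))))))

  tail : ℕ → ℕ → ℚ
  tail m zero    = 0ℚ
  tail m (suc d) = term m ℚ.- tail (suc m) d

  tail-bounds : ∀ m d → 0ℚ ℚ.≤ tail m d × tail m d ℚ.≤ term m
  tail-bounds m zero    = ℚₚ.≤-refl , term-pos m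
  tail-bounds m (suc d) =
    let lo , hi = tail-bounds (suc m) d
        t = tail (suc m) d
    in (begin
          0ℚ             ≡⟨ ℚₚ.+-inverseʳ t ⟨
          t ℚ.- t        ≤⟨ ℚₚ.+-monoˡ-≤ (ℚ.- t) (ℚₚ.≤-trans hi (term-anti m)) ⟩
          term m ℚ.- t   ∎)
     , (begin
          term m ℚ.- t   ≤⟨ ℚₚ.+-monoʳ-≤ (term m) (ℚₚ.neg-antimono-≤ lo) ⟩
          term m ℚ.- 0ℚ  ≡⟨ ℚₚ.+-identityʳ (term m) ⟩
          term m         ∎)

  partialSum-+ : ∀ d m → partialSum (d ℕ.+ m) ≡ partialSum m ℚ.+ (ℚ.- 1ℚ) ^ℚ m ℚ.* tail m d
  partialSum-+ zero    m =
    solve 2 (λ S s → S := S :+ s :* con 0ℚ) refl (partialSum m) ((ℚ.- 1ℚ) ^ℚ m)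
  partialSum-+ (suc d) m = trans (cong partialSum (sym (ℕₚ.+-suc d m)))
    (trans (partialSum-+ d (suc m))
      (solve 4 (λ S s a t → (S :+ s :* a) :+ (con (ℚ.- 1ℚ) :* s) :* t := S :+ s :* (a :- t)) refl
        (partialSum m) ((ℚ.- 1ℚ) ^ℚ m) (term m) (tail (suc m) d)))

  ∣sign∣ : ∀ m → ℚ.∣ (ℚ.- 1ℚ) ^ℚ m ∣ ≡ 1ℚ
  ∣sign∣ zero    = refl
  ∣sign∣ (suc m) = trans (ℚₚ.∣p*q∣≡∣p∣*∣q∣ (ℚ.- 1ℚ) ((ℚ.- 1ℚ) ^ℚ m)) (trans (ℚₚ.*-identityˡ _) (∣sign∣ m))

  close : ∀ N n → N ℕ.≤ n → ℚ.∣ partialSum n ℚ.- partialSum N ∣ ℚ.≤ term N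
  close N n N≤n = begin
    ℚ.∣ partialSum n ℚ.- S ∣
      ≡⟨ cong (λ k → ℚ.∣ partialSum k ℚ.- S ∣) (sym (ℕₚ.m∸n+n≡m N≤n)) ⟩
    ℚ.∣ partialSum (d ℕ.+ N) ℚ.- S ∣
      ≡⟨ cong (λ q → ℚ.∣ q ℚ.- S ∣) (partialSum-+ d N) ⟩
    ℚ.∣ (S ℚ.+ s ℚ.* tail N d) ℚ.- S ∣
      ≡⟨ cong ℚ.∣_∣ (solve 2 (λ S u → (S :+ u) :- S := u) refl S (s ℚ.* tail N d)) ⟩
    ℚ.∣ s ℚ.* tail N d ∣
      ≡⟨ trans (ℚₚ.∣p*q∣≡∣p∣*∣q∣ s (tail N d)) (trans (cong (ℚ._* ℚ.∣ tail N d ∣) (∣sign∣ N)) (ℚₚ.*-identityˡ _)) ⟩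
    ℚ.∣ tail N d ∣
      ≡⟨ ℚₚ.0≤p⇒∣p∣≡p (proj₁ (tail-bounds N d)) ⟩
    tail N d
      ≤⟨ proj₂ (tail-bounds N d) ⟩
    term N ∎
    where
    d = n ℕ.∸ N
    S = partialSum N
    s = (ℚ.- 1ℚ) ^ℚ N

  π/4 : ℝ
  π/4 = mkℝ partialSum λ ε 0<ε →
    let N , small = term-small (½ ℚ.* ε) (half-pos 0<ε)
    in N , λ m n N≤m N≤n → begin-strict
      ℚ.∣ partialSum m ℚ.- partialSum n ∣
        ≤⟨ triangle (partialSum m) (partialSum N) (partialSum n) ⟩
      ℚ.∣ partialSum m ℚ.- partialSum N ∣ ℚ.+ ℚ.∣ partialSum n ℚ.- partialSum N ∣
        ≤⟨ ℚₚ.+-mono-≤ (close N m N≤m) (close N n N≤n) ⟩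
      term N ℚ.+ term N
        <⟨ ℚₚ.+-mono-< small small ⟩
      ½ ℚ.* ε ℚ.+ ½ ℚ.* ε
        ≡⟨ half-sum ε ⟩
      ε ∎

  0<π/4 : 0ℝ < π/4
  0<π/4 = ½ , 0<½ , 2 , λ n 2≤n → begin-strict
    0ℚ ℚ.+ ½
      <⟨ from-yes ((0ℚ ℚ.+ ½) ℚₚ.<? partialSum 2) ⟩
    partialSum 2
      ≡⟨ ℚₚ.+-identityʳ _ ⟨
    partialSum 2 ℚ.+ 0ℚ
      ≤⟨ ℚₚ.+-monoʳ-≤ (partialSum 2) (proj₁ (tail-bounds 2 (n ℕ.∸ 2))) ⟩
    partialSum 2 ℚ.+ tail 2 (n ℕ.∸ 2)
      ≡⟨ cong (partialSum 2 ℚ.+_) (sym (ℚₚ.*-identityˡ (tail 2 (n ℕ.∸ 2)))) ⟩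
    partialSum 2 ℚ.+ (ℚ.- 1ℚ) ^ℚ 2 ℚ.* tail 2 (n ℕ.∸ 2)
      ≡⟨ partialSum-+ (n ℕ.∸ 2) 2 ⟨
    partialSum (n ℕ.∸ 2 ℕ.+ 2)
      ≡⟨ cong partialSum (ℕₚ.m∸n+n≡m 2≤n) ⟩
    partialSum n ∎

-- Overloaded numerals from here on; tt is the instance for their constraint.
open import Agda.Builtin.FromNat public using (fromNat)
open import Data.Unit public using (tt)

instance
  ℕ-number : Number ℕ
  ℕ-number = ℕ-Literals.number

  ℝ-number : Number ℝ
  ℝ-number = record { Constraint = λ _ → ⊤ ; fromNat = λ n → fromℕ n }

π : ℝ
π = 4 * Leibniz.π/4

0<π : 0ℝ < π
0<π = 0<* 4 Leibniz.π/4 (0<fromℕ 4) Leibniz.0<π/4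

-- (a)ⱼ = a (a + 1) ⋯ (a + j − 1)
rising : ℤ → ℕ → ℤ
rising a zero    = + 1
rising a (suc j) = rising a j ℤ.* (a ℤ.+ + j)

-- ₂F₁(−n, n + 1; 1; (1 − x)/2).  The series terminates because (−n)ⱼ = 0
-- for j > n; the denominator is (1)ⱼ j! = j! j!.
legendre : ℕ → ℝ → ℝ
legendre n x = ∑< (RawRing.+-rawMonoid ℝ-rawRing) (suc n) λ j →
  fromℚ (coeff j) * ((1 - x) * fromℚ ½) ^ j
  where
  coeff : ℕ → ℚ
  coeff j = ((rising (ℤ.- + n) j ℤ.* rising (+ suc n) j) ℚ./ (j ! ℕ.* j !)) {{j ℕₚ.!* j !≢0}}

C₃ C₂ C₁ C₀ : ℝ → ℝ
C₃ k = 4 * (k - 1) ^ 2 * k ^ 2 * (k ^ 2 + 3 * k + 4) ^ 2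
C₂ k = 12 * (k - 1) * k *
       (k ^ 6 + 5 * k ^ 5 + 10 * k ^ 4 + 10 * k ^ 3 + 5 * k ^ 2 - 3 * k + 4)
C₁ k = 9 * k ^ 8 + 36 * k ^ 7 + 37 * k ^ 6 + 8 * k ^ 5 - 9 * k ^ 4
       - 56 * k ^ 3 + 63 * k ^ 2 - 28 * k + 4
C₀ k = (k ^ 2 + 2 * k - 1) ^ 2 * (2 * k ^ 4 + 3 * k ^ 2 - 2 * k + 1)

numerator denominator : ℝ → ℝ
numerator   k = - (k ^ 4) + 6 * k ^ 3 - 2 * k + 1
denominator k = (k ^ 2 + 1) * (k ^ 2 + 2 * k - 1)

16[k+1]²#0 : ∀ k → 0ℝ < k → 16 * (k + 1) ^ 2 # 0ℝ
16[k+1]²#0 k 0<k = 0<⇒# (16 * (k + 1) ^ 2)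
  (0<* 16 ((k + 1) ^ 2) (0<fromℕ 16) (0<^ (k + 1) (0<+ k 1 0<k (0<fromℕ 1)) 2))

legendreProduct : ℕ → (k : ℝ) → 0ℝ < k → denominator k # 0ℝ → ℝ
legendreProduct n k 0<k d#0 =
  legendre n (numerator k / denominator k [ d#0 ]) *
  (denominator k / (16 * (k + 1) ^ 2) [ 16[k+1]²#0 k 0<k ]) ^ n

InDomain : ℝ → Set
InDomain k = 0ℝ < k × k < 1ℝ × denominator k # 0ℝ

-- t is the value of the product at k ∈ (0,1), extended by its limit to
-- √2 − 1, the only zero of the denominator there.  Equality with √2 − 1 is not
-- decidable for constructive reals, so this is a relation rather than a
-- function defined by cases; it determines t up to _≈_.
IsLegendreProduct : ℕ → (k : ℝ) → 0ℝ < k → ℝ → Set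
IsLegendreProduct n k 0<k t =
  (∀ d#0 → t ≈ legendreProduct n k 0<k d#0) ×
  (denominator k ≈ 0ℝ →
     HasLimit InDomain (λ { k′ (0<k′ , _ , d#0) → legendreProduct n k′ 0<k′ d#0 }) k t)

{-# OPTIONS --safe #-}
module Submission where

-- Write Aₙ = (2n choose n)² / 16ⁿ, u = (1 − k)³ / (1 + k), v = 4k³ / (1 + k)², X = u + v and
-- z = v − u.  The n-th product of the statement is Lₙ / 16ⁿ, where Lₙ = zⁿ Pₙ(X / z) satisfies a
-- three-term recurrence with coefficients polynomial in X and z², so that k = √2 − 1 is harmless.
--
-- Brafman's formula ∑ Aₙ Lₙ = F(k²) F(((1 − k) / (1 + k))²), F = ₂F₁(½, ½; 1; ·), explains the
-- result: up to a factor 2 / (1 + k) on the second one, both factors satisfy the same second-order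
-- equation in k, and their Wronskian is, up to normalisation,
--   V(k) = (1 + k)⁻¹ ∑ Aₙ ((α n + 2k(1 − k)) Lₙ + β n z Lₙ₋₁),  α = 1 + 6k − 5k²,  β = 1 − 2k − k².
-- The formula itself is not needed, because everything telescopes: the cubic weight of the
-- statement is (1 + k)³ (k² + 1) times the summand of V plus a difference in n, and the terms of
-- dV/dk are such differences too, whence V is constant.  As k → 0, V tends to 2 lim n Aₙ, and
-- n Aₙ → 1/π by Wallis' product, which is tied to Leibniz' series by a finite partial fraction
-- expansion.
--
-- All estimates are made at rational k, uniformly on compact subintervals of (0, 1), and then
-- applied to the terms of the Cauchy sequence representing a real k.

-- The derivation 2k(1 - k²) d/dk is chosen because it clears the poles of the logarithmic
-- derivatives of u and v: X and z then satisfy a linear system with polynomial coefficients, and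
-- the pair (Lₙ, z Lₙ₋₁) is closed under it. The obstacle is an exchange of limits. The decay of Lₙ
-- is uniform in k only away from 0 and 1, while the constant is read off near 0. So a point k₀ = η²
-- is fixed before the number of terms grows, and V is carried from k₀ to k. Near k₀ the linear
-- weight almost telescopes because z is close to -1; what remains is 12k ∑ Lₙ ≈ 3 against -1, the
-- origin of the factor 2 in the limit of V. Algebraic claims are polynomial identities modulo the
-- recurrences, with explicit cofactors; most inequalities are identities with a visibly nonnegative
-- remainder.

module Rational where
  open import Algebra.Bundles.Raw using (module RawRing)
  import Algebra.Solver.Ring
  open import Algebra.Solver.Ring.AlmostCommutativeRing using (fromCommutativeRing; _-Raw-AlmostCommutative⟶_)
  open import Data.Fin as Fin using (Fin)
  open import Data.Integer as ℤ using (ℤ; +_)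
  import Data.Integer.Properties as ℤₚ
  open import Data.Maybe using (Maybe; just; nothing)
  open import Data.Nat as ℕ using (ℕ; zero; suc; _!)
  open import Data.Nat.Combinatorics using (_C_; nCk≡n!/k![n-k]!; k![n∸k]!∣n!)
  open import Data.Nat.DivMod using (m/n*n≡m)
  import Data.Nat.Properties as ℕₚ
  open import Data.Product using (∃-syntax; _×_; _,_; proj₁; proj₂)
  open import Data.Rational as ℚ using (ℚ; 0ℚ; 1ℚ; ½; _+_; _*_; _-_; -_; _≤_; _<_; ∣_∣)
  import Data.Rational.Properties as ℚₚ
  open import Data.Rational.Unnormalised as ℚᵘ using (mkℚᵘ; *≡*)
  import Data.Rational.Unnormalised.Properties as ℚᵘₚ
  open import Data.Sum using (inj₁; inj₂)
  open import Data.Vec using (Vec; []; _∷_; lookup)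
  open import Relation.Binary.PropositionalEquality
  open import Relation.Nullary using (yes; no; contradiction)
  open import Algebra.Definitions.RawSemiring ℚ.+-*-rawSemiring using (_^_)
  import Defs
  open Defs using
    ( ∑<; recip; recip-inverseʳ; rising; module Leibniz; module ℚ-Lemmas
    ; ℝ; mkℝ; fromℚ; fromℕ; legendreProduct; legendre; numerator; denominator; 0ℝ; 1ℝ )
  open ℚ-Lemmas using
    (p≤∣p∣; -p≤∣p∣; ∣∣-lub; inverse; inverseʳ; inverse-pos; *-pos; half-pos; half<)
  open ℝ using (seq; cauchy)

  -- Multiplying out literals is left to the solver, so only 0 and 1 compute.
  opaque
    ratℤ-opaque : ℤ → ℚ
    ratℤ-opaque z = z ℚ./ 1

  ratℤ : ℤ → ℚ
  ratℤ (+ 0)             = 0ℚ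
  ratℤ (+ 1)             = 1ℚ
  ratℤ (+ suc (suc n))   = ratℤ-opaque (+ suc (suc n))
  ratℤ ℤ.-[1+ n ]        = ratℤ-opaque ℤ.-[1+ n ]

  ι : ℕ → ℚ
  ι n = ratℤ (+ n)

  opaque
    unfolding ratℤ-opaque

    ratℤ-def : ∀ z → ratℤ z ≡ z ℚ./ 1
    ratℤ-def (+ 0)             = refl
    ratℤ-def (+ 1)             = refl
    ratℤ-def (+ suc (suc n))   = refl
    ratℤ-def ℤ.-[1+ n ]        = refl

  toℚᵘ-ratℤ : ∀ z → ℚ.toℚᵘ (ratℤ z) ℚᵘ.≃ mkℚᵘ z 0
  toℚᵘ-ratℤ z = ℚᵘₚ.≃-trans (ℚᵘₚ.≃-reflexive (cong ℚ.toℚᵘ (ratℤ-def z))) (ℚₚ.toℚᵘ-fromℚᵘ (mkℚᵘ z 0))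

  ratℤ-+ : ∀ a b → ratℤ (a ℤ.+ b) ≡ ratℤ a + ratℤ b
  ratℤ-+ a b = ℚₚ.toℚᵘ-injective (begin
    ℚ.toℚᵘ (ratℤ (a ℤ.+ b))                 ≈⟨ toℚᵘ-ratℤ (a ℤ.+ b) ⟩
    mkℚᵘ (a ℤ.+ b) 0                        ≈⟨ *≡* (cong (ℤ._* + 1) (cong₂ ℤ._+_ (sym (ℤₚ.*-identityʳ a))
        (sym (ℤₚ.*-identityʳ b)))) ⟩
    mkℚᵘ a 0 ℚᵘ.+ mkℚᵘ b 0                  ≈⟨ ℚᵘₚ.+-cong (toℚᵘ-ratℤ a) (toℚᵘ-ratℤ b) ⟨
    ℚ.toℚᵘ (ratℤ a) ℚᵘ.+ ℚ.toℚᵘ (ratℤ b)    ≈⟨ ℚₚ.toℚᵘ-homo-+ (ratℤ a) (ratℤ b) ⟨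
    ℚ.toℚᵘ (ratℤ a + ratℤ b)                ∎)
    where open ℚᵘₚ.≃-Reasoning

  ratℤ-* : ∀ a b → ratℤ (a ℤ.* b) ≡ ratℤ a * ratℤ b
  ratℤ-* a b = ℚₚ.toℚᵘ-injective (begin
    ℚ.toℚᵘ (ratℤ (a ℤ.* b))                 ≈⟨ toℚᵘ-ratℤ (a ℤ.* b) ⟩
    mkℚᵘ a 0 ℚᵘ.* mkℚᵘ b 0                  ≈⟨ ℚᵘₚ.*-cong (toℚᵘ-ratℤ a) (toℚᵘ-ratℤ b) ⟨
    ℚ.toℚᵘ (ratℤ a) ℚᵘ.* ℚ.toℚᵘ (ratℤ b)    ≈⟨ ℚₚ.toℚᵘ-homo-* (ratℤ a) (ratℤ b) ⟨
    ℚ.toℚᵘ (ratℤ a * ratℤ b)                ∎)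
    where open ℚᵘₚ.≃-Reasoning

  ratℤ-neg : ∀ a → ratℤ (ℤ.- a) ≡ - ratℤ a
  ratℤ-neg a = ℚₚ.toℚᵘ-injective (begin
    ℚ.toℚᵘ (ratℤ (ℤ.- a))      ≈⟨ toℚᵘ-ratℤ (ℤ.- a) ⟩
    ℚᵘ.- mkℚᵘ a 0              ≈⟨ ℚᵘₚ.-‿cong (toℚᵘ-ratℤ a) ⟨
    ℚᵘ.- ℚ.toℚᵘ (ratℤ a)       ≈⟨ ℚₚ.toℚᵘ-homo‿- (ratℤ a) ⟨
    ℚ.toℚᵘ (- ratℤ a)          ∎)
    where open ℚᵘₚ.≃-Reasoning

  ratℤ-morphism : ℤ.+-*-rawRing -Raw-AlmostCommutative⟶ fromCommutativeRing ℚₚ.+-*-commutativeRing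
  ratℤ-morphism = record
    { ⟦_⟧ = ratℤ ; +-homo = ratℤ-+ ; *-homo = ratℤ-* ; -‿homo = ratℤ-neg ; 0-homo = refl ; 1-homo = refl }

  ratℤ-≟ : ∀ a b → Maybe (ratℤ a ≡ ratℤ b)
  ratℤ-≟ a b with a ℤₚ.≟ b
  ... | yes refl = just refl
  ... | no  _    = nothing

  open Algebra.Solver.Ring ℤ.+-*-rawRing (fromCommutativeRing ℚₚ.+-*-commutativeRing) ratℤ-morphism ratℤ-≟
    using ( Polynomial; op; var; con; [+]; [*]; _:=_; _:+_; _:*_; _:-_; :-_; _:^_; ⟦_⟧; solve; prove )

  #_ : ∀ {m} → ℕ → Polynomial m
  # n = con (+ n)

  ι-+ : ∀ m n → ι (m ℕ.+ n) ≡ ι m + ι n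
  ι-+ m n = ratℤ-+ (+ m) (+ n)

  ι-* : ∀ m n → ι (m ℕ.* n) ≡ ι m * ι n
  ι-* m n = trans (cong ratℤ (ℤₚ.pos-* m n)) (ratℤ-* (+ m) (+ n))

  ι-suc : ∀ n → ι (suc n) ≡ ι n + ι 1
  ι-suc n = trans (ι-+ 1 n) (ℚₚ.+-comm (ι 1) (ι n))

  0≤ι : ∀ n → 0ℚ ≤ ι n
  0≤ι n = subst (0ℚ ≤_) (sym (ratℤ-def (+ n))) (ℚₚ.nonNegative⁻¹ (+ n ℚ./ 1) {{ℚₚ.normalize-nonNeg n 1}})

  0<ι-suc : ∀ n → 0ℚ < ι (suc n)
  0<ι-suc n = subst (0ℚ <_) (sym (ratℤ-def (+ suc n))) (ℚₚ.positive⁻¹ (+ suc n ℚ./ 1)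
      {{ℚₚ.normalize-pos (suc n) 1}})

  -- Inequalities in ℚ

  infixl 6 _⊕_
  infixl 7 _⊗_

  _⊕_ : ∀ {p q} → 0ℚ ≤ p → 0ℚ ≤ q → 0ℚ ≤ p + q
  _⊕_ {p} {q} 0≤p 0≤q = ℚₚ.≤-trans (ℚₚ.≤-reflexive (sym (ℚₚ.+-identityˡ 0ℚ))) (ℚₚ.+-mono-≤ 0≤p 0≤q)

  _⊗_ : ∀ {p q} → 0ℚ ≤ p → 0ℚ ≤ q → 0ℚ ≤ p * q
  _⊗_ {p} {q} 0≤p 0≤q = ℚₚ.nonNegative⁻¹ (p * q)
    {{ℚₚ.nonNeg*nonNeg⇒nonNeg p {{ℚ.nonNegative 0≤p}} q {{ℚ.nonNegative 0≤q}}}}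

  gap : ∀ {p q} → p ≤ q → 0ℚ ≤ q - p
  gap {p} {q} p≤q = ℚₚ.≤-trans (ℚₚ.≤-reflexive (sym (ℚₚ.+-inverseʳ p))) (ℚₚ.+-monoˡ-≤ (- p) p≤q)

  -- The standard shape of an inequality proof below: the remainder r is assembled with `_⊕_`, `_⊗_`
  -- and `gap` so that its sign is evident, and the equation is left to the ring solver.
  ≤-by : ∀ {p q r} → 0ℚ ≤ r → q ≡ p + r → p ≤ q
  ≤-by {p} {q} {r} 0≤r q≡p+r = begin
    p       ≡⟨ ℚₚ.+-identityʳ p ⟨
    p + 0ℚ  ≤⟨ ℚₚ.+-monoʳ-≤ p 0≤r ⟩
    p + r   ≡⟨ q≡p+r ⟨
    q       ∎
    where open ℚₚ.≤-Reasoning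

  -- x ≡ y follows from a ≡ b once x − y is a multiple of a − b.
  modulo : ∀ {a b x y} → a ≡ b → ∀ c → x ≡ y + c * (a - b) → x ≡ y
  modulo {a} {y = y} refl c x≡ = trans x≡ (solve 3 (λ a c y → y :+ c :* (a :- a) := y) refl a c y)

  *-monoˡ-0≤ : ∀ {p q r} → 0ℚ ≤ r → p ≤ q → r * p ≤ r * q
  *-monoˡ-0≤ {r = r} 0≤r = ℚₚ.*-monoˡ-≤-nonNeg r {{ℚ.nonNegative 0≤r}}

  *-monoʳ-0≤ : ∀ {p q r} → 0ℚ ≤ r → p ≤ q → p * r ≤ q * r
  *-monoʳ-0≤ {r = r} 0≤r = ℚₚ.*-monoʳ-≤-nonNeg r {{ℚ.nonNegative 0≤r}}

  *-mono-0≤ : ∀ {p q r s} → 0ℚ ≤ p → 0ℚ ≤ s → p ≤ q → r ≤ s → p * r ≤ q * s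
  *-mono-0≤ {p} {q} {r} {s} 0≤p 0≤s p≤q r≤s = ≤-by (0≤p ⊗ gap r≤s ⊕ gap p≤q ⊗ 0≤s)
    (solve 4 (λ p q r s → q :* s := p :* r :+ (p :* (s :- r) :+ (q :- p) :* s)) refl p q r s)

  *-cancelˡ-≤ : ∀ {p q} r → 0ℚ < r → r * p ≤ r * q → p ≤ q
  *-cancelˡ-≤ r 0<r = ℚₚ.*-cancelˡ-≤-pos r {{ℚ.positive 0<r}}

  *-cancelˡ-≡ : ∀ {p q} r → 0ℚ < r → r * p ≡ r * q → p ≡ q
  *-cancelˡ-≡ r 0<r eq = ℚₚ.≤-antisym (*-cancelˡ-≤ r 0<r (ℚₚ.≤-reflexive eq))
      (*-cancelˡ-≤ r 0<r (ℚₚ.≤-reflexive (sym eq)))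

  0≤p*p : ∀ p → 0ℚ ≤ p * p
  0≤p*p p with ℚₚ.≤-total 0ℚ p
  ... | inj₁ 0≤p = 0≤p ⊗ 0≤p
  ... | inj₂ p≤0 = subst (0ℚ ≤_) (solve 1 (λ p → (# 0 :- p) :* (# 0 :- p) := p :* p) refl p) (gap p≤0 ⊗ gap p≤0)

  ∣∣-+ : ∀ {p q a b} → ∣ p ∣ ≤ a → ∣ q ∣ ≤ b → ∣ p + q ∣ ≤ a + b
  ∣∣-+ {p} {q} p≤a q≤b = ℚₚ.≤-trans (ℚₚ.∣p+q∣≤∣p∣+∣q∣ p q) (ℚₚ.+-mono-≤ p≤a q≤b)

  ∣∣-* : ∀ {p q a b} → ∣ p ∣ ≤ a → ∣ q ∣ ≤ b → ∣ p * q ∣ ≤ a * b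
  ∣∣-* {p} {q} {a} {b} p≤a q≤b = ℚₚ.≤-trans (ℚₚ.≤-reflexive (ℚₚ.∣p*q∣≡∣p∣*∣q∣ p q))
    (*-mono-0≤ (ℚₚ.0≤∣p∣ p) (ℚₚ.≤-trans (ℚₚ.0≤∣p∣ q) q≤b) p≤a q≤b)

  ∣∣-0≤ : ∀ {p a} → 0ℚ ≤ p → p ≤ a → ∣ p ∣ ≤ a
  ∣∣-0≤ 0≤p p≤a = ℚₚ.≤-trans (ℚₚ.≤-reflexive (ℚₚ.0≤p⇒∣p∣≡p 0≤p)) p≤a

  ∣∣-neg : ∀ {p a} → ∣ p ∣ ≤ a → ∣ - p ∣ ≤ a
  ∣∣-neg {p} = ℚₚ.≤-trans (ℚₚ.≤-reflexive (ℚₚ.∣-p∣≡∣p∣ p))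

  ∣∣-≡ : ∀ {p q a} → p ≡ q → ∣ p ∣ ≤ a → ∣ q ∣ ≤ a
  ∣∣-≡ refl p≤a = p≤a

  archimedean : ∀ q → ∃[ n ] q ≤ ι n
  archimedean q@(ℚ.mkℚ (+ a) d c) = a , ℚₚ.toℚᵘ-cancel-≤ (ℚᵘₚ.≤-respʳ-≃ (ℚᵘₚ.≃-sym (toℚᵘ-ratℤ (+ a)))
    (ℚᵘ.*≤* (ℤₚ.*-monoˡ-≤-nonNeg (+ a) (ℤ.+≤+ (ℕ.s≤s ℕ.z≤n)))))
  archimedean q@(ℚ.mkℚ ℤ.-[1+ a ] d c) = 0 , ℚₚ.<⇒≤ (ℚₚ.negative⁻¹ q)

  archimedean-* : ∀ {ε} → 0ℚ < ε → ∀ K → ∃[ n ] K ≤ ε * ι n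
  archimedean-* {ε} 0<ε K =
    let n , le = archimedean (inverse 0<ε * K) in n , (begin
      K                          ≡⟨ ℚₚ.*-identityˡ K ⟨
      1ℚ * K                     ≡⟨ cong (_* K) (inverseʳ 0<ε) ⟨
      ε * inverse 0<ε * K        ≡⟨ ℚₚ.*-assoc ε (inverse 0<ε) K ⟩
      ε * (inverse 0<ε * K)      ≤⟨ *-monoˡ-0≤ (ℚₚ.<⇒≤ 0<ε) le ⟩
      ε * ι n                    ∎)
    where open ℚₚ.≤-Reasoning

  opaque
    -- The reciprocal of n + 1, kept opaque so that it never unfolds to a normalised fraction; all
    -- that is known of it is `ι*ν` and `0<ν`.
    ν : ℕ → ℚ
    ν n = inverse (0<ι-suc n)

    ι*ν : ∀ n → ι (suc n) * ν n ≡ ι 1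
    ι*ν n = inverseʳ (0<ι-suc n)

    0<ν : ∀ n → 0ℚ < ν n
    0<ν n = inverse-pos (0<ι-suc n)

  -- The order of ℚ is decidable, so suppose d = p - q > 0. Multiplying the hypothesis by n + 1
  -- gives d (n + 1) ≤ K for every n, which contradicts K ≤ d n for a large n.
  ≤-arbitrary : ∀ {p q} K → (∀ n → p ≤ q + K * ν n) → p ≤ q
  ≤-arbitrary {p} {q} K h with p ℚₚ.≤? q
  ... | yes p≤q = p≤q
  ... | no  p≰q =
    let q<p    = ℚₚ.≰⇒> p≰q
        0<p-q  = ℚₚ.<-respˡ-≡ (ℚₚ.+-inverseʳ q) (ℚₚ.+-monoˡ-< (- q) q<p)
        n , le = archimedean-* 0<p-q K
    in contradiction (ℚₚ.<-≤-trans 0<p-q (nonpos n le)) (ℚₚ.<-irrefl refl)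
    where
    open ℚₚ.≤-Reasoning
    d : ℚ
    d = p - q
    nonpos : ∀ n → K ≤ d * ι n → d ≤ 0ℚ
    nonpos n K≤dn = ≤-by (gap (ℚₚ.≤-trans dN≤K K≤dn)) (trans
        (solve 2 (λ d m → # 0 := d :+ (d :* m :- d :* (m :+ # 1))) refl (p - q) (ι n))
        (cong (λ s → d + (d * ι n - d * s)) (sym (ι-suc n))))
      where
      dN≤K : d * ι (suc n) ≤ K
      dN≤K = ≤-by (0≤ι (suc n) ⊗ gap (h n)) (modulo (ι*ν n) (- K)
        (solve 5 (λ K p q i m →
            K :=
            (p :- q) :* m :+ m :* ((q :+ K :* i) :- p) :+ (:- K) :* (m :* i :- # 1))
            refl K p q (ν n) (ι (suc n))))

  -- Finite sums

  ∑ : ℕ → (ℕ → ℚ) → ℚ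
  ∑ = ∑< ℚ.+-0-rawMonoid

  ∑-cong : ∀ n {f g} → (∀ i → i ℕ.< n → f i ≡ g i) → ∑ n f ≡ ∑ n g
  ∑-cong zero    f≡g = refl
  ∑-cong (suc n) f≡g = cong₂ _+_ (∑-cong n λ i i<n → f≡g i (ℕₚ.m<n⇒m<1+n i<n)) (f≡g n ℕₚ.≤-refl)

  ∑-+ : ∀ n f g → ∑ n (λ i → f i + g i) ≡ ∑ n f + ∑ n g
  ∑-+ zero    f g = refl
  ∑-+ (suc n) f g = trans (cong (_+ (f n + g n)) (∑-+ n f g))
    (solve 4 (λ a b c d → (a :+ b) :+ (c :+ d) := (a :+ c) :+ (b :+ d)) refl (∑ n f) (∑ n g) (f n) (g n))

  ∑-* : ∀ n c f → ∑ n (λ i → c * f i) ≡ c * ∑ n f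
  ∑-* zero    c f = sym (ℚₚ.*-zeroʳ c)
  ∑-* (suc n) c f = trans (cong (_+ c * f n) (∑-* n c f)) (sym (ℚₚ.*-distribˡ-+ c (∑ n f) (f n)))

  ∑-suc : ∀ n f → ∑ (suc n) f ≡ f 0 + ∑ n (λ i → f (suc i))
  ∑-suc zero    f = ℚₚ.+-comm 0ℚ (f 0)
  ∑-suc (suc n) f = trans (cong (_+ f (suc n)) (∑-suc n f)) (ℚₚ.+-assoc (f 0) _ _)

  ∑-mono : ∀ n {f g} → (∀ i → i ℕ.< n → f i ≤ g i) → ∑ n f ≤ ∑ n g
  ∑-mono zero    f≤g = ℚₚ.≤-refl
  ∑-mono (suc n) f≤g = ℚₚ.+-mono-≤ (∑-mono n λ i i<n → f≤g i (ℕₚ.m<n⇒m<1+n i<n)) (f≤g n ℕₚ.≤-refl)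

  0≤∑ : ∀ n {f} → (∀ i → 0ℚ ≤ f i) → 0ℚ ≤ ∑ n f
  0≤∑ zero    0≤f = ℚₚ.≤-refl
  0≤∑ (suc n) 0≤f = 0≤∑ n 0≤f ⊕ 0≤f n

  ∣∑∣≤ : ∀ n {f g} → (∀ i → i ℕ.< n → ∣ f i ∣ ≤ g i) → ∣ ∑ n f ∣ ≤ ∑ n g
  ∣∑∣≤ zero    f≤g = ℚₚ.≤-refl
  ∣∑∣≤ (suc n) f≤g = ∣∣-+ (∣∑∣≤ n λ i i<n → f≤g i (ℕₚ.m<n⇒m<1+n i<n)) (f≤g n ℕₚ.≤-refl)

  ∑-const : ∀ n c → ∑ n (λ _ → c) ≡ ι n * c
  ∑-const zero    c = sym (ℚₚ.*-zeroˡ c)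
  ∑-const (suc n) c = trans (cong (_+ c) (∑-const n c))
    (trans (solve 2 (λ m c → m :* c :+ c := (m :+ # 1) :* c) refl (ι n) c) (cong (_* c) (sym (ι-suc n))))

  ∑-split : ∀ m n f → ∑ (n ℕ.+ m) f ≡ ∑ m f + ∑ n (λ i → f (i ℕ.+ m))
  ∑-split m zero    f = sym (ℚₚ.+-identityʳ _)
  ∑-split m (suc n) f = trans (cong (_+ f (n ℕ.+ m)) (∑-split m n f)) (ℚₚ.+-assoc (∑ m f) _ _)

  -- The three-term recurrence

  -- legendreᶻ X z n is zⁿ Pₙ(X / z), and legendreᶻ⁻ X z n is zⁿ⁻¹ Pₙ₋₁(X / z).
  mutual
    legendreᶻ legendreᶻ⁻ : ℚ → ℚ → ℕ → ℚ
    legendreᶻ X z zero    = ι 1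
    legendreᶻ X z (suc n) =
      ν n * ((ι 2 * ι n + ι 1) * X * legendreᶻ X z n - ι n * (z * z) * legendreᶻ⁻ X z n)
    legendreᶻ⁻ X z zero    = ι 0
    legendreᶻ⁻ X z (suc n) = legendreᶻ X z n

  [n+1]*ν : ∀ n → (ι n + ι 1) * ν n ≡ ι 1
  [n+1]*ν n = trans (cong (_* ν n) (sym (ι-suc n))) (ι*ν n)

  legendreᶻ-rec : ∀ X z n → (ι n + ι 1) * legendreᶻ X z (suc n) ≡
    (ι 2 * ι n + ι 1) * X * legendreᶻ X z n - ι n * (z * z) * legendreᶻ⁻ X z n
  legendreᶻ-rec X z n = modulo ([n+1]*ν n) r
    (solve 3 (λ m v r → (m :+ # 1) :* (v :* r) := r :+ r :* ((m :+ # 1) :* v :- # 1)) refl (ι n) (ν n) r)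
    where
    r : ℚ
    r = (ι 2 * ι n + ι 1) * X * legendreᶻ X z n - ι n * (z * z) * legendreᶻ⁻ X z n

  0<ι+1 : ∀ n → 0ℚ < ι n + ι 1
  0<ι+1 n = subst (0ℚ <_) (ι-suc n) (0<ι-suc n)

  module _ {X z : ℚ} (0<X : 0ℚ < X) (z²≤X² : z * z ≤ X * X) where
    private
      L L⁻ : ℕ → ℚ
      L = legendreᶻ X z
      L⁻ = legendreᶻ⁻ X z
      0≤X : 0ℚ ≤ X
      0≤X = ℚₚ.<⇒≤ 0<X

    -- The recurrence times X reads X (n + 1)(Lₙ₊₁ - X Lₙ) = n (X² - z²) Lₙ + n z² (Lₙ - X Lₙ₋₁).
    -- The factor `ι n` in the hypothesis lets the induction start at n = 0, where `L⁻ 0` is a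
    -- default value.
    legendreᶻ-growth-step : ∀ n → 0ℚ ≤ L n → 0ℚ ≤ ι n * (L n - X * L⁻ n) → X * L n ≤ L (suc n)
    legendreᶻ-growth-step n 0≤L h = *-cancelˡ-≤ (X * (ι n + ι 1)) (*-pos 0<X (0<ι+1 n))
      (≤-by (0≤ι n ⊗ gap z²≤X² ⊗ 0≤L ⊕ 0≤p*p z ⊗ h)
        (modulo (legendreᶻ-rec X z n) X
          (solve 6 (λ X z m l p s →
              X :* (m :+ # 1) :* s :=
              X :* (m :+ # 1) :* (X :* l) :+ (m :* (X :* X :- z :* z) :* l :+
                z :* z :* (m :* (l :- X :* p))) :+ X :* ((m :+ # 1) :* s :- ((# 2 :* m :+ # 1) :* X :* l :-
                m :* (z :* z) :* p)))
              refl X z (ι n) (L n) (L⁻ n) (L (suc n)))))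

    legendreᶻ-growth : ∀ n → 0ℚ ≤ L n × X * L n ≤ L (suc n)
    legendreᶻ-growth zero    = 0≤ι 1 , legendreᶻ-growth-step zero (0≤ι 1)
      (ℚₚ.≤-reflexive (sym (ℚₚ.*-zeroˡ (L 0 - X * L⁻ 0))))
    legendreᶻ-growth (suc n) =
      let 0≤L , XL≤L = legendreᶻ-growth n
          0≤L′ = ℚₚ.≤-trans (0≤X ⊗ 0≤L) XL≤L
      in 0≤L′ , legendreᶻ-growth-step (suc n) 0≤L′ (0≤ι (suc n) ⊗ gap XL≤L)

    0≤legendreᶻ : ∀ n → 0ℚ ≤ L n
    0≤legendreᶻ n = proj₁ (legendreᶻ-growth n)

    module _ {r : ℚ} (X≤r : X ≤ r) (0≤char : 0ℚ ≤ r * r - ι 2 * X * r + z * z) where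
      private
        0<r : 0ℚ < r
        0<r = ℚₚ.<-≤-trans 0<X X≤r

      -- As n grows, the recurrence approaches one with characteristic polynomial λ² - 2Xλ + z²;
      -- `X≤r` and `0≤char` put r at or above its larger root. Then r (n + 1)(r Lₙ - Lₙ₊₁) is the
      -- sum of n (r² - 2Xr + z²) Lₙ, r (r - X) Lₙ and n z² (r Lₙ₋₁ - Lₙ).
      legendreᶻ-ratio-step : ∀ n → 0ℚ ≤ ι n * (r * L⁻ n - L n) → L (suc n) ≤ r * L n
      legendreᶻ-ratio-step n h = *-cancelˡ-≤ (r * (ι n + ι 1)) (*-pos 0<r (0<ι+1 n))
        (≤-by (0≤ι n ⊗ 0≤char ⊗ 0≤legendreᶻ n ⊕ ℚₚ.<⇒≤ 0<r ⊗ gap X≤r ⊗ 0≤legendreᶻ n ⊕ 0≤p*p z ⊗ h)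
          (modulo (legendreᶻ-rec X z n) (- r)
            (solve 7 (λ X z r m l p s →
                r :* (m :+ # 1) :* (r :* l) :=
                r :* (m :+ # 1) :* s :+ (m :* (r :* r :- # 2 :* X :* r :+ z :* z) :* l :+ r :* (r :- X) :* l :+
                  z :* z :* (m :* (r :* p :- l))) :+ (:- r) :* ((m :+ # 1) :* s :-
                  ((# 2 :* m :+ # 1) :* X :* l :- m :* (z :* z) :* p)))
                refl X z r (ι n) (L n) (L⁻ n) (L (suc n)))))

      legendreᶻ-ratio : ∀ n → L (suc n) ≤ r * L n
      legendreᶻ-ratio zero    = legendreᶻ-ratio-step zero (ℚₚ.≤-reflexive (sym (ℚₚ.*-zeroˡ (r * L⁻ 0 - L 0))))
      legendreᶻ-ratio (suc n) = legendreᶻ-ratio-step (suc n) (0≤ι (suc n) ⊗ gap (legendreᶻ-ratio n))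

      legendreᶻ≤^ : ∀ n → L n ≤ r ^ n
      legendreᶻ≤^ zero    = ℚₚ.≤-refl
      legendreᶻ≤^ (suc n) = ℚₚ.≤-trans (legendreᶻ-ratio n) (*-monoˡ-0≤ (ℚₚ.<⇒≤ 0<r) (legendreᶻ≤^ n))

  -- binom² n is (2n choose n)² / 16ⁿ.
  binom² : ℕ → ℚ
  binom² zero    = ι 1
  binom² (suc n) = binom² n * (((ι 2 * ι n + ι 1) * ν 1 * ν n) * ((ι 2 * ι n + ι 1) * ν 1 * ν n))

  binom²-rec : ∀ n → ι 4 * ((ι n + ι 1) * (ι n + ι 1)) * binom² (suc n) ≡
    (ι 2 * ι n + ι 1) * (ι 2 * ι n + ι 1) * binom² n
  binom²-rec n = modulo (ι*ν 1) (c * ((ι n + ι 1) * ν n) * ((ι n + ι 1) * ν n) * (ι 2 * ν 1 + ι 1))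
    (modulo ([n+1]*ν n) (c * ((ι n + ι 1) * ν n + ι 1))
      (solve 4 (λ m h v a →
          # 4 :* ((m :+ # 1) :* (m :+ # 1)) :*
            (a :* (((# 2 :* m :+ # 1) :* h :* v) :* ((# 2 :* m :+ # 1) :* h :* v))) :=
          (# 2 :* m :+ # 1) :* (# 2 :* m :+ # 1) :* a :+ (# 2 :* m :+ # 1) :* (# 2 :* m :+ # 1) :* a :*
            ((m :+ # 1) :* v) :* ((m :+ # 1) :* v) :* (# 2 :* h :+ # 1) :* (# 2 :* h :- # 1) :+
            (# 2 :* m :+ # 1) :* (# 2 :* m :+ # 1) :* a :* ((m :+ # 1) :* v :+ # 1) :* ((m :+ # 1) :* v :- # 1))
          refl (ι n) (ν 1) (ν n) (binom² n)))
    where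
    c : ℚ
    c = (ι 2 * ι n + ι 1) * (ι 2 * ι n + ι 1) * binom² n

  0≤ν : ∀ n → 0ℚ ≤ ν n
  0≤ν n = ℚₚ.<⇒≤ (0<ν n)

  0≤binom² : ∀ n → 0ℚ ≤ binom² n
  0≤binom² zero    = 0≤ι 1
  0≤binom² (suc n) = 0≤binom² n ⊗ 0≤p*p ((ι 2 * ι n + ι 1) * ν 1 * ν n)

  -- The cubic weight and its telescoping

  cubic₃ cubic₂ cubic₁ cubic₀ : ℚ → ℚ
  cubic₃ k = ι 4 * ((k - ι 1) * (k - ι 1)) * (k * k) * ((k * k + ι 3 * k + ι 4) * (k * k + ι 3 * k + ι 4))
  cubic₂ k = ι 12 * (k - ι 1) * k * (k * k * k * k * k * k + ι 5 * (k * k * k * k * k) +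
      ι 10 * (k * k * k * k) + ι 10 * (k * k * k) + ι 5 * (k * k) - ι 3 * k + ι 4)
  cubic₁ k = ι 9 * (k * k * k * k * k * k * k * k) + ι 36 * (k * k * k * k * k * k * k) +
      ι 37 * (k * k * k * k * k * k) + ι 8 * (k * k * k * k * k) - ι 9 * (k * k * k * k) - ι 56 * (k * k * k) +
      ι 63 * (k * k) - ι 28 * k + ι 4
  cubic₀ k = (k * k + ι 2 * k - ι 1) * (k * k + ι 2 * k - ι 1) * (ι 2 * (k * k * k * k) + ι 3 * (k * k) - ι 2 *
      k + ι 1)

  cubic : ℚ → ℚ → ℚ
  cubic k m = cubic₃ k * (m * m * m) + cubic₂ k * (m * m) + cubic₁ k * m + cubic₀ k

  -- `M` is the common denominator of u and v. `Z` is M z, the denominator in the statement, and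
  -- `MX` is M X, its numerator, grouped so that 1 - X shows its factor k (1 - k).
  M Z MX : ℚ → ℚ
  M k = (ι 1 + k) * (ι 1 + k)
  Z k = (k * k + ι 1) * (k * k + ι 2 * k - ι 1)
  MX k = ((ι 1 + k) * (ι 1 + k)) - k * (ι 1 - k) * (ι 4 + ι 5 * k - k * k)

  -- A name ending in ᵖ is the solver expression of the corresponding function.
  Mᵖ MXᵖ Zᵖ αᵖ βᵖ aᵖ bᵖ Rᵖ numeratorᵖ C₃ᵖ C₂ᵖ C₁ᵖ C₀ᵖ : ∀ {m} → Polynomial m → Polynomial m
  Mᵖ k = (# 1 :+ k) :* (# 1 :+ k)
  MXᵖ k = Mᵖ k :- k :* (# 1 :- k) :* (# 4 :+ # 5 :* k :- k :* k)
  Zᵖ k = (k :* k :+ # 1) :* (k :* k :+ # 2 :* k :- # 1)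
  αᵖ k = # 1 :+ # 6 :* k :- # 5 :* k :* k
  βᵖ k = # 1 :- # 2 :* k :- k :* k
  aᵖ k = # 3 :* (# 1 :- # 2 :* k :- k :* k)
  bᵖ k = # 3 :+ # 2 :* k :+ k :* k
  Rᵖ k = (# 1 :+ k) :* (# 1 :- k :+ k :* k :+ k :* k :* k)
  numeratorᵖ k = (:- (k :* k :* k :* k)) :+ # 6 :* (k :* k :* k) :- # 2 :* k :+ # 1
  C₃ᵖ k = # 4 :* ((k :- # 1) :* (k :- # 1)) :* (k :* k) :* ((k :* k :+ # 3 :* k :+ # 4) :* (k :* k :+
    # 3 :* k :+ # 4))
  C₂ᵖ k = # 12 :* (k :- # 1) :* k :* (k :* k :* k :* k :* k :* k :+ # 5 :* (k :* k :* k :* k :* k) :+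
    # 10 :* (k :* k :* k :* k) :+ # 10 :* (k :* k :* k) :+ # 5 :* (k :* k) :- # 3 :* k :+ # 4)
  C₁ᵖ k = # 9 :* (k :* k :* k :* k :* k :* k :* k :* k) :+ # 36 :* (k :* k :* k :* k :* k :* k :* k) :+
    # 37 :* (k :* k :* k :* k :* k :* k) :+ # 8 :* (k :* k :* k :* k :* k) :- # 9 :* (k :* k :* k :* k) :-
    # 56 :* (k :* k :* k) :+ # 63 :* (k :* k) :- # 28 :* k :+ # 4
  C₀ᵖ k = (k :* k :+ # 2 :* k :- # 1) :* (k :* k :+ # 2 :* k :- # 1) :* (# 2 :* (k :* k :* k :* k) :+
    # 3 :* (k :* k) :- # 2 :* k :+ # 1)

  -- Found by matching the coefficients of Lₙ and Lₙ₋₁ on both sides of cubic-telescopes.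
  boundary : (k m a l p : ℚ) → ℚ
  boundary k m a l p = ι 4 * a * (m * m) * ((m + ι 1) * (Z k * Z k) * p - m * (M k * M k) * l)

  linear : (k z m l p : ℚ) → ℚ
  linear k z m l p = ((ι 1 + ι 6 * k - ι 5 * k * k) * m + ι 2 * k * (ι 1 - k)) * l + (ι 1 - ι 2 * k - k * k) *
      m * z * p

  -- Only the two recurrences at n and the equations of the curve enter, so all nine quantities are
  -- free variables and the claim is a single polynomial identity. Each `modulo` spends one
  -- hypothesis; its second argument is the cofactor.
  cubic-telescopes : ∀ {k X z m a l p a′ l′} → M k * X ≡ MX k → M k * z ≡ Z k →
    ι 4 * ((m + ι 1) * (m + ι 1)) * a′ ≡ (ι 2 * m + ι 1) * (ι 2 * m + ι 1) * a →
    (m + ι 1) * l′ ≡ (ι 2 * m + ι 1) * X * l - m * (z * z) * p →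
    a * l * cubic k m ≡ M k * (k * k + ι 1) * (a * linear k z m l p) +
      (boundary k (m + ι 1) a′ l′ l - boundary k m a l p)
  cubic-telescopes {k} {X} {z} {m} {a} {l} {p} {a′} {l′} hX hz ha hl =
    modulo ha (- ((m + ι 2) * (Z k * Z k) * l - (m + ι 1) * (M k * M k) * l′))
    (modulo hl (o * o * a * (M k * M k))
    (modulo hX (o * o * o * a * M k * l)
    (modulo hz (- (o * o * a * m * p * (M k * z + Z k) + (k * k + ι 1) * (ι 1 - ι 2 * k - k * k) * a * m * p))
    (solve 9 (λ k X z m a l p a′ l′ →
        a :* l :* (C₃ᵖ k :* (m :* m :* m) :+ C₂ᵖ k :* (m :* m) :+ C₁ᵖ k :* m :+ C₀ᵖ k) :=
        Mᵖ k :* (k :* k :+ # 1) :* (a :* ((αᵖ k :* m :+ # 2 :* k :* (# 1 :- k)) :* l :+ βᵖ k :* m :* z :*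
          p)) :+ (# 4 :* a′ :* ((m :+ # 1) :* (m :+ # 1)) :* ((m :+ # 1 :+ # 1) :* (Zᵖ k :* Zᵖ k) :* l :-
          (m :+ # 1) :* (Mᵖ k :* Mᵖ k) :* l′) :- # 4 :* a :* (m :* m) :* ((m :+ # 1) :* (Zᵖ k :* Zᵖ k) :* p :-
          m :* (Mᵖ k :* Mᵖ k) :* l)) :+ (:- ((m :+ # 2) :* (Zᵖ k :* Zᵖ k) :* l :- (m :+ # 1) :*
          (Mᵖ k :* Mᵖ k) :* l′)) :* (# 4 :* ((m :+ # 1) :* (m :+ # 1)) :* a′ :- (# 2 :* m :+ # 1) :*
          (# 2 :* m :+ # 1) :* a) :+ ((# 2 :* m :+ # 1) :* (# 2 :* m :+ # 1) :* a :* (Mᵖ k :* Mᵖ k)) :*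
          ((m :+ # 1) :* l′ :- ((# 2 :* m :+ # 1) :* X :* l :- m :* (z :* z) :* p)) :+
          ((# 2 :* m :+ # 1) :* (# 2 :* m :+ # 1) :* (# 2 :* m :+ # 1) :* a :* Mᵖ k :* l) :* (Mᵖ k :* X :-
          MXᵖ k) :+ (:- ((# 2 :* m :+ # 1) :* (# 2 :* m :+ # 1) :* a :* m :* p :* (Mᵖ k :* z :+ Zᵖ k) :+
          ((k :* k :+ # 1) :* βᵖ k) :* a :* m :* p)) :* (Mᵖ k :* z :- Zᵖ k))
        refl k X z m a l p a′ l′))))
    where
    o : ℚ
    o = ι 2 * m + ι 1

  -- Derivations on [0, 1]

  InUnit : ℚ → Set
  InUnit x = 0ℚ ≤ x × x ≤ 1ℚ

  ∣x∣≤1 : ∀ {x} → InUnit x → ∣ x ∣ ≤ ι 1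
  ∣x∣≤1 (0≤x , x≤1) = ∣∣-0≤ 0≤x x≤1

  -- The derivation 2x(1 − x²) d/dx keeps the derivatives below free of denominators.
  scale : ℚ → ℚ
  scale x = ι 2 * x * (ι 1 - x * x)

  -- A uniform quadratic remainder expresses differentiability without limits, and one constant for
  -- all four bounds keeps the calculus closed under products. `lipschitz` is a separate field
  -- because `scale` vanishes at 0 and 1, where `taylor` says nothing about f y - f x.
  record HasDerivation (f f′ : ℚ → ℚ) : Set where
    field
      B           : ℚ
      bounded     : ∀ {x} → InUnit x → ∣ f x ∣ ≤ B
      bounded′    : ∀ {x} → InUnit x → ∣ f′ x ∣ ≤ B
      lipschitz   : ∀ {x y} → InUnit x → InUnit y → ∣ f y - f x ∣ ≤ B * ∣ y - x ∣
      taylor      : ∀ {x y} → InUnit x → InUnit y →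
                    ∣ scale x * (f y - f x) - f′ x * (y - x) ∣ ≤ B * (∣ y - x ∣ * ∣ y - x ∣)

  open HasDerivation

  0≤∣∣² : ∀ h → 0ℚ ≤ ∣ h ∣ * ∣ h ∣
  0≤∣∣² h = 0≤p*p ∣ h ∣

  ∣0∣≤ : ∀ {p c} → p ≡ 0ℚ → 0ℚ ≤ c → ∣ p ∣ ≤ c
  ∣0∣≤ refl 0≤c = 0≤c

  unit-0 : InUnit 0ℚ
  unit-0 = ℚₚ.≤-refl , 0≤ι 1

  0≤B : ∀ {f f′} (D : HasDerivation f f′) → 0ℚ ≤ B D
  0≤B {f} D = ℚₚ.≤-trans (ℚₚ.0≤∣p∣ (f 0ℚ)) (bounded D unit-0)

  derivation-cong : ∀ {f f′ g g′} → (∀ x → InUnit x → f x ≡ g x) → (∀ x → InUnit x → f′ x ≡ g′ x) →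
                    HasDerivation f f′ → HasDerivation g g′
  derivation-cong f≡g f′≡g′ D = record
    { B = B D
    ; bounded = λ {x} xI → ∣∣-≡ (f≡g x xI) (bounded D xI)
    ; bounded′ = λ {x} xI → ∣∣-≡ (f′≡g′ x xI) (bounded′ D xI)
    ; lipschitz = λ {x} {y} xI yI → ∣∣-≡ (cong₂ _-_ (f≡g y yI) (f≡g x xI)) (lipschitz D xI yI)
    ; taylor = λ {x} {y} xI yI → ∣∣-≡ (cong₂ (λ d d′ → scale x * d - d′ * (y - x))
        (cong₂ _-_ (f≡g y yI) (f≡g x xI)) (f′≡g′ x xI)) (taylor D xI yI)
    }

  derivation-const : ∀ c → HasDerivation (λ _ → c) (λ _ → 0ℚ)
  derivation-const c = record
    { B = ∣ c ∣
    ; bounded = λ _ → ℚₚ.≤-refl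
    ; bounded′ = λ _ → ∣0∣≤ refl (ℚₚ.0≤∣p∣ c)
    ; lipschitz = λ {x} {y} _ _ → ∣0∣≤ (ℚₚ.+-inverseʳ c) (ℚₚ.0≤∣p∣ c ⊗ ℚₚ.0≤∣p∣ (y - x))
    ; taylor = λ {x} {y} _ _ → ∣0∣≤ (solve 4 (λ c x y s →
        s :* (c :- c) :- # 0 :* (y :- x) :=
        # 0)
        refl c x y (scale x)) (ℚₚ.0≤∣p∣ c ⊗ 0≤∣∣² (y - x))
    }

  derivation-id : HasDerivation (λ x → x) scale
  derivation-id = record
    { B = ι 2
    ; bounded = λ xI → ℚₚ.≤-trans (∣x∣≤1 xI) (≤-by (0≤ι 1) (solve 0 (# 2 := # 1 :+ # 1) refl))
    ; bounded′ = λ {x} (0≤x , x≤1) → ∣∣-0≤ (0≤ι 2 ⊗ 0≤x ⊗ subst (0ℚ ≤_) (solve 1 (λ x →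
        (# 1 :- x) :* (# 1 :+ x) :=
        # 1 :- x :* x)
        refl x) (gap x≤1 ⊗ (0≤ι 1 ⊕ 0≤x)))
        (≤-by (0≤ι 2 ⊗ gap x≤1 ⊕ 0≤ι 2 ⊗ 0≤x ⊗ 0≤x ⊗ 0≤x) (solve 1 (λ x →
            # 2 :=
            # 2 :* x :* (# 1 :- x :* x) :+ (# 2 :* (# 1 :- x) :+ # 2 :* x :* x :* x))
            refl x))
    ; lipschitz = λ {x} {y} _ _ → ≤-by (ℚₚ.0≤∣p∣ (y - x)) (solve 1 (λ h →
        # 2 :* h :=
        h :+ h)
        refl (∣ y - x ∣))
    ; taylor = λ {x} {y} _ _ → ∣0∣≤ (solve 3 (λ x y s →
        s :* (y :- x) :- s :* (y :- x) :=
        # 0)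
        refl x y (scale x)) (0≤ι 2 ⊗ 0≤∣∣² (y - x))
    }

  derivation-+ : ∀ {f f′ g g′} → HasDerivation f f′ → HasDerivation g g′ →
                 HasDerivation (λ x → f x + g x) (λ x → f′ x + g′ x)
  derivation-+ {f} {f′} {g} {g′} D E = record
    { B = B D + B E
    ; bounded = λ xI → ∣∣-+ (bounded D xI) (bounded E xI)
    ; bounded′ = λ xI → ∣∣-+ (bounded′ D xI) (bounded′ E xI)
    ; lipschitz = λ {x} {y} xI yI → ℚₚ.≤-trans
        (∣∣-≡ (solve 4 (λ a b c d → (b :- a) :+ (d :- c) := b :+ d :- (a :+ c)) refl (f x) (f y) (g x) (g y))
          (∣∣-+ (lipschitz D xI yI) (lipschitz E xI yI)))
        (ℚₚ.≤-reflexive (sym (ℚₚ.*-distribʳ-+ ∣ y - x ∣ (B D) (B E))))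
    ; taylor = λ {x} {y} xI yI → ℚₚ.≤-trans
        (∣∣-≡ (solve 9 (λ a b c d a′ c′ x y s →
            (s :* (b :- a) :- a′ :* (y :- x)) :+ (s :* (d :- c) :- c′ :* (y :- x)) :=
            s :* (b :+ d :- (a :+ c)) :- (a′ :+ c′) :* (y :- x))
            refl (f x) (f y) (g x) (g y) (f′ x) (g′ x) x y (scale x))
          (∣∣-+ (taylor D xI yI) (taylor E xI yI)))
        (ℚₚ.≤-reflexive (sym (ℚₚ.*-distribʳ-+ (∣ y - x ∣ * ∣ y - x ∣) (B D) (B E))))
    }

  derivation-* : ∀ {f f′ g g′} → HasDerivation f f′ → HasDerivation g g′ →
                 HasDerivation (λ x → f x * g x) (λ x → f′ x * g x + f x * g′ x)
  derivation-* {f} {f′} {g} {g′} D E = record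
    -- The Taylor bound dictates the 3: one b c from the remainder of each factor and one from the
    -- cross term f′(x) (y - x)(g y - g x). The other fields need at most 2 b c.
    { B = ι 3 * (b * c)
    ; bounded = λ xI → ℚₚ.≤-trans (∣∣-* (bounded D xI) (bounded E xI))
        (≤-by (0≤ι 2 ⊗ 0≤bc) (solve 1 (λ m → # 3 :* m := m :+ # 2 :* m) refl (b * c)))
    ; bounded′ = λ xI → ℚₚ.≤-trans
        (∣∣-+ (∣∣-* (bounded′ D xI) (bounded E xI)) (∣∣-* (bounded D xI) (bounded′ E xI)))
        (≤-by 0≤bc (solve 1 (λ m → # 3 :* m := m :+ m :+ m) refl (b * c)))
    ; lipschitz = λ {x} {y} xI yI → ℚₚ.≤-trans
        (∣∣-≡ (solve 4 (λ p q r s →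
            q :* (s :- r) :+ (q :- p) :* r :=
            q :* s :- p :* r)
            refl (f x) (f y) (g x) (g y))
          (∣∣-+ (∣∣-* (bounded D yI) (lipschitz E xI yI)) (∣∣-* (lipschitz D xI yI) (bounded E xI))))
        (≤-by (0≤bc ⊗ ℚₚ.0≤∣p∣ (y - x))
          (solve 3 (λ b c h →
              # 3 :* (b :* c) :* h :=
              b :* (c :* h) :+ b :* h :* c :+ b :* c :* h)
              refl b c (∣ y - x ∣)))
    ; taylor = λ {x} {y} xI yI → ℚₚ.≤-trans
        (∣∣-≡ (solve 9 (λ p q r s p′ r′ x y t →
            (t :* (q :- p) :- p′ :* (y :- x)) :* s :+ p :* (t :* (s :- r) :- r′ :* (y :- x)) :+
              p′ :* (y :- x) :* (s :- r) :=
            t :* (q :* s :- p :* r) :- (p′ :* r :+ p :* r′) :* (y :- x))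
            refl (f x) (f y) (g x) (g y) (f′ x) (g′ x) x y (scale x))
          (∣∣-+ (∣∣-+ (∣∣-* (taylor D xI yI) (bounded E yI)) (∣∣-* (bounded D xI) (taylor E xI yI)))
            (∣∣-* (∣∣-* (bounded′ D xI) ℚₚ.≤-refl) (lipschitz E xI yI))))
        (ℚₚ.≤-reflexive (solve 3 (λ b c h →
            b :* (h :* h) :* c :+ b :* (c :* (h :* h)) :+ b :* h :* (c :* h) :=
            # 3 :* (b :* c) :* (h :* h))
            refl b c (∣ y - x ∣)))
    }
    where
    b c : ℚ
    b = B D
    c = B E
    0≤bc : 0ℚ ≤ b * c
    0≤bc = 0≤B D ⊗ 0≤B E

  derivation-scalar : ∀ {f f′} c → HasDerivation f f′ → HasDerivation (λ x → c * f x) (λ x → c * f′ x)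
  derivation-scalar {f} {f′} c D = derivation-cong (λ _ _ → refl)
    (λ x _ → (solve 3 (λ c a b → # 0 :* a :+ c :* b := c :* b) refl c (f x) (f′ x)))
      (derivation-* (derivation-const c) D)

  derivation-- : ∀ {f f′ g g′} → HasDerivation f f′ → HasDerivation g g′ →
                 HasDerivation (λ x → f x - g x) (λ x → f′ x - g′ x)
  derivation-- {f} {f′} {g} {g′} D E = derivation-cong
    (λ x _ → (solve 2 (λ a b → a :+ (:- # 1) :* b := a :- b) refl (f x) (g x))) (λ x _ → (solve 2 (λ a b →
        a :+ (:- # 1) :* b :=
        a :- b)
        refl (f′ x) (g′ x)))
    (derivation-+ D (derivation-scalar (- ι 1) E))

  w : ℚ → ℚ
  w x = recip (ι 1 + x)

  0<1+x : ∀ {x} → 0ℚ ≤ x → 0ℚ < ι 1 + x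
  0<1+x 0≤x = ℚₚ.+-mono-<-≤ (0<ι-suc 0) 0≤x

  [1+x]*w : ∀ {x} → 0ℚ ≤ x → (ι 1 + x) * w x ≡ ι 1
  [1+x]*w {x} 0≤x = recip-inverseʳ (ι 1 + x) (λ eq → ℚₚ.<⇒≢ (0<1+x 0≤x) (sym eq))

  0≤w : ∀ {x} → 0ℚ ≤ x → 0ℚ ≤ w x
  0≤w {x} 0≤x = *-cancelˡ-≤ (ι 1 + x) (0<1+x 0≤x) (≤-by (0≤ι 1) (modulo ([1+x]*w 0≤x) (ι 1)
    (solve 2 (λ x w →
        (# 1 :+ x) :* w :=
        (# 1 :+ x) :* # 0 :+ # 1 :+ # 1 :* ((# 1 :+ x) :* w :- # 1))
        refl x (w x))))

  w≤1 : ∀ {x} → 0ℚ ≤ x → w x ≤ ι 1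
  w≤1 {x} 0≤x = ≤-by (0≤x ⊗ 0≤w 0≤x) (modulo ([1+x]*w 0≤x) (- ι 1)
    (solve 2 (λ x w → # 1 := w :+ x :* w :+ (:- # 1) :* ((# 1 :+ x) :* w :- # 1)) refl x (w x)))

  -- The derivative of 1 / (1 + x) is -w², and the factor 1 + x of `scale` cancels one w.
  derivation-w : HasDerivation w (λ x → - (ι 2 * w x * (x * (ι 1 - x))))
  derivation-w = record
    { B = ι 2
    ; bounded = λ xI → ℚₚ.≤-trans (∣w∣≤1 xI) (≤-by (0≤ι 1) (solve 0 (# 2 := # 1 :+ # 1) refl))
    ; bounded′ = λ {x} xI → ℚₚ.≤-trans
        (∣∣-neg (∣∣-* (∣∣-* ∣2∣≤2 (∣w∣≤1 xI)) (∣x[1-x]∣≤1 xI)))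
        (ℚₚ.≤-reflexive (solve 0 (# 2 :* # 1 :* # 1 := # 2) refl))
    ; lipschitz = λ {x} {y} xI yI → ℚₚ.≤-trans (∣w-w∣≤ xI yI) (≤-by (ℚₚ.0≤∣p∣ (y - x)) (solve 1 (λ h →
        # 2 :* h :=
        # 1 :* h :+ h)
        refl (∣ y - x ∣)))
    ; taylor = λ {x} {y} xI yI → ℚₚ.≤-trans (∣∣-≡
        (modulo ([1+x]*w (proj₁ xI)) (ι 2 * x * (ι 1 - x) * w y * (y - x))
        (modulo ([1+x]*w (proj₁ xI)) (ι 2 * x * (ι 1 - x) * w y * (ι 1 + x))
        (modulo ([1+x]*w (proj₁ yI)) (- (ι 2 * x * (ι 1 - x) * w x * (ι 1 + x)))
        (solve 4 (λ x y u v →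
            (:- # 2) :* (x :* (# 1 :- x)) :* (v :- u) :* (y :- x) :=
            # 2 :* x :* (# 1 :- x :* x) :* (v :- u) :- (:- (# 2 :* u :* (x :* (# 1 :- x)))) :* (y :- x) :+
              # 2 :* x :* (# 1 :- x) :* v :* (y :- x) :* ((# 1 :+ x) :* u :- # 1) :+ # 2 :* x :* (# 1 :- x) :*
              v :* (# 1 :+ x) :* ((# 1 :+ x) :* u :- # 1) :+
              (:- (# 2 :* x :* (# 1 :- x) :* u :* (# 1 :+ x))) :* ((# 1 :+ y) :* v :- # 1))
            refl x y (w x) (w y)))))
        (∣∣-* (∣∣-* (∣∣-* (∣∣-neg ∣2∣≤2) (∣x[1-x]∣≤1 xI)) (∣w-w∣≤ xI yI)) ℚₚ.≤-refl))
        (ℚₚ.≤-reflexive (solve 1 (λ h → # 2 :* # 1 :* (# 1 :* h) :* h := # 2 :* (h :* h)) refl (∣ y - x ∣)))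
    }
    where
    ∣2∣≤2 : ∣ ι 2 ∣ ≤ ι 2
    ∣2∣≤2 = ∣∣-0≤ (0≤ι 2) ℚₚ.≤-refl
    ∣w∣≤1 : ∀ {x} → InUnit x → ∣ w x ∣ ≤ ι 1
    ∣w∣≤1 (0≤x , _) = ∣∣-0≤ (0≤w 0≤x) (w≤1 0≤x)
    ∣x[1-x]∣≤1 : ∀ {x} → InUnit x → ∣ x * (ι 1 - x) ∣ ≤ ι 1
    ∣x[1-x]∣≤1 {x} (0≤x , x≤1) = ∣∣-0≤ (0≤x ⊗ gap x≤1)
      (≤-by (gap x≤1 ⊕ 0≤p*p x) (solve 1 (λ x → # 1 := x :* (# 1 :- x) :+ ((# 1 :- x) :+ x :* x)) refl x))
    ∣w-w∣≤ : ∀ {x y} → InUnit x → InUnit y → ∣ w y - w x ∣ ≤ ι 1 * ∣ y - x ∣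
    ∣w-w∣≤ {x} {y} xI yI = ℚₚ.≤-trans (∣∣-≡
        (modulo ([1+x]*w (proj₁ xI)) (w y) (modulo ([1+x]*w (proj₁ yI)) (- w x)
          (solve 4 (λ x y u v →
              (:- u) :* v :* (y :- x) :=
              v :- u :+ v :* ((# 1 :+ x) :* u :- # 1) :+ (:- u) :* ((# 1 :+ y) :* v :- # 1))
              refl x y (w x) (w y))))
        (∣∣-* (∣∣-* (∣∣-neg (∣w∣≤1 xI)) (∣w∣≤1 yI)) ℚₚ.≤-refl))
      (ℚₚ.≤-reflexive (solve 1 (λ h → # 1 :* # 1 :* h := # 1 :* h) refl (∣ y - x ∣)))

  -- Differentiating the solver's own syntax allows `prove` to compare the computed derivative with
  -- a closed form, so the product rule is never expanded by hand. The argument d holds the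
  -- derivatives of the variables.
  derive : ∀ {m} → (Fin m → Polynomial m) → Polynomial m → Polynomial m
  derive d (op [+] p q)   = derive d p :+ derive d q
  derive d (op [*] p q)   = derive d p :* q :+ p :* derive d q
  derive d (con c)        = con (+ 0)
  derive d (var i)        = d i
  derive d (p :^ zero)    = con (+ 0)
  derive d (p :^ suc n)   = derive d p :* (p :^ n) :+ p :* derive d (p :^ n)
  derive d (:- p)         = :- derive d p

  module _ {m} (ρ : ℚ → Vec ℚ m) (d : Fin m → Polynomial m)
           (vars : ∀ i → HasDerivation (λ x → lookup (ρ x) i) (λ x → ⟦ d i ⟧ (ρ x))) where

    derivation-⟦⟧ : ∀ p → HasDerivation (λ x → ⟦ p ⟧ (ρ x)) (λ x → ⟦ derive d p ⟧ (ρ x))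
    derivation-⟦⟧ (op [+] p q)   = derivation-+ (derivation-⟦⟧ p) (derivation-⟦⟧ q)
    derivation-⟦⟧ (op [*] p q)   = derivation-* (derivation-⟦⟧ p) (derivation-⟦⟧ q)
    derivation-⟦⟧ (con c)        = derivation-const (ratℤ c)
    derivation-⟦⟧ (var i)        = vars i
    derivation-⟦⟧ (p :^ zero)    = derivation-const 1ℚ
    derivation-⟦⟧ (p :^ suc n)   = derivation-* (derivation-⟦⟧ p) (derivation-⟦⟧ (p :^ n))
    derivation-⟦⟧ (:- p)         = derivation-cong
      (λ x _ → (solve 1 (λ a → (:- # 1) :* a := (:- a)) refl (⟦ p ⟧ (ρ x)))) (λ x _ → (solve 1 (λ a →
          (:- # 1) :* a :=
          (:- a))
          refl (⟦ derive d p ⟧ (ρ x))))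
      (derivation-scalar (- ι 1) (derivation-⟦⟧ p))

  -- The curve (X, z) and the derivatives of Lₙ

  module Curve where
    private
      kw : ℚ → Vec ℚ 2
      kw x = x ∷ w x ∷ []
      κ ω : Polynomial 2
      κ = var Fin.zero
      ω = var (Fin.suc Fin.zero)
      kw′ : Fin 2 → Polynomial 2
      kw′ Fin.zero           = # 2 :* κ :* (# 1 :- κ :* κ)
      kw′ (Fin.suc Fin.zero) = :- (# 2 :* ω :* (κ :* (# 1 :- κ)))
      kw-derivation : ∀ i → HasDerivation (λ x → lookup (kw x) i) (λ x → ⟦ kw′ i ⟧ (kw x))
      kw-derivation Fin.zero           = derivation-id
      kw-derivation (Fin.suc Fin.zero) = derivation-w

      X-poly z-poly a-poly b-poly : Polynomial 2
      X-poly = ω :* ω :* MXᵖ κ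
      z-poly = ω :* ω :* Zᵖ κ
      a-poly = aᵖ κ
      b-poly = bᵖ κ

    X z a b : ℚ → ℚ
    X k = w k * w k * MX k
    z k = w k * w k * Z k
    a k =  ι 3 * (ι 1 - ι 2 * k - k * k)
    b k =  ι 3 + ι 2 * k + k * k

    -- The scaled logarithmic derivatives of u and v are the polynomials a - b and a + b; for the
    -- sum X = u + v and the difference z = v - u this becomes a symmetric system with diagonal a
    -- and off-diagonal b.
    X-derivation : HasDerivation X (λ k → a k * X k + b k * z k)
    X-derivation = derivation-cong (λ _ _ → refl)
      (λ k _ → prove (kw k) (derive kw′ X-poly) (a-poly :* X-poly :+ b-poly :* z-poly) refl)
      (derivation-⟦⟧ kw kw′ kw-derivation X-poly)

    z-derivation : HasDerivation z (λ k → a k * z k + b k * X k)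
    z-derivation = derivation-cong (λ _ _ → refl)
      (λ k _ → prove (kw k) (derive kw′ z-poly) (a-poly :* z-poly :+ b-poly :* X-poly) refl)
      (derivation-⟦⟧ kw kw′ kw-derivation z-poly)

    L L⁻ : ℕ → ℚ → ℚ
    L n k = legendreᶻ (X k) (z k) n
    L⁻ n k = legendreᶻ⁻ (X k) (z k) n

    -- Lₙ is homogeneous of degree n in (X, z), so the diagonal of the system contributes n a Lₙ by
    -- Euler. The off-diagonal operator z ∂/∂X + X ∂/∂z sends Lₙ to n z Lₙ₋₁, which is (1 - x²) Pₙ′
    -- = n (Pₙ₋₁ - x Pₙ) in disguise.
    L′ L⁻′ : ℕ → ℚ → ℚ
    L′ n k = ι n * (a k * L n k + b k * (z k * L⁻ n k))
    L⁻′ zero    k = 0ℚ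
    L⁻′ (suc n) k = L′ n k

    -- Multiplication by z turns the contribution of Lₙ₋₂ into z² Lₙ₋₂, which the recurrence
    -- expresses through Lₙ and Lₙ₋₁. This is why z Lₙ₋₁, and not Lₙ₋₁, is paired with Lₙ. The
    -- factor `ι n` covers n = 0.
    z*L⁻′ : ∀ n k → ι n * (z k * L⁻′ n k) ≡
      ι n * ((ι n - ι 1) * (a k * (z k * L⁻ n k)) + b k * ((ι 2 * ι n - ι 1) * X k * L⁻ n k - ι n * L n k))
    z*L⁻′ zero    k = (solve 2 (λ z y →
        # 0 :* (z :* # 0) :=
        # 0 :* y)
        refl (z k) ((0ℚ - ι 1) * (a k * (z k * 0ℚ)) + b k * ((ι 2 * 0ℚ - ι 1) * X k * 0ℚ - 0ℚ * L 0 k)))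
    z*L⁻′ (suc n) k = trans (cong (λ N → N * (z k * L′ n k)) (ι-suc n)) (trans
      (modulo (legendreᶻ-rec (X k) (z k) n) ((ι n + ι 1) * b k)
        (solve 8 (λ n a b X z t p s →
            (n :+ # 1) :* (z :* (n :* (a :* t :+ b :* (z :* p)))) :=
            (n :+ # 1) :* ((n :+ # 1 :- # 1) :* (a :* (z :* t)) :+ b :* ((# 2 :* (n :+ # 1) :- # 1) :* X :*
              t :- (n :+ # 1) :* s)) :+ (n :+ # 1) :* b :* ((n :+ # 1) :* s :- ((# 2 :* n :+ # 1) :* X :* t :-
              n :* (z :* z) :* p)))
            refl (ι n) (a k) (b k) (X k) (z k) (L n k) (L⁻ n k) (L (suc n) k)))
      (cong (λ N → N * ((N - ι 1) * (a k * (z k * L n k)) + b k * ((ι 2 * N - ι 1) * X k * L n k - N * L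
          (suc n) k)))
        (sym (ι-suc n))))

    L-derivation  : ∀ n → HasDerivation (L n) (L′ n)
    L⁻-derivation : ∀ n → HasDerivation (L⁻ n) (L⁻′ n)

    L⁻-derivation zero    = derivation-const 0ℚ
    L⁻-derivation (suc n) = L-derivation n

    L-derivation zero = derivation-cong (λ _ _ → refl)
      (λ k _ → sym (ℚₚ.*-zeroˡ (a k * L 0 k + b k * (z k * L⁻ 0 k)))) (derivation-const (ι 1))
    L-derivation (suc n) = derivation-cong (λ _ _ → refl)
      (λ k _ → trans
        (modulo (z*L⁻′ n k) (- (ν n * z k))
        (modulo ([n+1]*ν n) ((ι n + ι 1) * b k * z k * L n k)
          (solve 9 (λ n v a b X z t p q →
              v :* ((# 2 :* n :+ # 1) :* (a :* X :+ b :* z) :* t :+ (# 2 :* n :+ # 1) :* X :*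
                (n :* (a :* t :+ b :* (z :* p))) :-
                (n :* ((a :* z :+ b :* X) :* z :+ z :* (a :* z :+ b :* X)) :* p :+ n :* (z :* z) :* q)) :=
              (n :+ # 1) :* (a :* (v :* ((# 2 :* n :+ # 1) :* X :* t :- n :* (z :* z) :* p)) :+
                b :* (z :* t)) :+ (:- (v :* z)) :* (n :* (z :* q) :- n :* ((n :- # 1) :* (a :* (z :* p)) :+
                b :* ((# 2 :* n :- # 1) :* X :* p :- n :* t))) :+ ((n :+ # 1) :* b :* z :* t) :*
                ((n :+ # 1) :* v :- # 1))
              refl (ι n) (ν n) (a k) (b k) (X k) (z k) (L n k) (L⁻ n k) (L⁻′ n k))))
        (cong (λ N → N * (a k * L (suc n) k + b k * (z k * L n k))) (sym (ι-suc n))))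
      (derivation-scalar (ν n) (derivation--
        (derivation-* (derivation-scalar (ι 2 * ι n + ι 1) X-derivation) (L-derivation n))
        (derivation-* (derivation-scalar (ι n) (derivation-* z-derivation z-derivation)) (L⁻-derivation n))))

  -- The Wronskian sums and their derivative

  module Wronskian where
    open Curve

    summand : ℕ → ℚ → ℚ
    summand n k = binom² n * linear k (z k) (ι n) (L n k) (L⁻ n k)

    V : ℕ → ℚ → ℚ
    V N k = ∑ N (λ n → w k * summand n k)

    h : ℚ → ℚ
    h k =  ι 16 * (k * (ι 1 - k)) * (ι 1 - ι 2 * k - k * k)

    M*w*w : ∀ {k} → 0ℚ ≤ k → M k * (w k * w k) ≡ ι 1
    M*w*w {k} 0≤k = modulo ([1+x]*w 0≤k) ((ι 1 + k) * w k + ι 1)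
      (solve 2 (λ k w →
          Mᵖ k :* (w :* w) :=
          # 1 :+ ((# 1 :+ k) :* w :+ # 1) :* ((# 1 :+ k) :* w :- # 1))
          refl k (w k))

    M*X : ∀ {k} → 0ℚ ≤ k → M k * X k ≡ MX k
    M*X {k} 0≤k = modulo (M*w*w 0≤k) (MX k)
      (solve 2 (λ k w →
          Mᵖ k :* (w :* w :* MXᵖ k) :=
          MXᵖ k :+ MXᵖ k :* (Mᵖ k :* (w :* w) :- # 1))
          refl k (w k))

    M*z : ∀ {k} → 0ℚ ≤ k → M k * z k ≡ Z k
    M*z {k} 0≤k = modulo (M*w*w 0≤k) (Z k)
      (solve 2 (λ k w → Mᵖ k :* (w :* w :* Zᵖ k) := Zᵖ k :+ Zᵖ k :* (Mᵖ k :* (w :* w) :- # 1)) refl k (w k))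

    private
      km : ℚ → ℚ → Vec ℚ 2
      km m k = k ∷ m ∷ []
      κ μ : Polynomial 2
      κ = var Fin.zero
      μ = var (Fin.suc Fin.zero)
      km′ : Fin 2 → Polynomial 2
      km′ Fin.zero           = # 2 :* κ :* (# 1 :- κ :* κ)
      km′ (Fin.suc Fin.zero) = # 0
      km-derivation : ∀ m i → HasDerivation (λ x → lookup (km m x) i) (λ x → ⟦ km′ i ⟧ (km m x))
      km-derivation m Fin.zero           = derivation-id
      km-derivation m (Fin.suc Fin.zero) = derivation-const m

      c d : ℚ → ℚ → ℚ
      c m k = (ι 1 + ι 6 * k - ι 5 * k * k) * m + ι 2 * k * (ι 1 - k)
      d m k = (ι 1 - ι 2 * k - k * k) * m

      c-derivation : ∀ m → HasDerivation (c m) (λ k → scale k * ( (ι 6 - ι 10 * k) * m + ι 2 - ι 4 * k ))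
      c-derivation m = derivation-cong (λ _ _ → refl)
        (λ k _ → prove (km m k) (derive km′ c-poly)
          (km′ Fin.zero :* ((# 6 :- # 10 :* κ) :* μ :+ # 2 :- # 4 :* κ)) refl)
        (derivation-⟦⟧ (km m) km′ (km-derivation m) c-poly)
        where
        c-poly : Polynomial 2
        c-poly = αᵖ κ :* μ :+ # 2 :* κ :* (# 1 :- κ)

      d-derivation : ∀ m → HasDerivation (d m) (λ k → scale k * ( (- ι 2 - ι 2 * k) * m ))
      d-derivation m = derivation-cong (λ _ _ → refl)
        (λ k _ → prove (km m k) (derive km′ d-poly)
          (km′ Fin.zero :* ((:- # 2 :- # 2 :* κ) :* μ)) refl)
        (derivation-⟦⟧ (km m) km′ (km-derivation m) d-poly)
        where
        d-poly : Polynomial 2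
        d-poly = βᵖ κ :* μ

    -- The derivative of the n-th term is the difference of these expressions at n + 1 and n, and
    -- the one at 0 vanishes. The survivor is at most of order N Lₙ with n = N - 1, hence
    -- geometrically small inside (0, 1), so no infinite series has to be differentiated.
    V-derivation : ∀ N → HasDerivation (V N) (λ k → w k * (binom² N * (ι N * ι N) * h k * L⁻ N k))
    V-derivation zero = derivation-cong (λ _ _ → refl)
      (λ k _ → (solve 2 (λ w h → # 0 := w :* (# 1 :* (# 0 :* # 0) :* h :* # 0)) refl (w k) (h k)))
        (derivation-const 0ℚ)
    V-derivation (suc n) = derivation-cong (λ _ _ → refl)
      (λ k (0≤k , _) → trans
        (modulo (M*w*w 0≤k) (- (ι 4 * w k * binom² n * L⁻ n k * (ι n * ι n) * (ι 4 * (k * (ι 1 - k)) *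
            (ι 1 - ι 2 * k - k * k) )))
        (modulo (z*L⁻′ n k) (w k * binom² n * (ι 1 - ι 2 * k - k * k) )
        (modulo (binom²-rec n) (- (w k * (ι 4 * (k * (ι 1 - k)) * (ι 1 - ι 2 * k - k * k) ) * L n k))
          (solve 8 (λ k n w A B t p q →
              w :* (A :* (n :* n) :* (# 16 :* (k :* (# 1 :- k)) :* βᵖ k) :* p) :+
                ((:- (# 2 :* w :* (k :* (# 1 :- k)))) :* (A :* ((αᵖ k :* n :+ # 2 :* k :* (# 1 :- k)) :* t :+
                βᵖ k :* n :* (w :* w :* Zᵖ k) :* p)) :+
                w :* (A :* (# 2 :* k :* (# 1 :- k :* k) :* ((# 6 :- # 10 :* k) :* n :+ # 2 :- # 4 :* k) :* t :+
                (αᵖ k :* n :+ # 2 :* k :* (# 1 :- k)) :* (n :* (aᵖ k :* t :+ bᵖ k :* (w :* w :* Zᵖ k :* p))) :+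
                ((# 2 :* k :* (# 1 :- k :* k) :* (((:- # 2) :- # 2 :* k) :* n) :* (w :* w :* Zᵖ k) :+
                βᵖ k :* n :* (aᵖ k :* (w :* w :* Zᵖ k) :+ bᵖ k :* (w :* w :* MXᵖ k))) :* p :+ βᵖ k :* n :*
                (w :* w :* Zᵖ k) :* q)))) :=
              w :* (B :* ((n :+ # 1) :* (n :+ # 1)) :* (# 16 :* (k :* (# 1 :- k)) :* βᵖ k) :* t) :+
                (:- (# 4 :* w :* A :* p :* (n :* n) :* (# 4 :* (k :* (# 1 :- k)) :* βᵖ k))) :*
                (Mᵖ k :* (w :* w) :- # 1) :+ (w :* A :* βᵖ k) :* (n :* (w :* w :* Zᵖ k :* q) :-
                n :* ((n :- # 1) :* (aᵖ k :* (w :* w :* Zᵖ k :* p)) :+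
                bᵖ k :* ((# 2 :* n :- # 1) :* (w :* w :* MXᵖ k) :* p :- n :* t))) :+
                (:- (w :* (# 4 :* (k :* (# 1 :- k)) :* βᵖ k) :* t)) :* (# 4 :* ((n :+ # 1) :* (n :+ # 1)) :*
                B :- (# 2 :* n :+ # 1) :* (# 2 :* n :+ # 1) :* A))
              refl k (ι n) (w k) (binom² n) (binom² (suc n)) (L n k) (L⁻ n k) (L⁻′ n k)))))
        (cong (λ N → w k * (binom² (suc n) * (N * N) * h k * L n k)) (sym (ι-suc n))))
      (derivation-+ (V-derivation n) (derivation-* derivation-w (derivation-scalar (binom² n)
        (derivation-+ (derivation-* (c-derivation (ι n)) (L-derivation n))
          (derivation-* (derivation-* (d-derivation (ι n)) z-derivation) (L⁻-derivation n))))))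

  -- Mean value inequality and geometric decay

  module MeanValue {f f′ : ℚ → ℚ} (D : HasDerivation f f′) {lo hi m₀ E : ℚ}
                   (0≤lo : 0ℚ ≤ lo) (hi≤1 : hi ≤ 1ℚ)
                   (m₀≤scale : ∀ p → lo ≤ p → p ≤ hi → m₀ ≤ scale p)
                   (∣f′∣≤E : ∀ p → lo ≤ p → p ≤ hi → ∣ f′ p ∣ ≤ E) where

    step : ∀ {x y} → lo ≤ x → x ≤ y → y ≤ hi →
           m₀ * ∣ f y - f x ∣ ≤ E * (y - x) + B D * ((y - x) * (y - x))
    step {x} {y} lo≤x x≤y y≤hi = begin
      m₀ * ∣ f y - f x ∣              ≤⟨ *-monoʳ-0≤ (ℚₚ.0≤∣p∣ (f y - f x)) (m₀≤scale x lo≤x x≤hi) ⟩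
      scale x * ∣ f y - f x ∣         ≤⟨ *-monoʳ-0≤ (ℚₚ.0≤∣p∣ (f y - f x)) (p≤∣p∣ (scale x)) ⟩
      ∣ scale x ∣ * ∣ f y - f x ∣     ≡⟨ ℚₚ.∣p*q∣≡∣p∣*∣q∣ (scale x) (f y - f x) ⟨
      ∣ scale x * (f y - f x) ∣       ≤⟨ ∣∣-≡ (solve 2 (λ s t →
          t :+ (s :- t) :=
          s)
          refl (scale x * (f y - f x)) (f′ x * (y - x)))
                                           (∣∣-+ (∣∣-* (∣f′∣≤E x lo≤x x≤hi) ∣h∣≤h) (taylor D xI yI)) ⟩
      E * h + B D * (∣ h ∣ * ∣ h ∣)   ≡⟨ cong (λ s → E * h + B D * (s * s)) (ℚₚ.0≤p⇒∣p∣≡p (gap x≤y)) ⟩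
      E * h + B D * (h * h)           ∎
      where
      open ℚₚ.≤-Reasoning
      h : ℚ
      h = y - x
      ∣h∣≤h : ∣ h ∣ ≤ h
      ∣h∣≤h = ∣∣-0≤ (gap x≤y) ℚₚ.≤-refl
      x≤hi : x ≤ hi
      x≤hi = ℚₚ.≤-trans x≤y y≤hi
      xI : InUnit x
      xI = ℚₚ.≤-trans 0≤lo lo≤x , ℚₚ.≤-trans x≤hi hi≤1
      yI : InUnit y
      yI = ℚₚ.≤-trans (proj₁ xI) x≤y , ℚₚ.≤-trans y≤hi hi≤1

    module _ {x y : ℚ} (lo≤x : lo ≤ x) (x≤y : x ≤ y) (y≤hi : y ≤ hi) (0≤m₀ : 0ℚ ≤ m₀) where
      steps : ∀ η → 0ℚ ≤ η → ∀ j → x + ι j * η ≤ y →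
              m₀ * ∣ f (x + ι j * η) - f x ∣ ≤ ι j * (E * η + B D * (η * η))
      steps η 0≤η zero    le = ℚₚ.≤-reflexive (trans
        (cong (m₀ *_) (trans (cong (λ p → ∣ f p - f x ∣) (solve 2 (λ x η → x :+ # 0 :* η := x) refl x η))
          (cong ∣_∣ (ℚₚ.+-inverseʳ (f x)))))
        (solve 2 (λ m e → m :* # 0 := # 0 :* e) refl m₀ (E * η + B D * (η * η))))
      steps η 0≤η (suc j) le = begin
        m₀ * ∣ f p′ - f x ∣                       ≤⟨ *-monoˡ-0≤ 0≤m₀ (∣∣-≡ (solve 3 (λ a b c →
            (a :- b) :+ (b :- c) :=
            a :- c)
            refl (f p′) (f p) (f x))
                                                       (∣∣-+ (ℚₚ.≤-refl {∣ f p′ - f p ∣})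
                                                           (ℚₚ.≤-refl {∣ f p - f x ∣}))) ⟩
        m₀ * (∣ f p′ - f p ∣ + ∣ f p - f x ∣)     ≡⟨ ℚₚ.*-distribˡ-+ m₀ _ _ ⟩
        m₀ * ∣ f p′ - f p ∣ + m₀ * ∣ f p - f x ∣  ≤⟨ ℚₚ.+-mono-≤
            (subst (λ h → m₀ * ∣ f p′ - f p ∣ ≤ E * h + B D * (h * h)) p′-p (step (ℚₚ.≤-trans lo≤x x≤p) p≤p′
                (ℚₚ.≤-trans le y≤hi)))
            (steps η 0≤η j (ℚₚ.≤-trans p≤p′ le)) ⟩
        E * η + B D * (η * η) + ι j * (E * η + B D * (η * η))
          ≡⟨ (solve 2 (λ e j → e :+ j :* e := (j :+ # 1) :* e) refl (E * η + B D * (η * η)) (ι j)) ⟩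
        (ι j + ι 1) * (E * η + B D * (η * η))
          ≡⟨ cong (_* (E * η + B D * (η * η))) (ι-suc j) ⟨
        ι (suc j) * (E * η + B D * (η * η))       ∎
        where
        open ℚₚ.≤-Reasoning
        p p′ : ℚ
        p  = x + ι j * η
        p′ = x + ι (suc j) * η
        p′-p : p′ - p ≡ η
        p′-p = trans (cong (λ J → x + J * η - p) (ι-suc j)) (solve 3 (λ x η j →
            x :+ (j :+ # 1) :* η :- (x :+ j :* η) :=
            η)
            refl x η (ι j))
        p≤p′ : p ≤ p′
        p≤p′ = ≤-by 0≤η (trans (solve 2 (λ p p′ → p′ := p :+ (p′ :- p)) refl p p′) (cong (λ h → p + h) p′-p))
        x≤p : x ≤ p
        x≤p = ≤-by (0≤ι j ⊗ 0≤η) refl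

      -- Over ℚ there is no intermediate point. Instead [x, y] is cut into n + 1 equal steps, whose
      -- quadratic remainders add up to B (y - x)² / (n + 1), and `≤-arbitrary` removes them.
      mean-value : m₀ * ∣ f y - f x ∣ ≤ E * (y - x)
      mean-value = ≤-arbitrary (B D * (h * h)) bound
        where
        h : ℚ
        h = y - x
        bound : ∀ n → m₀ * ∣ f y - f x ∣ ≤ E * h + B D * (h * h) * ν n
        bound n = subst₂ _≤_ (cong (λ p → m₀ * ∣ f p - f x ∣) end)
          (modulo (ι*ν n) (E * h + B D * (h * h) * ν n)
            (solve 5 (λ e b h v N →
                N :* (e :* (h :* v) :+ b :* ((h :* v) :* (h :* v))) :=
                e :* h :+ b :* (h :* h) :* v :+ (e :* h :+ b :* (h :* h) :* v) :* (N :* v :- # 1))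
                refl E (B D) h (ν n) (ι (suc n))))
          (steps (h * ν n) (gap x≤y ⊗ 0≤ν n) (suc n) (ℚₚ.≤-reflexive end))
          where
          end : x + ι (suc n) * (h * ν n) ≡ y
          end = modulo (ι*ν n) h (solve 4 (λ x y v N →
              x :+ N :* ((y :- x) :* v) :=
              y :+ (y :- x) :* (N :* v :- # 1))
              refl x y (ν n) (ι (suc n)))

  0≤^ : ∀ {p} → 0ℚ ≤ p → ∀ n → 0ℚ ≤ p ^ n
  0≤^ 0≤p zero    = 0≤ι 1
  0≤^ 0≤p (suc n) = 0≤p ⊗ 0≤^ 0≤p n

  ^-mono : ∀ {p q} → 0ℚ ≤ p → p ≤ q → ∀ n → p ^ n ≤ q ^ n
  ^-mono 0≤p p≤q zero    = ℚₚ.≤-refl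
  ^-mono 0≤p p≤q (suc n) = *-mono-0≤ 0≤p (0≤^ (ℚₚ.≤-trans 0≤p p≤q) n) p≤q (^-mono 0≤p p≤q n)

  ^≤1 : ∀ {p} → 0ℚ ≤ p → p ≤ 1ℚ → ∀ n → p ^ n ≤ 1ℚ
  ^≤1 0≤p p≤1 zero    = ℚₚ.≤-refl
  ^≤1 {p} 0≤p p≤1 (suc n) = ℚₚ.≤-trans (*-mono-0≤ 0≤p (0≤ι 1) p≤1 (^≤1 0≤p p≤1 n))
      (ℚₚ.≤-reflexive (ℚₚ.*-identityˡ 1ℚ))

  cube-^ : ∀ q n → (q * q * q) ^ n ≡ q ^ n * q ^ n * q ^ n
  cube-^ q zero    = refl
  cube-^ q (suc n) = trans (cong (q * q * q *_) (cube-^ q n))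
    (solve 2 (λ q s → q :* q :* q :* (s :* s :* s) := q :* s :* (q :* s) :* (q :* s)) refl q (q ^ n))

  -- The right side is (1 - q)(1 + q + ⋯ + qⁿ), and each of these n + 1 powers is at least qⁿ.
  [n+1]*^≤ : ∀ {q} → 0ℚ ≤ q → q ≤ 1ℚ → ∀ n → (1ℚ - q) * ((ι n + ι 1) * q ^ n) ≤ 1ℚ - q * q ^ n
  [n+1]*^≤ {q} 0≤q q≤1 zero    = ℚₚ.≤-reflexive (solve 1 (λ q →
      (# 1 :- q) :* ((# 0 :+ # 1) :* # 1) :=
      # 1 :- q :* # 1)
      refl q)
  [n+1]*^≤ {q} 0≤q q≤1 (suc n) = ≤-by
    (0≤q ⊗ gap ([n+1]*^≤ 0≤q q≤1 n) ⊕ gap q≤1 ⊗ gap (^≤1 0≤q q≤1 (suc n)))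
    (trans (solve 3 (λ q n s →
        # 1 :- q :* (q :* s) :=
        (# 1 :- q) :* ((n :+ # 1 :+ # 1) :* (q :* s)) :+
          (q :* (# 1 :- q :* s :- (# 1 :- q) :* ((n :+ # 1) :* s)) :+ (# 1 :- q) :* (# 1 :- q :* s)))
        refl q (ι n) (q ^ n))
      (cong (λ N → (1ℚ - q) * ((N + ι 1) * (q * q ^ n))
        + (q * (1ℚ - q * q ^ n - (1ℚ - q) * ((ι n + ι 1) * q ^ n)) + (1ℚ - q) * (1ℚ - q * q ^ n)))
            (sym (ι-suc n))))

  ι-mono : ∀ {m n} → m ℕ.≤ n → ι m ≤ ι n
  ι-mono {m} {n} m≤n = ≤-by (0≤ι (n ℕ.∸ m)) (trans (cong ι (sym (ℕₚ.m+[n∸m]≡n m≤n))) (ι-+ m (n ℕ.∸ m)))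

  -- With q = 1 − (1 − R)/3 one has R ≤ q³, and (n + 1) qⁿ is bounded.
  quadratic-decay : ∀ {R} → 0ℚ ≤ R → R < 1ℚ → ∀ K {ε} → 0ℚ ≤ K → 0ℚ < ε →
    ∃[ N ] ∀ n → N ℕ.≤ n → K * ((ι n + ι 1) * (ι n + ι 1) * R ^ n) ≤ ε
  quadratic-decay {R} 0≤R R<1 K {ε} 0≤K 0<ε = proj₁ arch , bound
    where
    y q : ℚ
    y = (1ℚ - R) * ν 2
    q = 1ℚ - y
    0<y : 0ℚ < y
    0<y = *-pos (ℚₚ.<-respˡ-≡ (ℚₚ.+-inverseʳ R) (ℚₚ.+-monoˡ-< (- R) R<1)) (0<ν 2)
    0≤y : 0ℚ ≤ y
    0≤y = ℚₚ.<⇒≤ 0<y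
    3y : ι 3 * y ≡ 1ℚ - R
    3y = modulo (ι*ν 2) (1ℚ - R) (solve 2 (λ R v →
        # 3 :* ((# 1 :- R) :* v) :=
        # 1 :- R :+ (# 1 :- R) :* (# 3 :* v :- # 1))
        refl R (ν 2))
    y≤1 : y ≤ 1ℚ
    y≤1 = ≤-by (0≤R ⊕ 0≤ι 2 ⊗ 0≤y) (modulo 3y (- 1ℚ) (solve 2 (λ y R →
        # 1 :=
        y :+ (R :+ # 2 :* y) :+ (:- # 1) :* (# 3 :* y :- (# 1 :- R)))
        refl y R))
    -- (1 - y)³ = 1 - 3y + y² (3 - y), and 1 - 3y = R.
    R≤q³ : R ≤ q * q * q
    R≤q³ = ≤-by (0≤p*p y ⊗ (0≤ι 2 ⊕ gap y≤1)) (modulo 3y (- 1ℚ)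
      (solve 2 (λ y R →
          (# 1 :- y) :* (# 1 :- y) :* (# 1 :- y) :=
          R :+ y :* y :* (# 2 :+ (# 1 :- y)) :+ (:- # 1) :* (# 3 :* y :- (# 1 :- R)))
          refl y R))
    arch : ∃[ N ] K ≤ ε * (y * y * y) * ι N
    arch = archimedean-* (*-pos 0<ε (*-pos (*-pos 0<y 0<y) 0<y)) K
    bound : ∀ n → proj₁ arch ℕ.≤ n → K * ((ι n + ι 1) * (ι n + ι 1) * R ^ n) ≤ ε
    bound n N≤n = begin
      -- Three factors y (n + 1) qⁿ ≤ 1 are needed to use up q³ⁿ; the third n + 1 is supplied by K ≤
      -- ε y³ (n + 1).
      K * (m * m * R ^ n)                        ≤⟨ *-mono-0≤ 0≤K (0≤m ⊗ 0≤m ⊗ (0≤s ⊗ 0≤s ⊗ 0≤s)) K≤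
                                                     (*-monoˡ-0≤ (0≤m ⊗ 0≤m) (ℚₚ.≤-trans (^-mono 0≤R R≤q³ n)
                                                         (ℚₚ.≤-reflexive (cube-^ q n)))) ⟩
      ε * (y * y * y) * m * (m * m * (s * s * s)) ≡⟨ (solve 4 (λ e y m s →
          e :* (y :* y :* y) :* m :* (m :* m :* (s :* s :* s)) :=
          e :* (y :* (m :* s) :* (y :* (m :* s)) :* (y :* (m :* s))))
          refl ε y m s) ⟩
      ε * (c * c * c)                            ≤⟨ *-monoˡ-0≤ (ℚₚ.<⇒≤ 0<ε) (*-mono-0≤ (0≤c ⊗ 0≤c) (0≤ι 1)
          (*-mono-0≤ 0≤c (0≤ι 1) c≤1 c≤1) c≤1) ⟩
      ε * (1ℚ * 1ℚ * 1ℚ)                         ≡⟨ (solve 1 (λ e → e :* (# 1 :* # 1 :* # 1) := e) refl ε) ⟩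
      ε                                          ∎
      where
      open ℚₚ.≤-Reasoning
      m s c : ℚ
      m = ι n + ι 1
      s = q ^ n
      c = y * (m * s)
      0≤m : 0ℚ ≤ m
      0≤m = 0≤ι n ⊕ 0≤ι 1
      0≤q : 0ℚ ≤ q
      0≤q = gap y≤1
      q≤1 : q ≤ 1ℚ
      q≤1 = ≤-by 0≤y (solve 1 (λ y → # 1 := # 1 :- y :+ y) refl y)
      0≤s : 0ℚ ≤ s
      0≤s = 0≤^ 0≤q n
      0≤c : 0ℚ ≤ c
      0≤c = 0≤y ⊗ (0≤m ⊗ 0≤s)
      c≤1 : c ≤ 1ℚ
      c≤1 = ≤-by (gap ([n+1]*^≤ 0≤q q≤1 n) ⊕ 0≤q ⊗ 0≤s)
        (solve 3 (λ y m s →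
            # 1 :=
            y :* (m :* s) :+ (# 1 :- (# 1 :- y) :* s :- (# 1 :- (# 1 :- y)) :* (m :* s) :+ (# 1 :- y) :* s))
            refl y m s)
      K≤ : K ≤ ε * (y * y * y) * m
      K≤ = ℚₚ.≤-trans (proj₂ arch) (≤-by (ℚₚ.<⇒≤ 0<ε ⊗ (0≤y ⊗ 0≤y ⊗ 0≤y) ⊗ (gap (ι-mono N≤n) ⊕ 0≤ι 1))
        (solve 3 (λ e N n →
            e :* (n :+ # 1) :=
            e :* N :+ e :* (n :- N :+ # 1))
            refl (ε * (y * y * y)) (ι (proj₁ arch)) (ι n)))

  -- Bounds for the binomial weights

  binom²-anti : ∀ n → binom² (suc n) ≤ binom² n
  binom²-anti n = *-cancelˡ-≤ (ι 4 * ((ι n + ι 1) * (ι n + ι 1)))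
      (*-pos (0<ι-suc 3) (*-pos (0<ι+1 n) (0<ι+1 n)))
    (≤-by ((0≤ι 4 ⊗ 0≤ι n ⊕ 0≤ι 3) ⊗ 0≤binom² n) (modulo (binom²-rec n) (- ι 1)
      (solve 3 (λ n a b →
          # 4 :* ((n :+ # 1) :* (n :+ # 1)) :* a :=
          # 4 :* ((n :+ # 1) :* (n :+ # 1)) :* b :+ (# 4 :* n :+ # 3) :* a :+
            (:- # 1) :* (# 4 :* ((n :+ # 1) :* (n :+ # 1)) :* b :- (# 2 :* n :+ # 1) :* (# 2 :* n :+ # 1) :* a))
          refl (ι n) (binom² n) (binom² (suc n)))))

  binom²≤1 : ∀ n → binom² n ≤ 1ℚ
  binom²≤1 zero    = ℚₚ.≤-refl
  binom²≤1 (suc n) = ℚₚ.≤-trans (binom²-anti n) (binom²≤1 n)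

  -- (2n + 1) Aₙ decreases from 1: its consecutive ratio is (2n + 1)(2n + 3) / (2n + 2)².
  [2n+1]*binom²≤1 : ∀ n → (ι 2 * ι n + ι 1) * binom² n ≤ 1ℚ
  [2n+1]*binom²≤1 zero    = ℚₚ.≤-reflexive (solve 0 ((# 2 :* # 0 :+ # 1) :* # 1 := # 1) refl)
  [2n+1]*binom²≤1 (suc n) = ℚₚ.≤-trans (*-cancelˡ-≤ (ι 4 * ((ι n + ι 1) * (ι n + ι 1)))
      (*-pos (0<ι-suc 3) (*-pos (0<ι+1 n) (0<ι+1 n)))
      (≤-by ((0≤ι 2 ⊗ 0≤ι n ⊕ 0≤ι 1) ⊗ 0≤binom² n) (trans
        (modulo (binom²-rec n) (- (ι 2 * ι n + ι 3))
          (solve 3 (λ n a b →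
              # 4 :* ((n :+ # 1) :* (n :+ # 1)) :* ((# 2 :* n :+ # 1) :* a) :=
              # 4 :* ((n :+ # 1) :* (n :+ # 1)) :* ((# 2 :* (n :+ # 1) :+ # 1) :* b) :+ (# 2 :* n :+ # 1) :*
                a :+ (:- (# 2 :* n :+ # 3)) :* (# 4 :* ((n :+ # 1) :* (n :+ # 1)) :* b :- (# 2 :* n :+ # 1) :*
                (# 2 :* n :+ # 1) :* a))
              refl (ι n) (binom² n) (binom² (suc n))))
        (cong (λ N → ι 4 * ((ι n + ι 1) * (ι n + ι 1)) * ((ι 2 * N + ι 1) * binom² (suc n)) +
            (ι 2 * ι n + ι 1) * binom² n)
          (sym (ι-suc n))))))
    ([2n+1]*binom²≤1 n)

  n*binom²≤1 : ∀ n → ι n * binom² n ≤ 1ℚ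
  n*binom²≤1 n = ℚₚ.≤-trans (≤-by ((0≤ι n ⊕ 0≤ι 1) ⊗ 0≤binom² n)
    (solve 2 (λ n a → (# 2 :* n :+ # 1) :* a := n :* a :+ (n :+ # 1) :* a) refl (ι n) (binom² n)))
      ([2n+1]*binom²≤1 n)

  p<1⇒0<1-p : ∀ {p} → p < 1ℚ → 0ℚ < 1ℚ - p
  p<1⇒0<1-p {p} p<1 = ℚₚ.<-respˡ-≡ (ℚₚ.+-inverseʳ p) (ℚₚ.+-monoˡ-< (- p) p<1)

  -- Growth of Lₙ along the curve

  module Curve-bounds {k : ℚ} (0<k : 0ℚ < k) (k<1 : k < 1ℚ) where
    open Curve
    open Wronskian using (M*w*w)

    0≤k : 0ℚ ≤ k
    0≤k = ℚₚ.<⇒≤ 0<k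

    0≤1-k : 0ℚ ≤ 1ℚ - k
    0≤1-k = gap (ℚₚ.<⇒≤ k<1)

    unit : InUnit k
    unit = 0≤k , ℚₚ.<⇒≤ k<1

    0≤w² : 0ℚ ≤ w k * w k
    0≤w² = 0≤p*p (w k)

    0<w² : 0ℚ < w k * w k
    0<w² = ℚₚ.*-cancelˡ-<-nonNeg (M k) {{ℚ.nonNegative (0≤p*p (ι 1 + k))}}
      (subst₂ _<_ (sym (ℚₚ.*-zeroʳ (M k))) (sym (M*w*w 0≤k)) (0<ι-suc 0))

    0<X : 0ℚ < X k
    0<X = *-pos 0<w² (ℚₚ.<-≤-trans (*-pos (0<ι-suc 3) (*-pos (*-pos 0<k 0<k) 0<k))
      (≤-by (0≤1-k ⊗ 0≤1-k ⊗ 0≤1-k ⊗ (0≤ι 1 ⊕ 0≤k)) (solve 1 (λ k →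
          MXᵖ k :=
          # 4 :* (k :* k :* k) :+ (# 1 :- k) :* (# 1 :- k) :* (# 1 :- k) :* (# 1 :+ k))
          refl k)))

    -- X² − z² = 4uv with u = (1 − k)³ / (1 + k) and v = 4k³ / (1 + k)².
    z²≤X² : z k * z k ≤ X k * X k
    z²≤X² = ≤-by (0≤w² ⊗ 0≤w² ⊗ (0≤ι 16 ⊗ (0≤k ⊗ 0≤k ⊗ 0≤k) ⊗ (0≤1-k ⊗ 0≤1-k ⊗ 0≤1-k) ⊗ (0≤ι 1 ⊕ 0≤k)))
      (solve 2 (λ k w →
          (w :* w :* MXᵖ k) :* (w :* w :* MXᵖ k) :=
          (w :* w :* Zᵖ k) :* (w :* w :* Zᵖ k) :+ w :* w :* (w :* w) :* (# 16 :* (k :* k :* k) :*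
            ((# 1 :- k) :* (# 1 :- k) :* (# 1 :- k)) :* (# 1 :+ k)))
          refl k (w k))

    -- A rational upper bound for the growth rate (√u + √v)² of Lₙ.
    r : ℚ
    r = w k * w k *  ((ι 1 + k) * (ι 1 - k + k * k + k * k * k))

    X≤r : X k ≤ r
    X≤r = ≤-by (0≤w² ⊗ (0≤ι 2 ⊗ 0≤k ⊗ 0≤1-k ⊗ (0≤ι 1 ⊕ 0≤k ⊗ 0≤1-k)))
      (solve 2 (λ k w →
          w :* w :* Rᵖ k :=
          w :* w :* MXᵖ k :+ w :* w :* (# 2 :* k :* (# 1 :- k) :* (# 1 :+ k :* (# 1 :- k))))
          refl k (w k))

    -- Here 2√(uv) = 4k (1 - k) √(k (1 - k²)) / (1 + k)², and the inequality of the means for k and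
    -- 1 - k² bounds it by r - X. Its defect is a square, so (r - X)² - 4uv is the square of 2k (1 -
    -- k)(1 - k - k²) / (1 + k)².
    0≤char : 0ℚ ≤ r * r - ι 2 * X k * r + z k * z k
    0≤char = subst (0ℚ ≤_) (solve 2 (λ k w →
        # 4 :* ((w :* w :* (k :* (# 1 :- k) :* (# 1 :- k :- k :* k))) :*
          (w :* w :* (k :* (# 1 :- k) :* (# 1 :- k :- k :* k)))) :=
        (w :* w :* Rᵖ k) :* (w :* w :* Rᵖ k) :- # 2 :* (w :* w :* MXᵖ k) :* (w :* w :* Rᵖ k) :+
          (w :* w :* Zᵖ k) :* (w :* w :* Zᵖ k))
        refl k (w k))
      (0≤ι 4 ⊗ 0≤p*p (w k * w k *  (k * (ι 1 - k) * (ι 1 - k - k * k)) ))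

    r≤1-k[1-k] : r ≤ 1ℚ - k * (1ℚ - k)
    r≤1-k[1-k] = ≤-by (0≤k ⊗ 0≤1-k ⊗ 0≤w² ⊗ (0≤ι 1 ⊕ 0≤k)) (modulo (M*w*w 0≤k) (- (1ℚ - k * (1ℚ - k)))
      (solve 2 (λ k w →
          # 1 :- k :* (# 1 :- k) :=
          w :* w :* Rᵖ k :+ k :* (# 1 :- k) :* (w :* w) :* (# 1 :+ k) :+ (:- (# 1 :- k :* (# 1 :- k))) :*
            (Mᵖ k :* (w :* w) :- # 1))
          refl k (w k)))

    0≤L : ∀ n → 0ℚ ≤ L n k
    0≤L = 0≤legendreᶻ 0<X z²≤X²

    L≤^ : ∀ {R} → 1ℚ - k * (1ℚ - k) ≤ R → ∀ n → L n k ≤ R ^ n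
    L≤^ r≤R n = ℚₚ.≤-trans (legendreᶻ≤^ 0<X z²≤X² X≤r 0≤char n)
      (^-mono (ℚₚ.≤-trans (ℚₚ.<⇒≤ 0<X) X≤r) (ℚₚ.≤-trans r≤1-k[1-k] r≤R) n)

    ∣be∣≤2 : ∣ (ι 1 - ι 2 * k - k * k)  ∣ ≤ ι 2
    ∣be∣≤2 = ∣∣-lub (≤-by (0≤ι 1 ⊕ 0≤ι 2 ⊗ 0≤k ⊕ 0≤k ⊗ 0≤k) (solve 1 (λ k →
        # 2 :=
        βᵖ k :+ (# 1 :+ # 2 :* k :+ k :* k))
        refl k))
      (≤-by (0≤1-k ⊗ (0≤ι 3 ⊕ 0≤k)) (solve 1 (λ k → # 2 := (:- βᵖ k) :+ (# 1 :- k) :* (# 3 :+ k)) refl k))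

    ∣Z∣≤4 : ∣ Z k ∣ ≤ ι 4
    ∣Z∣≤4 = ℚₚ.≤-trans (∣∣-* {k * k + ι 1} {k * k + ι 2 * k - ι 1}
      (∣∣-0≤ (0≤k ⊗ 0≤k ⊕ 0≤ι 1) (≤-by (0≤1-k ⊗ (0≤ι 1 ⊕ 0≤k)) (solve 1 (λ k →
          # 2 :=
          k :* k :+ # 1 :+ (# 1 :- k) :* (# 1 :+ k))
          refl k)))
      (∣∣-≡ (solve 1 (λ k → (:- βᵖ k) := k :* k :+ # 2 :* k :- # 1) refl k) (∣∣-neg ∣be∣≤2)))
      (ℚₚ.≤-reflexive (solve 0 (# 2 :* # 2 := # 4) refl))

  module Curve-range {lo hi : ℚ} (0<lo : 0ℚ < lo) (hi<1 : hi < 1ℚ) where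
    open Curve
    open Wronskian

    InRange : ℚ → Set
    InRange k = lo ≤ k × k ≤ hi

    0<k : ∀ {k} → InRange k → 0ℚ < k
    0<k (lo≤k , _) = ℚₚ.<-≤-trans 0<lo lo≤k

    k<1 : ∀ {k} → InRange k → k < 1ℚ
    k<1 (_ , k≤hi) = ℚₚ.≤-<-trans k≤hi hi<1

    -- On [lo, hi] one has k (1 - k) ≥ lo (1 - hi), so a single rate R < 1 serves all points. The
    -- same m₀ bounds `scale` from below in `V-near-constant`.
    m₀ R : ℚ
    m₀ = lo * (1ℚ - hi)
    R = 1ℚ - m₀

    0<m₀ : 0ℚ < m₀
    0<m₀ = *-pos 0<lo (p<1⇒0<1-p hi<1)

    m₀≤k[1-k] : ∀ {k} → InRange k → m₀ ≤ k * (1ℚ - k)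
    m₀≤k[1-k] {k} kI@(lo≤k , k≤hi) = ≤-by (gap lo≤k ⊗ gap (ℚₚ.<⇒≤ hi<1) ⊕ ℚₚ.<⇒≤ (0<k kI) ⊗ gap k≤hi)
      (solve 3 (λ k l h →
          k :* (# 1 :- k) :=
          l :* (# 1 :- h) :+ ((k :- l) :* (# 1 :- h) :+ k :* (h :- k)))
          refl k lo hi)

    R<1 : R < 1ℚ
    R<1 = subst (R <_) (solve 1 (λ m → # 1 :- m :+ m := # 1) refl m₀) (subst (_< R + m₀) (ℚₚ.+-identityʳ R)
      (ℚₚ.+-monoʳ-< R 0<m₀))

    0≤R : ∀ {k} → InRange k → 0ℚ ≤ R
    0≤R {k} kI = ≤-by (gap (m₀≤k[1-k] kI) ⊕ (0≤1-k ⊕ 0≤p*p k))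
      (solve 2 (λ k m → # 1 :- m := # 0 :+ (k :* (# 1 :- k) :- m :+ (# 1 :- k :+ k :* k))) refl k m₀)
      where open Curve-bounds (0<k kI) (k<1 kI)

    L≤R^ : ∀ {k} → InRange k → ∀ n → L n k ≤ R ^ n
    L≤R^ {k} kI = L≤^ (≤-by (gap (m₀≤k[1-k] kI)) (solve 2 (λ p m →
        # 1 :- m :=
        # 1 :- p :+ (p :- m))
        refl (k * (1ℚ - k)) m₀))
      where open Curve-bounds (0<k kI) (k<1 kI)

    V′≤ : ∀ {k} → InRange k → ∀ n →
          ∣ w k * (binom² (suc n) * (ι (suc n) * ι (suc n)) * h k * L n k) ∣ ≤ ι 32 *
              ((ι n + ι 1) * (ι n + ι 1) * R ^ n)
    V′≤ {k} kI n = ℚₚ.≤-trans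
      (∣∣-* (∣∣-0≤ (0≤w 0≤k) (w≤1 0≤k)) (∣∣-* (∣∣-* (∣∣-*
        (∣∣-0≤ (0≤binom² (suc n)) (binom²≤1 (suc n)))
        (∣∣-0≤ (0≤ι (suc n) ⊗ 0≤ι (suc n)) (ℚₚ.≤-reflexive (cong (λ N → N * N) (ι-suc n)))))
        (∣∣-* {ι 16 * (k * (ι 1 - k))} (∣∣-0≤ (0≤ι 16 ⊗ (0≤k ⊗ 0≤1-k)) 16k[1-k]≤16) ∣be∣≤2))
        (∣∣-0≤ (0≤L n) (L≤R^ kI n))))
      (ℚₚ.≤-reflexive (solve 2 (λ n p →
          # 1 :* (# 1 :* ((n :+ # 1) :* (n :+ # 1)) :* (# 16 :* # 2) :* p) :=
          # 32 :* ((n :+ # 1) :* (n :+ # 1) :* p))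
          refl (ι n) (R ^ n)))
      where
      open Curve-bounds (0<k kI) (k<1 kI)
      16k[1-k]≤16 : ι 16 * (k * (ι 1 - k)) ≤ ι 16
      16k[1-k]≤16 = ≤-by (0≤ι 16 ⊗ (0≤1-k ⊕ 0≤p*p k)) (solve 1 (λ k →
          # 16 :=
          # 16 :* (k :* (# 1 :- k)) :+ # 16 :* (# 1 :- k :+ k :* k))
          refl k)

    V-near-constant : ∀ {x} → InRange x → ∀ {ε} → 0ℚ < ε →
      ∃[ N ] ∀ n → N ℕ.≤ n → ∀ {y} → InRange y → x ≤ y → ∣ V (suc n) y - V (suc n) x ∣ ≤ ε
    V-near-constant {x} xI {ε} 0<ε =
      -- The derivative is made smaller than ε m₀, not ε, because the mean value inequality leaves
      -- the factor m₀ on the left.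
      let N , small = quadratic-decay (0≤R xI) R<1 (ι 32) (0≤ι 32) (*-pos 0<ε 0<m₀)
      in N , λ n N≤n {y} yI x≤y → *-cancelˡ-≤ m₀ 0<m₀ (begin
        m₀ * ∣ V (suc n) y - V (suc n) x ∣
          ≤⟨ MeanValue.mean-value (V-derivation (suc n)) (ℚₚ.<⇒≤ 0<lo) (ℚₚ.<⇒≤ hi<1)
               (λ p lo≤p p≤hi → m₀≤scale (lo≤p , p≤hi)) (λ p lo≤p p≤hi → ℚₚ.≤-trans (V′≤ (lo≤p , p≤hi) n)
                   (small n N≤n))
               (proj₁ xI) x≤y (proj₂ yI) (ℚₚ.<⇒≤ 0<m₀) ⟩
        ε * m₀ * (y - x)
          ≤⟨ ≤-by ((ℚₚ.<⇒≤ 0<ε ⊗ ℚₚ.<⇒≤ 0<m₀) ⊗ (ℚₚ.<⇒≤ (0<k xI) ⊕ gap (ℚₚ.<⇒≤ (k<1 yI))))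
               (solve 4 (λ e m x y →
                   m :* e :=
                   e :* m :* (y :- x) :+ e :* m :* (x :+ (# 1 :- y)))
                   refl ε m₀ x y) ⟩
        m₀ * ε ∎)
      where
      open ℚₚ.≤-Reasoning
      m₀≤scale : ∀ {p} → InRange p → m₀ ≤ scale p
      m₀≤scale {p} pI = ℚₚ.≤-trans (m₀≤k[1-k] pI) (≤-by (0≤k ⊗ 0≤1-k ⊗ (0≤ι 1 ⊕ 0≤ι 2 ⊗ 0≤k))
        (solve 1 (λ k →
            # 2 :* k :* (# 1 :- k :* k) :=
            k :* (# 1 :- k) :+ k :* (# 1 :- k) :* (# 1 :+ # 2 :* k))
            refl p))
        where open Curve-bounds (0<k pI) (k<1 pI)

    ∣boundary∣≤ : ∀ {k} → InRange k → ∀ n →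
      ∣ boundary k (ι (suc n)) (binom² (suc n)) (L (suc n) k) (L n k) ∣ ≤ ι 192 * ((ι n + ι 1) * (ι n + ι 1) *
          R ^ n)
    ∣boundary∣≤ {k} kI n = ℚₚ.≤-trans
      -- The boundary term is regrouped so that m Aₘ ≤ 1 absorbs one factor m; the growth left over
      -- is quadratic, as `quadratic-decay` expects.
      (∣∣-≡ (solve 6 (λ m a z g l p →
          (# 4 :* m) :* (m :* a) :* ((m :+ # 1) :* (z :* z) :* p :+ (:- (m :* (g :* g) :* l))) :=
          # 4 :* a :* (m :* m) :* ((m :+ # 1) :* (z :* z) :* p :- m :* (g :* g) :* l))
          refl (ι (suc n)) (binom² (suc n)) (Z k) (M k) (L (suc n) k) (L n k))
        (∣∣-* (∣∣-* ∣4m∣≤ (∣∣-0≤ (0≤m ⊗ 0≤binom² (suc n)) (n*binom²≤1 (suc n))))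
          (∣∣-+ (∣∣-* (∣∣-* ∣m+1∣≤ (∣∣-* ∣Z∣≤4 ∣Z∣≤4)) (∣∣-0≤ (0≤L n) (L≤R^ kI n)))
            (∣∣-neg (∣∣-* (∣∣-* ∣m∣≤ (∣∣-* ∣M∣≤4 ∣M∣≤4)) (∣∣-0≤ (0≤L (suc n)) L≤R^n))))))
      (ℚₚ.≤-reflexive (solve 2 (λ n p →
          # 4 :* (n :+ # 1) :* # 1 :* (# 2 :* (n :+ # 1) :* (# 4 :* # 4) :* p :+ (n :+ # 1) :* (# 4 :* # 4) :*
            p) :=
          # 192 :* ((n :+ # 1) :* (n :+ # 1) :* p))
          refl (ι n) (R ^ n)))
      where
      open Curve-bounds (0<k kI) (k<1 kI)
      0≤m : 0ℚ ≤ ι (suc n)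
      0≤m = 0≤ι (suc n)
      ∣m∣≤ : ∣ ι (suc n) ∣ ≤ ι n + ι 1
      ∣m∣≤ = ∣∣-0≤ 0≤m (ℚₚ.≤-reflexive (ι-suc n))
      ∣m+1∣≤ : ∣ ι (suc n) + ι 1 ∣ ≤ ι 2 * (ι n + ι 1)
      ∣m+1∣≤ = ∣∣-0≤ (0≤m ⊕ 0≤ι 1) (≤-by (0≤ι n) (trans
        (solve 1 (λ n → # 2 :* (n :+ # 1) := n :+ # 1 :+ # 1 :+ n) refl (ι n)) (cong (λ N → N + ι 1 + ι n)
          (sym (ι-suc n)))))
      ∣4m∣≤ : ∣ ι 4 * ι (suc n) ∣ ≤ ι 4 * (ι n + ι 1)
      ∣4m∣≤ = ∣∣-0≤ (0≤ι 4 ⊗ 0≤m) (ℚₚ.≤-reflexive (cong (ι 4 *_) (ι-suc n)))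
      ∣M∣≤4 : ∣ M k ∣ ≤ ι 4
      ∣M∣≤4 = ∣∣-0≤ (0≤p*p (ι 1 + k)) (≤-by (0≤1-k ⊗ (0≤ι 3 ⊕ 0≤k)) (solve 1 (λ k →
          # 4 :=
          Mᵖ k :+ (# 1 :- k) :* (# 3 :+ k))
          refl k))
      L≤R^n : L (suc n) k ≤ R ^ n
      L≤R^n = ℚₚ.≤-trans (L≤R^ kI (suc n)) (≤-by (ℚₚ.<⇒≤ 0<m₀ ⊗ 0≤^ (0≤R kI) n)
        (solve 2 (λ m p → p := (# 1 :- m) :* p :+ m :* p) refl m₀ (R ^ n)))

    boundary-small : lo ≤ hi → ∀ {ε} → 0ℚ < ε →
      ∃[ N ] ∀ n → N ℕ.≤ n → ∀ {k} → InRange k →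
        ∣ boundary k (ι (suc n)) (binom² (suc n)) (L (suc n) k) (L n k) ∣ ≤ ε
    boundary-small lo≤hi 0<ε =
      let N , small = quadratic-decay (0≤R (ℚₚ.≤-refl , lo≤hi)) R<1 (ι 192) (0≤ι 192) 0<ε
      in N , λ n N≤n kI → ℚₚ.≤-trans (∣boundary∣≤ kI n) (small n N≤n)

  -- The limit k → 0

  -- The first M terms are at most 1 each, the later ones at most ε t n. After multiplication by k
  -- the first part vanishes as k → 0, while the second stays below ε because k ∑ t is bounded.
  ∑-weighted≤ : ∀ {b t : ℕ → ℚ} {ε} M → (∀ n → 0ℚ ≤ t n) → (∀ n → t n ≤ 1ℚ) → (∀ n → 0ℚ ≤ b n) →
      (∀ n → b n ≤ 1ℚ) →
    0ℚ ≤ ε → (∀ n → M ℕ.≤ n → b n ≤ ε) → ∀ d → ∑ (d ℕ.+ M) (λ n → b n * t n) ≤ ι M + ε * ∑ (d ℕ.+ M) t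
  ∑-weighted≤ {b} {t} {ε} M 0≤t t≤1 0≤b b≤1 0≤ε b≤ε zero = ℚₚ.≤-trans
    (∑-mono M {g = λ _ → 1ℚ} λ i _ → ℚₚ.≤-trans (*-mono-0≤ (0≤b i) (0≤ι 1) (b≤1 i) (t≤1 i))
        (ℚₚ.≤-reflexive (ℚₚ.*-identityˡ 1ℚ)))
    (≤-by (0≤ε ⊗ 0≤∑ M 0≤t) (trans (solve 2 (λ m s → m :+ s := m :* # 1 :+ s) refl (ι M) (ε * ∑ M t))
      (cong (_+ ε * ∑ M t) (sym (∑-const M 1ℚ)))))
  ∑-weighted≤ {b} {t} {ε} M 0≤t t≤1 0≤b b≤1 0≤ε b≤ε (suc d) = ≤-by
    (gap (∑-weighted≤ {b} M 0≤t t≤1 0≤b b≤1 0≤ε b≤ε d) ⊕ gap (b≤ε (d ℕ.+ M) (ℕₚ.m≤n+m M d)) ⊗ 0≤t (d ℕ.+ M))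
    (solve 6 (λ m e S T β τ →
        m :+ e :* (T :+ τ) :=
        S :+ β :* τ :+ ((m :+ e :* T :- S) :+ (e :- β) :* τ))
        refl (ι M) ε (∑ (d ℕ.+ M) (λ n → b n * t n)) (∑ (d ℕ.+ M) t) (b (d ℕ.+ M)) (t (d ℕ.+ M)))

  module Limit {η : ℚ} (0<η : 0ℚ < η) (11η≤1 : ι 11 * η ≤ 1ℚ) where
    open Curve using (X; z)
    open Wronskian

    k : ℚ
    k = η * η

    η≤1 : η ≤ 1ℚ
    η≤1 = ≤-by (gap 11η≤1 ⊕ 0≤ι 10 ⊗ ℚₚ.<⇒≤ 0<η) (solve 1 (λ η →
        # 1 :=
        η :+ (# 1 :- # 11 :* η :+ # 10 :* η))
        refl η)

    0≤η : 0ℚ ≤ η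
    0≤η = ℚₚ.<⇒≤ 0<η

    k≤η : k ≤ η
    k≤η = ≤-by (0≤η ⊗ gap η≤1) (solve 1 (λ η → η := η :* η :+ η :* (# 1 :- η)) refl η)

    k<1 : k < 1ℚ
    k<1 = ℚₚ.≤-<-trans k≤η (ℚₚ.*-cancelˡ-<-nonNeg (ι 11) {{ℚ.nonNegative (0≤ι 11)}} (ℚₚ.≤-<-trans 11η≤1
      (subst₂ _<_ (ℚₚ.+-identityʳ 1ℚ) (solve 0 (# 1 :+ # 10 := # 11 :* # 1) refl)
        (ℚₚ.+-monoʳ-< 1ℚ (0<ι-suc 9)))))

    open Curve-bounds (*-pos 0<η 0<η) k<1 hiding (L≤^)

    t : ℕ → ℚ
    t n = Curve.L n k

    -- The growth rate exceeds X by 2√(uv) ≈ 4k^(3/2), which is why k is taken to be a square η².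
    -- With this ρ both 1 - X and 1 - ρ are 4k to leading order, whereas the rate r of
    -- `Curve-bounds` has only 1 - r ≈ 2k, too crude to determine the limit.
    ρ : ℚ
    ρ = X k + ι 4 * (η * η * η)

    1-X≤4k : 1ℚ - X k ≤ ι 4 * k
    1-X≤4k = ≤-by (0≤w² ⊗ (0≤k ⊗ 0≤k) ⊗ (0≤ι 7 ⊕ 0≤ι 9 ⊗ 0≤k ⊕ 0≤k ⊗ 0≤1-k)) (modulo (M*w*w 0≤k) (1ℚ - ι 4 * k)
      (solve 2 (λ k w →
          # 4 :* k :=
          # 1 :- w :* w :* MXᵖ k :+ w :* w :* (k :* k) :* (# 7 :+ # 9 :* k :+ k :* (# 1 :- k)) :+
            (# 1 :- # 4 :* k) :* (Mᵖ k :* (w :* w) :- # 1))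
          refl k (w k)))

    -- From 1 - X ≥ 4k - 7k², with k² ≤ kη and 4η³ = 4kη: this is 11 = 7 + 4. The hypothesis `11η≤1`
    -- then leaves 1 - ρ ≥ 3k.
    1-ρ≥ : k * (ι 4 - ι 11 * η) ≤ 1ℚ - ρ
    1-ρ≥ = ≤-by (0≤w² ⊗ (0≤k ⊗ 0≤k ⊗ 0≤k) ⊗ (0≤ι 4 ⊕ 0≤ι 8 ⊗ 0≤k) ⊕ 0≤ι 7 ⊗ (0≤k ⊗ (0≤η ⊗ gap η≤1)))
        (modulo (M*w*w 0≤k) (ι 4 * k - ι 7 * (k * k) - 1ℚ)
      (solve 2 (λ η w →
          # 1 :- (w :* w :* MXᵖ (η :* η) :+ # 4 :* (η :* η :* η)) :=
          (η :* η) :* (# 4 :- # 11 :* η) :+ (w :* w :* ((η :* η) :* (η :* η) :* (η :* η)) :*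
            (# 4 :+ # 8 :* (η :* η)) :+ # 7 :* ((η :* η) :* (η :* (# 1 :- η)))) :+
            (# 4 :* (η :* η) :- # 7 :* ((η :* η) :* (η :* η)) :- # 1) :* (Mᵖ (η :* η) :* (w :* w) :- # 1))
          refl η (w (η * η))))

    X≤ρ : X k ≤ ρ
    X≤ρ = ≤-by (0≤ι 4 ⊗ (0≤η ⊗ 0≤η ⊗ 0≤η)) refl

    0≤char-ρ : 0ℚ ≤ ρ * ρ - ι 2 * X k * ρ + z k * z k
    0≤char-ρ = ≤-by
      (0≤ι 16 ⊗ (0≤k ⊗ 0≤k ⊗ 0≤k) ⊗ ((0≤w² ⊗ 0≤w²) ⊗
          ((0≤ι 1 ⊕ 0≤k) ⊗ (0≤ι 6 ⊗ 0≤k ⊕ 0≤ι 2 ⊗ (0≤k ⊗ 0≤k ⊗ 0≤k)))))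
      (modulo (M*w*w 0≤k) (- (ι 16 * (k * k * k) * (M k * (w k * w k) + 1ℚ)))
        (solve 2 (λ η w →
            (w :* w :* MXᵖ (η :* η) :+ # 4 :* (η :* η :* η)) :* (w :* w :* MXᵖ (η :* η) :+
              # 4 :* (η :* η :* η)) :- # 2 :* (w :* w :* MXᵖ (η :* η)) :* (w :* w :* MXᵖ (η :* η) :+
              # 4 :* (η :* η :* η)) :+ (w :* w :* Zᵖ (η :* η)) :* (w :* w :* Zᵖ (η :* η)) :=
            # 0 :+ # 16 :* ((η :* η) :* (η :* η) :* (η :* η)) :* (w :* w :* (w :* w) :*
              ((# 1 :+ (η :* η)) :* (# 6 :* (η :* η) :+ # 2 :* ((η :* η) :* (η :* η) :* (η :* η))))) :+
              (:- (# 16 :* ((η :* η) :* (η :* η) :* (η :* η)) :* (Mᵖ (η :* η) :* (w :* w) :+ # 1))) :*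
              (Mᵖ (η :* η) :* (w :* w) :- # 1))
            refl η (w (η * η))))

    0≤t : ∀ n → 0ℚ ≤ t n
    0≤t = 0≤L

    1-ρ≥3k : ι 3 * k ≤ 1ℚ - ρ
    1-ρ≥3k = ≤-by (gap 1-ρ≥ ⊕ 0≤k ⊗ gap 11η≤1) (solve 3 (λ k η s →
        s :=
        # 3 :* k :+ (s :- k :* (# 4 :- # 11 :* η) :+ k :* (# 1 :- # 11 :* η)))
        refl k η (1ℚ - ρ))

    ρ≤1 : ρ ≤ 1ℚ
    ρ≤1 = ≤-by (gap 1-ρ≥3k ⊕ 0≤ι 3 ⊗ 0≤k) (solve 2 (λ k ρ →
        # 1 :=
        ρ :+ (# 1 :- ρ :- # 3 :* k :+ # 3 :* k))
        refl k ρ)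

    ρ<1 : ρ < 1ℚ
    ρ<1 = subst₂ _<_ (ℚₚ.+-identityʳ ρ) (solve 1 (λ ρ → ρ :+ (# 1 :- ρ) := # 1) refl ρ)
      (ℚₚ.+-monoʳ-< ρ (ℚₚ.<-≤-trans (*-pos (0<ι-suc 2) (*-pos 0<η 0<η)) 1-ρ≥3k))

    0≤ρ : 0ℚ ≤ ρ
    0≤ρ = ℚₚ.≤-trans (ℚₚ.<⇒≤ 0<X) X≤ρ

    t≤^ : ∀ n → t n ≤ ρ ^ n
    t≤^ = legendreᶻ≤^ 0<X z²≤X² X≤ρ 0≤char-ρ

    t≤1 : ∀ n → t n ≤ 1ℚ
    t≤1 n = ℚₚ.≤-trans (t≤^ n) (^≤1 0≤ρ ρ≤1 n)

    X*t≤t : ∀ n → X k * t n ≤ t (suc n)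
    X*t≤t n = proj₂ (legendreᶻ-growth 0<X z²≤X² n)

    t≤ρ*t : ∀ n → t (suc n) ≤ ρ * t n
    t≤ρ*t = legendreᶻ-ratio 0<X z²≤X² X≤ρ 0≤char-ρ

    T : ℕ → ℚ
    T N = ∑ N t

    -- The differences t n - t (suc n) ≤ (1 - X) t n ≤ 4k t n telescope. Together with `T-upper`,
    -- where ρ replaces X, this pins k T to 1/4 as η → 0 once t N is negligible, without a
    -- generating function.
    T-lower : ∀ N → 1ℚ - t N ≤ ι 4 * (k * T N)
    T-lower zero    = ℚₚ.≤-reflexive (solve 1 (λ k → # 1 :- # 1 := # 4 :* (k :* # 0)) refl k)
    T-lower (suc N) = ≤-by (gap (T-lower N) ⊕ gap (X*t≤t N) ⊕ gap 1-X≤4k ⊗ 0≤t N)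
      (solve 5 (λ k S t t′ X →
          # 4 :* (k :* (S :+ t)) :=
          # 1 :- t′ :+ (# 4 :* (k :* S) :- (# 1 :- t) :+ (t′ :- X :* t) :+ (# 4 :* k :- (# 1 :- X)) :* t))
          refl k (T N) (t N) (t (suc N)) (X k))

    T-upper : ∀ N → k * (ι 4 - ι 11 * η) * T N ≤ 1ℚ - t N
    T-upper zero    = ℚₚ.≤-reflexive (solve 2 (λ k c → k :* c :* # 0 := # 1 :- # 1) refl k (ι 4 - ι 11 * η))
    T-upper (suc N) = ≤-by (gap (T-upper N) ⊕ gap (t≤ρ*t N) ⊕ gap 1-ρ≥ ⊗ 0≤t N)
      (solve 5 (λ c S t t′ ρ →
          # 1 :- t′ :=
          c :* (S :+ t) :+ (# 1 :- t :- c :* S :+ (ρ :* t :- t′) :+ ((# 1 :- ρ) :- c) :* t))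
          refl (k * (ι 4 - ι 11 * η)) (T N) (t N) (t (suc N)) ρ)

    0≤T : ∀ N → 0ℚ ≤ T N
    0≤T N = 0≤∑ N 0≤t

    k*T≤1 : ∀ N → k * T N ≤ 1ℚ
    k*T≤1 N = ≤-by (gap (T-upper N) ⊕ 0≤t N ⊕ gap 11η≤1 ⊗ (0≤k ⊗ 0≤T N) ⊕ 0≤ι 2 ⊗ (0≤k ⊗ 0≤T N))
      (solve 4 (λ k η S t →
          # 1 :=
          k :* S :+ (# 1 :- t :- k :* (# 4 :- # 11 :* η) :* S :+ t :+ (# 1 :- # 11 :* η) :* (k :* S) :+
            # 2 :* (k :* S)))
          refl k η (T N) (t N))

    4kT-1 : ∀ N → ∣ ι 4 * (k * T N) - 1ℚ ∣ ≤ ι 11 * η + t N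
    4kT-1 N = ∣∣-lub
      (≤-by (gap (T-upper N) ⊕ (0≤ι 11 ⊗ 0≤η) ⊗ gap (k*T≤1 N) ⊕ 0≤ι 2 ⊗ 0≤t N)
        (solve 4 (λ k η S t →
            # 11 :* η :+ t :=
            # 4 :* (k :* S) :- # 1 :+ ((# 1 :- t) :- k :* (# 4 :- # 11 :* η) :* S :+ # 11 :* η :*
              (# 1 :- k :* S) :+ # 2 :* t))
            refl k η (T N) (t N)))
      (≤-by (gap (T-lower N) ⊕ 0≤ι 11 ⊗ 0≤η)
        (solve 4 (λ k η S t →
            # 11 :* η :+ t :=
            (:- (# 4 :* (k :* S) :- # 1)) :+ (# 4 :* (k :* S) :- (# 1 :- t) :+ # 11 :* η))
            refl k η (T N) (t N)))

    al be e : ℚ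
    al = (ι 1 + ι 6 * k - ι 5 * k * k)
    be = (ι 1 - ι 2 * k - k * k)
    e = al + be * z k

    -- (n + 1) G n is the part of `linear` at n + 1 that is proportional to n + 1. As k → 0, α and β
    -- tend to 1 and z to -1, so G n is nearly t (suc n) - t n; the defect e = α + β z is about 12k.
    G : ℕ → ℚ
    G n = al * t (suc n) + be * z k * t n

    ∑G : ∀ N → ∑ N G ≡ e * T N - al * (1ℚ - t N)
    ∑G zero    = (solve 2 (λ e a → # 0 := e :* # 0 :- a :* (# 1 :- # 1)) refl e al)
    ∑G (suc N) = trans (cong (_+ G N) (∑G N)) (solve 5 (λ a c S t t′ →
        (a :+ c) :* S :- a :* (# 1 :- t) :+ (a :* t′ :+ c :* t) :=
        (a :+ c) :* (S :+ t) :- a :* (# 1 :- t′))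
        refl al (be * z k) (T N) (t N) (t (suc N)))

    0≤al : 0ℚ ≤ al
    0≤al = ≤-by (0≤ι 1 ⊕ 0≤k ⊕ 0≤ι 5 ⊗ 0≤k ⊗ 0≤1-k) (solve 1 (λ k →
        αᵖ k :=
        # 0 :+ (# 1 :+ k :+ # 5 :* k :* (# 1 :- k)))
        refl k)

    al≤7 : al ≤ ι 7
    al≤7 = ≤-by (0≤ι 6 ⊗ 0≤1-k ⊕ 0≤ι 5 ⊗ 0≤k ⊗ 0≤k) (solve 1 (λ k →
        # 7 :=
        αᵖ k :+ (# 6 :* (# 1 :- k) :+ # 5 :* k :* k))
        refl k)

    ∣e-12k∣≤ : ∣ e - ι 12 * k ∣ ≤ ι 48 * (k * k)
    ∣e-12k∣≤ = ∣∣-lub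
      (≤-by (0≤w² ⊗ (0≤k ⊗ 0≤k) ⊗ (0≤ι 19 ⊕ 0≤ι 16 ⊗ 0≤k ⊕ 0≤ι 8 ⊗ (0≤k ⊗ 0≤k) ⊕ 0≤ι 4 ⊗ (0≤k ⊗ 0≤k ⊗ 0≤k) ⊕
          0≤k ⊗ 0≤k ⊗ 0≤k ⊗ 0≤k)
          ⊕ 0≤ι 48 ⊗ (0≤k ⊗ 0≤k))
        (modulo (M*w*w 0≤k) (al - ι 12 * k) (solve 2 (λ k w →
            # 48 :* (k :* k) :=
            αᵖ k :+ βᵖ k :* (w :* w :* Zᵖ k) :- # 12 :* k :+ (w :* w :* (k :* k) :* (# 19 :+ # 16 :* k :+
              # 8 :* (k :* k) :+ # 4 :* (k :* k :* k) :+ k :* k :* k :* k) :+ # 48 :* (k :* k)) :+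
              (αᵖ k :- # 12 :* k) :* (Mᵖ k :* (w :* w) :- # 1))
            refl k (w k))))
      (≤-by (0≤w² ⊗ (0≤k ⊗ 0≤k) ⊗ (0≤ι 29 ⊕ 0≤ι 80 ⊗ 0≤k ⊕ 0≤ι 35 ⊗ (0≤k ⊗ 0≤k) ⊕ 0≤ι 4 ⊗ (0≤k ⊗ 0≤k) ⊗ 0≤1-k
          ⊕ (0≤k ⊗ 0≤k) ⊗ (0≤1-k ⊗ (0≤ι 1 ⊕ 0≤k))))
        (modulo (M*w*w 0≤k) (- (al - ι 12 * k) - ι 48 * (k * k)) (solve 2 (λ k w →
            # 48 :* (k :* k) :=
            (:- (αᵖ k :+ βᵖ k :* (w :* w :* Zᵖ k) :- # 12 :* k)) :+ w :* w :* (k :* k) :* (# 29 :+ # 80 :* k :+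
              # 35 :* (k :* k) :+ # 4 :* (k :* k) :* (# 1 :- k) :+ k :* k :* ((# 1 :- k) :* (# 1 :+ k))) :+
              ((:- (αᵖ k :- # 12 :* k)) :- # 48 :* (k :* k)) :* (Mᵖ k :* (w :* w) :- # 1))
            refl k (w k))))

    ∣e∣≤60k : ∣ e ∣ ≤ ι 60 * k
    ∣e∣≤60k = ℚₚ.≤-trans (∣∣-≡ (solve 2 (λ e k → (e :- # 12 :* k) :+ # 12 :* k := e) refl e k)
        (∣∣-+ ∣e-12k∣≤ (∣∣-0≤ (0≤ι 12 ⊗ 0≤k) (ℚₚ.≤-refl {ι 12 * k}))))
      (≤-by (0≤ι 48 ⊗ 0≤k ⊗ 0≤1-k) (solve 1 (λ k →
          # 60 :* k :=
          # 48 :* (k :* k) :+ # 12 :* k :+ # 48 :* k :* (# 1 :- k))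
          refl k))

    -- In `∑G` the term e T is about 12k / (4k) = 3 and the telescoped part about -1.
    ∣∑G-2∣≤ : ∀ N → ∣ ∑ N G - ι 2 ∣ ≤ ι 87 * η + ι 10 * t N
    ∣∑G-2∣≤ N = ℚₚ.≤-trans
      (∣∣-≡ (trans (solve 4 (λ e k S t →
          (e :- # 12 :* k) :* S :+ # 3 :* (# 4 :* (k :* S) :- # 1) :+ (:- (# 6 :* k :- # 5 :* k :* k)) :+
            αᵖ k :* t :=
          e :* S :- αᵖ k :* (# 1 :- t) :- # 2)
          refl e k (T N) (t N))
          (cong (_- ι 2) (sym (∑G N))))
        (∣∣-+ (∣∣-+ (∣∣-+ (∣∣-* ∣e-12k∣≤ (∣∣-0≤ (0≤T N) (ℚₚ.≤-refl {T N})))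
            (∣∣-* (∣∣-0≤ (0≤ι 3) (ℚₚ.≤-refl {ι 3})) (4kT-1 N)))
          (∣∣-neg (∣∣-0≤ 0≤6k-5k² (≤-by (0≤ι 5 ⊗ 0≤k ⊗ 0≤k) (solve 1 (λ k →
              # 6 :* k :=
              # 6 :* k :- # 5 :* k :* k :+ # 5 :* k :* k)
              refl k)))))
          (∣∣-* (∣∣-0≤ 0≤al al≤7) (∣∣-0≤ (0≤t N) (ℚₚ.≤-refl {t N})))))
      (≤-by ((0≤ι 48 ⊗ 0≤k) ⊗ gap (k*T≤1 N) ⊕ 0≤ι 54 ⊗ gap k≤η)
        (solve 4 (λ η k S t →
            # 87 :* η :+ # 10 :* t :=
            # 48 :* (k :* k) :* S :+ # 3 :* (# 11 :* η :+ t) :+ # 6 :* k :+ # 7 :* t :+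
              (# 48 :* k :* (# 1 :- k :* S) :+ # 54 :* (η :- k)))
            refl η k (T N) (t N)))
      where
      0≤6k-5k² : 0ℚ ≤ ι 6 * k - ι 5 * k * k
      0≤6k-5k² = ≤-by (0≤k ⊕ 0≤ι 5 ⊗ 0≤k ⊗ 0≤1-k) (solve 1 (λ k →
          # 6 :* k :- # 5 :* k :* k :=
          # 0 :+ (k :+ # 5 :* k :* (# 1 :- k)))
          refl k)

    -- α (t (suc n) - t n) and e t n are each O(k) t n, with 88 = 7 · 4 + 60. So ∑ ∣G n∣ stays
    -- bounded as k → 0, and the weights q may be replaced by their approximate limit ℓ at a small
    -- cost.
    ∣G∣≤ : ∀ n → ∣ G n ∣ ≤ ι 88 * k * t n
    ∣G∣≤ n = ℚₚ.≤-trans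
      (∣∣-≡ (solve 4 (λ a c t t′ →
          a :* (:- (t :- t′)) :+ (a :+ c) :* t :=
          a :* t′ :+ c :* t)
          refl al (be * z k) (t n) (t (suc n)))
        (∣∣-+ (∣∣-* (∣∣-0≤ 0≤al al≤7) (∣∣-neg (∣∣-0≤ 0≤t-t′ t-t′≤)))
          (∣∣-* ∣e∣≤60k (∣∣-0≤ (0≤t n) (ℚₚ.≤-refl {t n})))))
      (ℚₚ.≤-reflexive (solve 2 (λ k t →
          # 7 :* (# 4 :* k :* t) :+ # 60 :* k :* t :=
          # 88 :* k :* t)
          refl k (t n)))
      where
      0≤t-t′ : 0ℚ ≤ t n - t (suc n)
      0≤t-t′ = ≤-by (gap (t≤ρ*t n) ⊕ gap ρ≤1 ⊗ 0≤t n)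
        (solve 3 (λ ρ t t′ → t :- t′ := # 0 :+ (ρ :* t :- t′ :+ (# 1 :- ρ) :* t)) refl ρ (t n) (t (suc n)))
      t-t′≤ : t n - t (suc n) ≤ ι 4 * k * t n
      t-t′≤ = ≤-by (gap (X*t≤t n) ⊕ gap 1-X≤4k ⊗ 0≤t n)
        (solve 4 (λ k X t t′ →
            # 4 :* k :* t :=
            t :- t′ :+ (t′ :- X :* t :+ (# 4 :* k :- (# 1 :- X)) :* t))
            refl k (X k) (t n) (t (suc n)))

    q : ℕ → ℚ
    q n = ι n * binom² n

    V-by-parts : ∀ N → Wronskian.V (suc N) k ≡
      w k * (∑ N (λ n → q (suc n) * G n) + ι 2 * k * (1ℚ - k) * ∑ (suc N) (λ n → binom² n * t n))
    V-by-parts zero    = (solve 3 (λ k w z →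
        # 0 :+ w :* (# 1 :* ((αᵖ k :* # 0 :+ # 2 :* k :* (# 1 :- k)) :* # 1 :+ βᵖ k :* # 0 :* z :* # 0)) :=
        w :* (# 0 :+ # 2 :* k :* (# 1 :- k) :* (# 0 :+ # 1 :* # 1)))
        refl k (w k) (z k))
    V-by-parts (suc N) = trans (cong (_+ w k * Wronskian.summand (suc N) k) (V-by-parts N))
      (solve 9 (λ k w z S U m a t t′ →
          w :* (S :+ # 2 :* k :* (# 1 :- k) :* U) :+ w :* (a :* ((αᵖ k :* m :+ # 2 :* k :* (# 1 :- k)) :* t′ :+
            βᵖ k :* m :* z :* t)) :=
          w :* (S :+ m :* a :* (αᵖ k :* t′ :+ βᵖ k :* z :* t) :+ # 2 :* k :* (# 1 :- k) :* (U :+ a :* t′)))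
          refl k (w k) (z k) (∑ N (λ n → q (suc n) * G n)) (∑ (suc N) (λ n → binom² n * t n)) (ι (suc N))
              (binom² (suc N)) (t N) (t (suc N)))

    module _ {ℓ ε : ℚ} {M : ℕ} (0≤ℓ : 0ℚ ≤ ℓ) (ℓ≤1 : ℓ ≤ 1ℚ) (0≤ε : 0ℚ ≤ ε)
             (∣q-ℓ∣≤ε : ∀ n → M ℕ.≤ n → ∣ q n - ℓ ∣ ≤ ε) (binom²≤ε : ∀ n → M ℕ.≤ n → binom² n ≤ ε) where

      ∣q-ℓ∣≤1 : ∀ n → ∣ q n - ℓ ∣ ≤ 1ℚ
      ∣q-ℓ∣≤1 n = ∣∣-lub (≤-by (gap (n*binom²≤1 n) ⊕ 0≤ℓ) (solve 2 (λ q l →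
          # 1 :=
          q :- l :+ (# 1 :- q :+ l))
          refl (q n) ℓ))
        (≤-by (gap ℓ≤1 ⊕ 0≤ι n ⊗ 0≤binom² n) (solve 2 (λ q l →
            # 1 :=
            (:- (q :- l)) :+ (# 1 :- l :+ q))
            refl (q n) ℓ))

      k*∑-weighted≤ : ∀ {b} → (∀ n → 0ℚ ≤ b n) → (∀ n → b n ≤ 1ℚ) → (∀ n → M ℕ.≤ n → b n ≤ ε) →
        ∀ d → k * ∑ (d ℕ.+ M) (λ n → b n * t n) ≤ η * ι M + ε
      k*∑-weighted≤ {b} 0≤b b≤1 b≤ε d = ≤-by
        (0≤k ⊗ gap (∑-weighted≤ {b} M 0≤t t≤1 0≤b b≤1 0≤ε b≤ε d) ⊕ gap k≤η ⊗ 0≤ι M ⊕ 0≤ε ⊗ gap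
            (k*T≤1 (d ℕ.+ M)))
        (solve 6 (λ k η m e S T →
            η :* m :+ e :=
            k :* S :+ (k :* (m :+ e :* T :- S) :+ (η :- k) :* m :+ e :* (# 1 :- k :* T)))
            refl k η (ι M) ε (∑ (d ℕ.+ M) (λ n → b n * t n)) (T (d ℕ.+ M)))

      ∣∑qG-ℓ∑G∣≤ : ∀ d → ∣ ∑ (d ℕ.+ M) (λ n → q (suc n) * G n) - ℓ * ∑ (d ℕ.+ M) G ∣ ≤ ι 88 * (η * ι M + ε)
      ∣∑qG-ℓ∑G∣≤ d = ℚₚ.≤-trans
        (∣∣-≡ eq (∣∑∣≤ N {g = λ n → ι 88 * k * (∣ q (suc n) - ℓ ∣ * t n)} λ n _ → ℚₚ.≤-trans
          (∣∣-* (ℚₚ.≤-refl {∣ q (suc n) - ℓ ∣}) (∣G∣≤ n))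
          (ℚₚ.≤-reflexive (solve 3 (λ k b t →
              b :* (# 88 :* k :* t) :=
              # 88 :* k :* (b :* t))
              refl k (∣ q (suc n) - ℓ ∣) (t n)))))
        (ℚₚ.≤-trans (ℚₚ.≤-reflexive (trans (∑-* N (ι 88 * k) _) (ℚₚ.*-assoc (ι 88) k _)))
          (*-monoˡ-0≤ (0≤ι 88) (k*∑-weighted≤ {λ n → ∣ q (suc n) - ℓ ∣} (λ n → ℚₚ.0≤∣p∣ (q (suc n) - ℓ))
              (λ n → ∣q-ℓ∣≤1 (suc n))
            (λ n M≤n → ∣q-ℓ∣≤ε (suc n) (ℕₚ.m≤n⇒m≤1+n M≤n)) d)))
        where
        N : ℕ
        N = d ℕ.+ M
        eq : ∑ N (λ n → (q (suc n) - ℓ) * G n) ≡ ∑ N (λ n → q (suc n) * G n) - ℓ * ∑ N G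
        eq = trans (∑-cong N λ n _ → (solve 3 (λ q l g →
            (q :- l) :* g :=
            q :* g :+ (:- l) :* g)
            refl (q (suc n)) ℓ (G n)))
          (trans (∑-+ N _ _) (trans (cong (λ s → ∑ N (λ n → q (suc n) * G n) + s) (∑-* N (- ℓ) G))
            (solve 3 (λ S l g → S :+ (:- l) :* g := S :- l :* g) refl (∑ N (λ n → q (suc n) * G n)) ℓ (∑ N G))))

      -- With q replaced by ℓ, the first sum of `V-by-parts` is ℓ ∑ G ≈ 2ℓ. The second one carries a
      -- factor k and weights Aₙ that become small, and replacing w by 1 costs at most 2η.
      ∣V-2ℓ∣≤ : ∀ d → ∣ Wronskian.V (suc (d ℕ.+ M)) k - ι 2 * ℓ ∣ ≤
        ι 90 * (η * ι M + ε) + ι 89 * η + ι 10 * t (d ℕ.+ M)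
      ∣V-2ℓ∣≤ d = ℚₚ.≤-trans
        (∣∣-≡ (trans
            (modulo ([1+x]*w 0≤k) (- (ι 2 * ℓ)) (solve 6 (λ k l w S g U →
                w :* ((S :- l :* g) :+ (l :* (g :- # 2) :+ # 2 :* (# 1 :- k) :* (k :* U))) :+
                  (:- (# 2 :* l :* (k :* w))) :=
                w :* (S :+ # 2 :* k :* (# 1 :- k) :* U) :- # 2 :* l :+ (:- (# 2 :* l)) :* ((# 1 :+ k) :* w :-
                  # 1))
                refl k ℓ (w k) S (∑ N G) U))
            (cong (_- ι 2 * ℓ) (sym (V-by-parts N))))
          (∣∣-+ (∣∣-* (∣∣-0≤ (0≤w 0≤k) (w≤1 0≤k)) (∣∣-+ (∣∑qG-ℓ∑G∣≤ d) (∣∣-+ (∣∣-* (∣∣-0≤ 0≤ℓ ℓ≤1) (∣∑G-2∣≤ N))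
              (∣∣-* (∣∣-0≤ (0≤ι 2 ⊗ 0≤1-k) 2[1-k]≤2) (∣∣-0≤ (0≤k ⊗ 0≤U) (k*∑-weighted≤ {binom²} 0≤binom²
                  binom²≤1 binom²≤ε (suc d)))))))
            (∣∣-neg (∣∣-0≤ (0≤ι 2 ⊗ 0≤ℓ ⊗ (0≤k ⊗ 0≤w 0≤k)) 2ℓkw≤2η))))
        (ℚₚ.≤-reflexive (solve 4 (λ η m e t →
            # 1 :* (# 88 :* (η :* m :+ e) :+ (# 1 :* (# 87 :* η :+ # 10 :* t) :+ # 2 :* (η :* m :+ e))) :+
              # 2 :* η :=
            # 90 :* (η :* m :+ e) :+ # 89 :* η :+ # 10 :* t)
            refl η (ι M) ε (t N)))
        where
        N : ℕ
        N = d ℕ.+ M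
        S U : ℚ
        S = ∑ N (λ n → q (suc n) * G n)
        U = ∑ (suc N) (λ n → binom² n * t n)
        0≤U : 0ℚ ≤ U
        0≤U = 0≤∑ (suc N) (λ n → 0≤binom² n ⊗ 0≤t n)
        2[1-k]≤2 : ι 2 * (1ℚ - k) ≤ ι 2
        2[1-k]≤2 = ≤-by (0≤ι 2 ⊗ 0≤k) (solve 1 (λ k → # 2 := # 2 :* (# 1 :- k) :+ # 2 :* k) refl k)
        2ℓkw≤2η : ι 2 * ℓ * (k * w k) ≤ ι 2 * η
        2ℓkw≤2η = ≤-by (0≤ι 2 ⊗ (gap k≤η ⊕ 0≤k ⊗ gap (w≤1 0≤k) ⊕ (0≤k ⊗ 0≤w 0≤k) ⊗ gap ℓ≤1))
          (solve 4 (λ η k l w →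
              # 2 :* η :=
              # 2 :* l :* (k :* w) :+ # 2 :* (η :- k :+ k :* (# 1 :- w) :+ k :* w :* (# 1 :- l)))
              refl η k ℓ (w k))

  -- Wallis' product from Leibniz' series

  ν-anti : ∀ {m n} → m ℕ.≤ n → ν n ≤ ν m
  ν-anti {m} {n} m≤n = ≤-by (0≤ν m ⊗ 0≤ν n ⊗ gap (ι-mono (ℕ.s≤s m≤n)))
    (modulo (ι*ν m) (ν n) (modulo (ι*ν n) (- ν m)
      (solve 4 (λ a b M N →
          a :=
          b :+ a :* b :* (N :- M) :+ b :* (M :* a :- # 1) :+ (:- a) :* (N :* b :- # 1))
          refl (ν m) (ν n) (ι (suc m)) (ι (suc n)))))

  ν≤1 : ∀ n → ν n ≤ 1ℚ
  ν≤1 n = ≤-by (0≤ι n ⊗ 0≤ν n) (modulo ([n+1]*ν n) (- 1ℚ) (solve 2 (λ n v →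
      # 1 :=
      v :+ n :* v :+ (:- # 1) :* ((n :+ # 1) :* v :- # 1))
      refl (ι n) (ν n)))

  small-ν : ∀ K {ε} → 0ℚ ≤ K → 0ℚ < ε → ∃[ N ] ∀ n → N ℕ.≤ n → K * ν n ≤ ε
  small-ν K {ε} 0≤K 0<ε =
    let N , K≤εN = archimedean-* 0<ε K
    in N , λ n N≤n → ≤-by (0≤ν n ⊗ (gap K≤εN ⊕ ℚₚ.<⇒≤ 0<ε ⊗ (gap (ι-mono N≤n) ⊕ 0≤ι 1)))
      (modulo ([n+1]*ν n) (- ε) (solve 5 (λ e K v n N →
          e :=
          K :* v :+ v :* (e :* N :- K :+ e :* (n :- N :+ # 1)) :+ (:- e) :* ((n :+ # 1) :* v :- # 1))
          refl ε K (ν n) (ι n) (ι N)))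

  sign : ℕ → ℚ
  sign i = (- 1ℚ) ^ i

  sign≤1 : ∀ i → ∣ sign i ∣ ≤ 1ℚ
  sign≤1 zero    = ℚₚ.≤-refl
  sign≤1 (suc i) = ℚₚ.≤-trans (∣∣-* { - 1ℚ} {sign i} (∣∣-neg {1ℚ} ℚₚ.≤-refl) (sign≤1 i))
      (ℚₚ.≤-reflexive (ℚₚ.*-identityˡ 1ℚ))

  sign-+ : ∀ i m → sign (i ℕ.+ m) ≡ sign m * sign i
  sign-+ zero    m = sym (ℚₚ.*-identityʳ (sign m))
  sign-+ (suc i) m = trans (cong (- 1ℚ *_) (sign-+ i m)) (solve 2 (λ a b →
      (:- # 1) :* (a :* b) :=
      a :* ((:- # 1) :* b))
      refl (sign m) (sign i))

  alternating-bounds : ∀ d {y : ℕ → ℚ} → (∀ i → 0ℚ ≤ y i) → (∀ i → y (suc i) ≤ y i) →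
    0ℚ ≤ ∑ d (λ i → sign i * y i) × ∑ d (λ i → sign i * y i) ≤ y 0
  alternating-bounds zero    0≤y anti = ℚₚ.≤-refl , 0≤y 0
  alternating-bounds (suc d) {y} 0≤y anti =
    let lo , hi = alternating-bounds d {λ i → y (suc i)} (λ i → 0≤y (suc i)) (λ i → anti (suc i))
    in subst (λ s → 0ℚ ≤ s × s ≤ y 0) (sym eq) (gap (ℚₚ.≤-trans hi (anti 0)) , ≤-by lo (solve 2 (λ y s →
        y :=
        y :- s :+ s)
        refl (y 0) s))
    where
    s : ℚ
    s = ∑ d (λ i → sign i * y (suc i))
    eq : ∑ (suc d) (λ i → sign i * y i) ≡ y 0 - s
    eq = trans (∑-suc d (λ i → sign i * y i)) (trans
      (cong (λ t → 1ℚ * y 0 + t) (trans (∑-cong d λ i _ → ℚₚ.*-assoc (- 1ℚ) (sign i) (y (suc i)))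
          (∑-* d (- 1ℚ) (λ i → sign i * y (suc i)))))
      (solve 2 (λ y s → # 1 :* y :+ (:- # 1) :* s := y :- s) refl (y 0) s))

  alternating-tail : ∀ d m {y : ℕ → ℚ} → (∀ i → 0ℚ ≤ y i) → (∀ i → y (suc i) ≤ y i) →
    ∣ ∑ (d ℕ.+ m) (λ i → sign i * y i) - ∑ m (λ i → sign i * y i) ∣ ≤ y m
  alternating-tail d m {y} 0≤y anti = ℚₚ.≤-trans
    (∣∣-≡ (sym eq) (∣∣-* (sign≤1 m) (∣∣-0≤ (proj₁ bounds) (proj₂ bounds))))
        (ℚₚ.≤-reflexive (ℚₚ.*-identityˡ (y m)))
    where
    bounds = alternating-bounds d {λ i → y (i ℕ.+ m)} (λ i → 0≤y (i ℕ.+ m)) (λ i → anti (i ℕ.+ m))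
    s : ℚ
    s = ∑ d (λ i → sign i * y (i ℕ.+ m))
    eq : ∑ (d ℕ.+ m) (λ i → sign i * y i) - ∑ m (λ i → sign i * y i) ≡ sign m * s
    eq = trans (cong (_- ∑ m (λ i → sign i * y i)) (∑-split m d (λ i → sign i * y i)))
      (trans (solve 2 (λ a b →
          a :+ b :- a :=
          b)
          refl (∑ m (λ i → sign i * y i)) (∑ d (λ i → sign (i ℕ.+ m) * y (i ℕ.+ m))))
        (trans (∑-cong d λ i _ → trans (cong (_* y (i ℕ.+ m)) (sign-+ i m)) (ℚₚ.*-assoc (sign m) (sign i) _))
          (∑-* d (sign m) (λ i → sign i * y (i ℕ.+ m)))))

  -- centralRatio n i is (2n choose n + i) / (2n choose n).
  centralRatio : ℕ → ℕ → ℚ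
  centralRatio n zero    = 1ℚ
  centralRatio n (suc i) = centralRatio n i * ((ι n - ι i) * ν (n ℕ.+ i))

  [n+i+1]*ν : ∀ n i → (ι n + ι i + ι 1) * ν (n ℕ.+ i) ≡ ι 1
  [n+i+1]*ν n i = trans (cong (λ s → (s + ι 1) * ν (n ℕ.+ i)) (sym (ι-+ n i))) ([n+1]*ν (n ℕ.+ i))

  centralRatio-rec : ∀ n i → (ι n + ι i + ι 1) * centralRatio n (suc i) ≡ (ι n - ι i) * centralRatio n i
  centralRatio-rec n i = modulo ([n+i+1]*ν n i) ((ι n - ι i) * centralRatio n i)
    (solve 4 (λ n i v r →
        (n :+ i :+ # 1) :* (r :* ((n :- i) :* v)) :=
        (n :- i) :* r :+ (n :- i) :* r :* ((n :+ i :+ # 1) :* v :- # 1))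
        refl (ι n) (ι i) (ν (n ℕ.+ i)) (centralRatio n i))

  centralRatio-beyond : ∀ n d → centralRatio n (suc (d ℕ.+ n)) ≡ 0ℚ
  centralRatio-beyond n zero    = (solve 3 (λ n v r →
      r :* ((n :- n) :* v) :=
      # 0)
      refl (ι n) (ν (n ℕ.+ n)) (centralRatio n n))
  centralRatio-beyond n (suc d) = trans
    (cong (_* ((ι n - ι (suc (d ℕ.+ n))) * ν (n ℕ.+ suc (d ℕ.+ n)))) (centralRatio-beyond n d))
        (ℚₚ.*-zeroˡ ((ι n - ι (suc (d ℕ.+ n))) * ν (n ℕ.+ suc (d ℕ.+ n))))

  centralRatio-bounds : ∀ n i → 0ℚ ≤ centralRatio n i × centralRatio n (suc i) ≤ centralRatio n i
  centralRatio-bounds n i = 0≤ratio i , decreasing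
    where
    factor≥0 : ∀ i → i ℕ.≤ n → 0ℚ ≤ (ι n - ι i) * ν (n ℕ.+ i)
    factor≥0 i i≤n = gap (ι-mono i≤n) ⊗ 0≤ν (n ℕ.+ i)
    0≤ratio : ∀ i → 0ℚ ≤ centralRatio n i
    0≤ratio zero = 0≤ι 1
    0≤ratio (suc i) with i ℕₚ.≤? n
    ... | yes i≤n = 0≤ratio i ⊗ factor≥0 i i≤n
    ... | no  i≰n = ℚₚ.≤-reflexive (sym (subst (λ j → centralRatio n (suc j) ≡ 0ℚ)
                      (ℕₚ.m∸n+n≡m (ℕₚ.<⇒≤ (ℕₚ.≰⇒> i≰n))) (centralRatio-beyond n (i ℕ.∸ n))))
    decreasing : centralRatio n (suc i) ≤ centralRatio n i
    decreasing = *-cancelˡ-≤ (ι n + ι i + ι 1) (ℚₚ.≤-<-trans (0≤ι n ⊕ 0≤ι i)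
        (subst (_< ι n + ι i + ι 1) (ℚₚ.+-identityʳ (ι n + ι i)) (ℚₚ.+-monoʳ-< (ι n + ι i) (0<ι-suc 0))))
      (≤-by ((0≤ι 2 ⊗ 0≤ι i ⊕ 0≤ι 1) ⊗ 0≤ratio i) (modulo (centralRatio-rec n i) (- 1ℚ)
        (solve 4 (λ n i r s →
            (n :+ i :+ # 1) :* r :=
            (n :+ i :+ # 1) :* s :+ (# 2 :* i :+ # 1) :* r :+ (:- # 1) :* ((n :+ i :+ # 1) :* s :-
              (n :- i) :* r))
            refl (ι n) (ι i) (centralRatio n i) (centralRatio n (suc i)))))

  0≤centralRatio : ∀ n i → 0ℚ ≤ centralRatio n i
  0≤centralRatio n i = proj₁ (centralRatio-bounds n i)

  centralRatio≤1 : ∀ n i → centralRatio n i ≤ 1ℚ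
  centralRatio≤1 n zero    = ℚₚ.≤-refl
  centralRatio≤1 n (suc i) = ℚₚ.≤-trans (proj₂ (centralRatio-bounds n i)) (centralRatio≤1 n i)

  -- The factor (n - j) / (n + j + 1) falls short of 1 by (2j + 1) / (n + j + 1) ≤ (2j + 1) / (n +
  -- 1), and the first i odd numbers sum to i².
  1-centralRatio≤ : ∀ n i → 1ℚ - centralRatio n i ≤ ι i * ι i * ν n
  1-centralRatio≤ n zero    = ℚₚ.≤-reflexive (solve 1 (λ v → # 1 :- # 1 := # 0 :* # 0 :* v) refl (ν n))
  1-centralRatio≤ n (suc i) = ≤-by
    (gap (1-centralRatio≤ n i) ⊕ (0≤ι 2 ⊗ 0≤ι i ⊕ 0≤ι 1) ⊗ gap (ν-anti (ℕₚ.m≤m+n n i))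
      ⊕ (0≤ι 2 ⊗ 0≤ι i ⊕ 0≤ι 1) ⊗ 0≤ν (n ℕ.+ i) ⊗ gap (centralRatio≤1 n i))
    (trans (cong (λ I → I * I * ν n) (ι-suc i)) (modulo ([n+i+1]*ν n i) (centralRatio n i)
      (solve 5 (λ n i r v u →
          (i :+ # 1) :* (i :+ # 1) :* v :=
          # 1 :- r :* ((n :- i) :* u) :+ (i :* i :* v :- (# 1 :- r) :+ (# 2 :* i :+ # 1) :* (v :- u) :+
            (# 2 :* i :+ # 1) :* u :* (# 1 :- r)) :+ r :* ((n :+ i :+ # 1) :* u :- # 1))
          refl (ι n) (ι i) (centralRatio n i) (ν n) (ν (n ℕ.+ i)))))

  -- Passing from n to n + 1 in the finite partial fraction expansion
  -- Π_{j ≤ n} 4j² / (4j² − 1) = ∑ᵢ (−1)ⁱ centralRatio n |i| / (2i + 1), i ∈ ℤ.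
  centralRatio-suc : ∀ n i → (ι n + ι 1) * (ι n + ι 1) * centralRatio n i ≡
    ((ι n + ι 1) * (ι n + ι 1) - ι i * ι i) * centralRatio (suc n) i
  centralRatio-suc n zero    = (solve 1 (λ n →
      (n :+ # 1) :* (n :+ # 1) :* # 1 :=
      ((n :+ # 1) :* (n :+ # 1) :- # 0 :* # 0) :* # 1)
      refl (ι n))
  centralRatio-suc n (suc i) = *-cancelˡ-≡ (ι n + ι i + ι 1) (ℚₚ.≤-<-trans (0≤ι n ⊕ 0≤ι i)
      (subst (_< ι n + ι i + ι 1) (ℚₚ.+-identityʳ (ι n + ι i)) (ℚₚ.+-monoʳ-< (ι n + ι i) (0<ι-suc 0))))
    (subst (λ I → (ι n + ι i + ι 1) * (N * N * centralRatio n (suc i)) ≡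
                  (ι n + ι i + ι 1) * ((N * N - I * I) * centralRatio (suc n) (suc i))) (sym (ι-suc i))
      (modulo (centralRatio-rec n i) (N * N) (modulo (centralRatio-suc n i) (ι n - ι i)
        (modulo (subst (λ M → (M + ι i + ι 1) * centralRatio (suc n) (suc i) ≡ (M - ι i) * centralRatio (suc n)
            i) (ι-suc n)
                  (centralRatio-rec (suc n) i)) (- ((ι n - ι i) * (ι n + ι i + ι 1)))
          (solve 6 (λ n i a b c d →
              (n :+ i :+ # 1) :* ((n :+ # 1) :* (n :+ # 1) :* b) :=
              (n :+ i :+ # 1) :* (((n :+ # 1) :* (n :+ # 1) :- (i :+ # 1) :* (i :+ # 1)) :* d) :+ (n :+ # 1) :*
                (n :+ # 1) :* ((n :+ i :+ # 1) :* b :- (n :- i) :* a) :+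
                (n :- i) :* ((n :+ # 1) :* (n :+ # 1) :* a :- ((n :+ # 1) :* (n :+ # 1) :- i :* i) :* c) :+
                (:- ((n :- i) :* (n :+ i :+ # 1))) :* ((n :+ # 1 :+ i :+ # 1) :* d :- (n :+ # 1 :- i) :* c))
              refl (ι n) (ι i) (centralRatio n i) (centralRatio n (suc i)) (centralRatio (suc n) i)
                  (centralRatio (suc n) (suc i)))))))
    where
    N : ℚ
    N = ι n + ι 1

  -- In the expansion over ℤ the terms i and -i - 1 carry the same factor (-1)ⁱ / (2i + 1), so the
  -- sum folds onto i ≥ 0.
  wallisTerm : ℕ → ℕ → ℚ
  wallisTerm n i = (centralRatio n i + centralRatio n (suc i)) * ν (2 ℕ.* i)

  wallisSum : ℕ → ℕ → ℚ
  wallisSum n m = ∑ m (λ i → sign i * wallisTerm n i)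

  [2i+1]*ν : ∀ i → (ι 2 * ι i + ι 1) * ν (2 ℕ.* i) ≡ ι 1
  [2i+1]*ν i = trans (cong (λ s → (s + ι 1) * ν (2 ℕ.* i)) (sym (ι-* 2 i))) ([n+1]*ν (2 ℕ.* i))

  -- By `centralRatio-suc`, the step from n to N = n + 1 brings in 4 (N² - i²) = (4N² - 1) - (2i -
  -- 1)(2i + 1), and likewise for i + 1 with (2i + 1)(2i + 3). The subtracted products cancel the
  -- denominator 2i + 1 and telescope. Beyond the support of `centralRatio` the end term vanishes,
  -- leaving the recurrence of Wallis' product.
  wallisSum-telescopes : ∀ n m → (ι n + ι 1) * ((ι 4 * ((ι n + ι 1) * (ι n + ι 1)) - ι 1) * wallisSum (suc n)
      m) +
      (ι 2 * ι n + ι 1) * (sign m * (ι m * centralRatio (suc n) m)) ≡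
    (ι n + ι 1) * (ι 4 * ((ι n + ι 1) * (ι n + ι 1)) * wallisSum n m)
  wallisSum-telescopes n zero    = (solve 1 (λ n →
      (n :+ # 1) :* ((# 4 :* ((n :+ # 1) :* (n :+ # 1)) :- # 1) :* # 0) :+ (# 2 :* n :+ # 1) :*
        (# 1 :* (# 0 :* # 1)) :=
      (n :+ # 1) :* (# 4 :* ((n :+ # 1) :* (n :+ # 1)) :* # 0))
      refl (ι n))
  wallisSum-telescopes n (suc m) = subst (λ I →
      (ι n + ι 1) * ((ι 4 * ((ι n + ι 1) * (ι n + ι 1)) - ι 1) * wallisSum (suc n) (suc m)) +
        (ι 2 * ι n + ι 1) * (sign (suc m) * (I * centralRatio (suc n) (suc m))) ≡
      (ι n + ι 1) * (ι 4 * ((ι n + ι 1) * (ι n + ι 1)) * wallisSum n (suc m))) (sym (ι-suc m))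
    (modulo (wallisSum-telescopes n m) 1ℚ
    (modulo (centralRatio-suc n m) (- (ι 4 * (ι n + ι 1) * sign m * v))
    (modulo (subst (λ I → N * N * centralRatio n (suc m) ≡ (N * N - I * I) * centralRatio (suc n) (suc m))
        (ι-suc m)
              (centralRatio-suc n (suc m))) (- (ι 4 * (ι n + ι 1) * sign m * v))
    (modulo ([2i+1]*ν m) ((ι n + ι 1) * sign m * ((ι 2 * ι m - ι 1) * centralRatio (suc n) m +
        (ι 2 * ι m + ι 3) * centralRatio (suc n) (suc m)))
    (modulo (subst (λ M → (M + ι m + ι 1) * centralRatio (suc n) (suc m) ≡ (M - ι m) * centralRatio (suc n) m)
        (ι-suc n)
              (centralRatio-rec (suc n) m)) (sign m)
      (solve 10 (λ n m s v a b c d S T →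
          (n :+ # 1) :* ((# 4 :* ((n :+ # 1) :* (n :+ # 1)) :- # 1) :* (S :+ s :* ((c :+ d) :* v))) :+
            (# 2 :* n :+ # 1) :* ((:- # 1) :* s :* ((m :+ # 1) :* d)) :=
          (n :+ # 1) :* (# 4 :* ((n :+ # 1) :* (n :+ # 1)) :* (T :+ s :* ((a :+ b) :* v))) :+
            # 1 :* ((n :+ # 1) :* ((# 4 :* ((n :+ # 1) :* (n :+ # 1)) :- # 1) :* S) :+ (# 2 :* n :+ # 1) :*
            (s :* (m :* c)) :- (n :+ # 1) :* (# 4 :* ((n :+ # 1) :* (n :+ # 1)) :* T)) :+
            (:- (# 4 :* (n :+ # 1) :* s :* v)) :* ((n :+ # 1) :* (n :+ # 1) :* a :-
            ((n :+ # 1) :* (n :+ # 1) :- m :* m) :* c) :+ (:- (# 4 :* (n :+ # 1) :* s :* v)) :*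
            ((n :+ # 1) :* (n :+ # 1) :* b :- ((n :+ # 1) :* (n :+ # 1) :- (m :+ # 1) :* (m :+ # 1)) :* d) :+
            (n :+ # 1) :* s :* ((# 2 :* m :- # 1) :* c :+ (# 2 :* m :+ # 3) :* d) :* ((# 2 :* m :+ # 1) :* v :-
            # 1) :+ s :* ((n :+ # 1 :+ m :+ # 1) :* d :- (n :+ # 1 :- m) :* c))
          refl (ι n) (ι m) (sign m) (ν (2 ℕ.* m)) (centralRatio n m) (centralRatio n (suc m))
              (centralRatio (suc n) m) (centralRatio (suc n) (suc m)) (wallisSum (suc n) m)
              (wallisSum n m)))))))
    where
    N v : ℚ
    N = ι n + ι 1
    v = ν (2 ℕ.* m)

  centralRatio-0 : ∀ d → centralRatio 0 (suc d) ≡ 0ℚ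
  centralRatio-0 d = subst (λ j → centralRatio 0 (suc j) ≡ 0ℚ) (ℕₚ.+-identityʳ d) (centralRatio-beyond 0 d)

  wallisSum-0 : ∀ d → wallisSum 0 (suc d) ≡ 1ℚ
  wallisSum-0 zero    = modulo (centralRatio-0 0) (ν 0) (modulo (ι*ν 0) 1ℚ
    (solve 2 (λ a v →
        # 0 :+ # 1 :* ((# 1 :+ a) :* v) :=
        # 1 :+ v :* (a :- # 0) :+ # 1 :* (# 1 :* v :- # 1))
        refl (centralRatio 0 1) (ν 0)))
  wallisSum-0 (suc d) = modulo (wallisSum-0 d) 1ℚ (modulo (centralRatio-0 d) (sign (suc d) * v)
      (modulo (centralRatio-0 (suc d)) (sign (suc d) * v)
    (solve 5 (λ S s v a b →
        S :+ s :* ((a :+ b) :* v) :=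
        # 1 :+ # 1 :* (S :- # 1) :+ s :* v :* (a :- # 0) :+ s :* v :* (b :- # 0))
        refl (wallisSum 0 (suc d)) (sign (suc d)) v (centralRatio 0 (suc d)) (centralRatio 0 (suc (suc d))))))
    where
    v : ℚ
    v = ν (2 ℕ.* suc d)

  0<2n+1 : ∀ n → 0ℚ < ι 2 * ι n + ι 1
  0<2n+1 n = subst (λ s → 0ℚ < s + ι 1) (ι-* 2 n) (0<ι+1 (2 ℕ.* n))

  -- (2n + 1) Aₙ is the reciprocal of the finite Wallis product, and every cut-off past n gives the
  -- expansion of that product in full.
  wallis-product : ∀ n d → (ι 2 * ι n + ι 1) * binom² n * wallisSum n (d ℕ.+ suc n) ≡ 1ℚ
  wallis-product zero    d = modulo (trans (cong (wallisSum 0) (ℕₚ.+-comm d 1)) (wallisSum-0 d)) 1ℚ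
    (solve 1 (λ S → (# 2 :* # 0 :+ # 1) :* # 1 :* S := # 1 :+ # 1 :* (S :- # 1)) refl (wallisSum 0 (d ℕ.+ 1)))
  wallis-product (suc n) d = subst₂ (λ I m → (ι 2 * I + ι 1) * binom² (suc n) * wallisSum (suc n) m ≡ 1ℚ)
    (sym (ι-suc n)) (sym (ℕₚ.+-suc d (suc n)))
    (*-cancelˡ-≡ (N * (ι 4 * (N * N)) * (ι 2 * ι n + ι 1))
      (*-pos (*-pos (0<ι+1 n) (*-pos (0<ι-suc 3) (*-pos (0<ι+1 n) (0<ι+1 n)))) (0<2n+1 n))
      (modulo (binom²-rec n) (N * (ι 2 * ι n + ι 3) * (ι 2 * ι n + ι 1) * wallisSum (suc n) m)
      (modulo (wallisSum-telescopes n m) (o * o * binom² n)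
      (modulo (centralRatio-beyond (suc n) d) (- (o * o * o * binom² n * sign m * ι m))
      (modulo (wallis-product n (suc d)) (N * (ι 4 * (N * N)) * o)
      (solve 8 (λ n A B S T s m r →
          (n :+ # 1) :* (# 4 :* ((n :+ # 1) :* (n :+ # 1))) :* (# 2 :* n :+ # 1) :*
            ((# 2 :* (n :+ # 1) :+ # 1) :* B :* T) :=
          (n :+ # 1) :* (# 4 :* ((n :+ # 1) :* (n :+ # 1))) :* (# 2 :* n :+ # 1) :* # 1 :+ (n :+ # 1) :*
            (# 2 :* n :+ # 3) :* (# 2 :* n :+ # 1) :* T :* (# 4 :* ((n :+ # 1) :* (n :+ # 1)) :* B :-
            (# 2 :* n :+ # 1) :* (# 2 :* n :+ # 1) :* A) :+ (# 2 :* n :+ # 1) :* (# 2 :* n :+ # 1) :* A :*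
            ((n :+ # 1) :* ((# 4 :* ((n :+ # 1) :* (n :+ # 1)) :- # 1) :* T) :+ (# 2 :* n :+ # 1) :*
            (s :* (m :* r)) :- (n :+ # 1) :* (# 4 :* ((n :+ # 1) :* (n :+ # 1)) :* S)) :+
            (:- ((# 2 :* n :+ # 1) :* (# 2 :* n :+ # 1) :* (# 2 :* n :+ # 1) :* A :* s :* m)) :* (r :- # 0) :+
            (n :+ # 1) :* (# 4 :* ((n :+ # 1) :* (n :+ # 1))) :* (# 2 :* n :+ # 1) :*
            ((# 2 :* n :+ # 1) :* A :* S :- # 1))
          refl (ι n) (binom² n) (binom² (suc n)) (wallisSum n m) (wallisSum (suc n) m) (sign m) (ι m)
              (centralRatio (suc n) m)))))))
    where
    m : ℕ
    m = suc (d ℕ.+ suc n)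
    N o : ℚ
    N = ι n + ι 1
    o = ι 2 * ι n + ι 1

  leibnizSum : ℕ → ℚ
  leibnizSum m = ∑ m (λ i → sign i * ν (2 ℕ.* i))

  ι*/ : ∀ d .{{_ : ℕ.NonZero d}} z → ι d * (z ℚ./ d) ≡ ratℤ z
  ι*/ (suc d) z = ℚₚ.toℚᵘ-injective (begin
      ℚ.toℚᵘ (ι (suc d) * (z ℚ./ suc d))                ≈⟨ ℚₚ.toℚᵘ-homo-* (ι (suc d)) (z ℚ./ suc d) ⟩
      ℚ.toℚᵘ (ι (suc d)) ℚᵘ.* ℚ.toℚᵘ (z ℚ./ suc d)      ≈⟨ ℚᵘₚ.*-cong (toℚᵘ-ratℤ (+ suc d))
          (ℚₚ.toℚᵘ-fromℚᵘ (mkℚᵘ z d)) ⟩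
      mkℚᵘ (+ suc d) 0 ℚᵘ.* mkℚᵘ z d                    ≈⟨ *≡* (trans (ℤₚ.*-identityʳ (+ suc d ℤ.* z))
          (trans (ℤₚ.*-comm (+ suc d) z)
                                                             (cong (λ j → z ℤ.* (+ suc j)) (sym
                                                                 (ℕₚ.+-identityʳ d))))) ⟩
      mkℚᵘ z 0                                          ≈⟨ toℚᵘ-ratℤ z ⟨
      ℚ.toℚᵘ (ratℤ z)                                   ∎)
    where open ℚᵘₚ.≃-Reasoning

  1/suc≡ν : ∀ n → + 1 ℚ./ suc n ≡ ν n
  1/suc≡ν n = *-cancelˡ-≡ (ι (suc n)) (0<ι-suc n) (trans (ι*/ (suc n) (+ 1)) (sym (ι*ν n)))

  partialSum≡leibnizSum : ∀ m → Leibniz.partialSum m ≡ leibnizSum m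
  partialSum≡leibnizSum m = ∑-cong m λ i _ → cong (sign i *_) (1/suc≡ν (2 ℕ.* i))

  wallisTerm-anti : ∀ n i → wallisTerm n (suc i) ≤ wallisTerm n i
  wallisTerm-anti n i = *-mono-0≤ (0≤centralRatio n (suc i) ⊕ 0≤centralRatio n (suc (suc i))) (0≤ν (2 ℕ.* i))
    (ℚₚ.+-mono-≤ (proj₂ (centralRatio-bounds n i)) (proj₂ (centralRatio-bounds n (suc i))))
    (ν-anti (ℕₚ.*-monoʳ-≤ 2 (ℕₚ.n≤1+n i)))

  0≤wallisTerm : ∀ n i → 0ℚ ≤ wallisTerm n i
  0≤wallisTerm n i = (0≤centralRatio n i ⊕ 0≤centralRatio n (suc i)) ⊗ 0≤ν (2 ℕ.* i)

  wallisTerm≤ : ∀ n i → wallisTerm n i ≤ ι 2 * ν i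
  wallisTerm≤ n i = ≤-by ((gap (centralRatio≤1 n i) ⊕ gap (centralRatio≤1 n (suc i))) ⊗ 0≤ν (2 ℕ.* i)
      ⊕ 0≤ι 2 ⊗ gap (ν-anti (ℕₚ.m≤m+n i (i ℕ.+ 0))))
    (solve 4 (λ a b v u →
        # 2 :* u :=
        (a :+ b) :* v :+ ((# 1 :- a :+ (# 1 :- b)) :* v :+ # 2 :* (u :- v)))
        refl (centralRatio n i) (centralRatio n (suc i)) (ν (2 ℕ.* i)) (ν i))

  ∣2leibniz-wallis∣≤ : ∀ n m → ∣ ι 2 * leibnizSum m - wallisSum n m ∣ ≤ ι 2 * (ι m * (ι m * ι m)) * ν n
  ∣2leibniz-wallis∣≤ n m = ℚₚ.≤-trans (∣∣-≡ eq (∣∑∣≤ m {g = λ _ → ι 2 * (ι m * ι m * ν n)} term≤))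
    (ℚₚ.≤-reflexive (trans (∑-const m _) (solve 2 (λ m v →
        m :* (# 2 :* (m :* m :* v)) :=
        # 2 :* (m :* (m :* m)) :* v)
        refl (ι m) (ν n))))
    where
    eq : ∑ m (λ i → sign i * (ι 2 * ν (2 ℕ.* i) - wallisTerm n i)) ≡ ι 2 * leibnizSum m - wallisSum n m
    eq = trans (∑-cong m λ i _ → (solve 3 (λ s v x →
        s :* (# 2 :* v :- x) :=
        # 2 :* (s :* v) :+ (:- # 1) :* (s :* x))
        refl (sign i) (ν (2 ℕ.* i)) (wallisTerm n i)))
      (trans (∑-+ m _ _) (trans (cong₂ _+_ (∑-* m (ι 2) _) (∑-* m (- 1ℚ) _))
        (solve 2 (λ a b → # 2 :* a :+ (:- # 1) :* b := # 2 :* a :- b) refl (leibnizSum m) (wallisSum n m))))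
    term≤ : ∀ i → i ℕ.< m → ∣ sign i * (ι 2 * ν (2 ℕ.* i) - wallisTerm n i) ∣ ≤ ι 2 * (ι m * ι m * ν n)
    term≤ i i<m = ℚₚ.≤-trans (∣∣-* (sign≤1 i) (∣∣-0≤ {a = ι 2 * (ι m * ι m * ν n)}
        (≤-by ((gap (centralRatio≤1 n i) ⊕ gap (centralRatio≤1 n (suc i))) ⊗ 0≤ν (2 ℕ.* i))
          (solve 3 (λ a b v →
              # 2 :* v :- (a :+ b) :* v :=
              # 0 :+ (# 1 :- a :+ (# 1 :- b)) :* v)
              refl (centralRatio n i) (centralRatio n (suc i)) (ν (2 ℕ.* i))))
        (≤-by ((gap (deficit≤ i (ℕₚ.<⇒≤ i<m)) ⊕ gap (deficit≤ (suc i) i<m)) ⊕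
               (gap (centralRatio≤1 n i) ⊕ gap (centralRatio≤1 n (suc i))) ⊗ gap (ν≤1 (2 ℕ.* i)))
          (solve 4 (λ a b v c →
              # 2 :* c :=
              # 2 :* v :- (a :+ b) :* v :+ ((c :- (# 1 :- a) :+ (c :- (# 1 :- b))) :+
                (# 1 :- a :+ (# 1 :- b)) :* (# 1 :- v)))
              refl (centralRatio n i) (centralRatio n (suc i)) (ν (2 ℕ.* i)) (ι m * ι m * ν n)))))
      (ℚₚ.≤-reflexive (ℚₚ.*-identityˡ _))
      where
      deficit≤ : ∀ j → j ℕ.≤ m → 1ℚ - centralRatio n j ≤ ι m * ι m * ν n
      deficit≤ j j≤m = ℚₚ.≤-trans (1-centralRatio≤ n j)
        (*-monoʳ-0≤ (0≤ν n) (*-mono-0≤ (0≤ι j) (0≤ι m) (ι-mono j≤m) (ι-mono j≤m)))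

  -- The cut-off m decouples two limits: past m both sums are alternating, with tails of order 1 /
  -- (m + 1) uniformly in n and i; below m the central ratios tend to 1 as n grows.
  ∣2leibniz-product∣≤ : ∀ m {n i} → m ℕ.≤ n → m ℕ.≤ i →
    ∣ ι 2 * leibnizSum i - wallisSum n (suc n) ∣ ≤ ι 4 * ν m + ι 2 * (ι m * (ι m * ι m)) * ν n
  ∣2leibniz-product∣≤ m {n} {i} m≤n m≤i = ℚₚ.≤-trans
    (∣∣-≡ (solve 4 (λ a b c d →
        # 2 :* (a :- b) :+ (# 2 :* b :- c) :+ (:- (d :- c)) :=
        # 2 :* a :- d)
        refl (leibnizSum i) (leibnizSum m) (wallisSum n m) (wallisSum n (suc n)))
      (∣∣-+ (∣∣-+ (∣∣-* (∣∣-0≤ (0≤ι 2) (ℚₚ.≤-refl {ι 2})) leibniz-tail) (∣2leibniz-wallis∣≤ n m))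
          (∣∣-neg wallis-tail)))
    (ℚₚ.≤-reflexive (solve 2 (λ v c →
        # 2 :* v :+ c :+ # 2 :* v :=
        # 4 :* v :+ c)
        refl (ν m) (ι 2 * (ι m * (ι m * ι m)) * ν n)))
    where
    leibniz-tail : ∣ leibnizSum i - leibnizSum m ∣ ≤ ν m
    leibniz-tail = ℚₚ.≤-trans (subst (λ j → ∣ leibnizSum j - leibnizSum m ∣ ≤ ν (2 ℕ.* m)) (ℕₚ.m∸n+n≡m m≤i)
        (alternating-tail (i ℕ.∸ m) m {λ j → ν (2 ℕ.* j)} (λ j → 0≤ν (2 ℕ.* j))
            (λ j → ν-anti (ℕₚ.*-monoʳ-≤ 2 (ℕₚ.n≤1+n j)))))
      (ν-anti (ℕₚ.m≤m+n m (m ℕ.+ 0)))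
    m≤1+n : m ℕ.≤ suc n
    m≤1+n = ℕₚ.m≤n⇒m≤1+n m≤n
    wallis-tail : ∣ wallisSum n (suc n) - wallisSum n m ∣ ≤ ι 2 * ν m
    wallis-tail = ℚₚ.≤-trans (subst (λ j → ∣ wallisSum n j - wallisSum n m ∣ ≤ wallisTerm n m)
        (ℕₚ.m∸n+n≡m m≤1+n)
        (alternating-tail (suc n ℕ.∸ m) m {wallisTerm n} (0≤wallisTerm n) (wallisTerm-anti n)))
      (wallisTerm≤ n m)

  ½≤leibnizSum : ∃[ I ] ∀ i → I ℕ.≤ i → ½ ≤ leibnizSum i
  -- Both 2 and ½ are the witnesses inside `Leibniz.0<π/4`.
  ½≤leibnizSum = 2 , λ i 2≤i → subst₂ _≤_ (ℚₚ.+-identityˡ ½) (partialSum≡leibnizSum i)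
    (ℚₚ.<⇒≤ (proj₂ (proj₂ (proj₂ Leibniz.0<π/4)) i 2≤i))

  -- n (2n choose n)² / 16ⁿ → 1 / π, where s stands for 1 / (4 leibnizSum i).
  1/π-approximation : ∀ {ε} → 0ℚ < ε → ∃[ I ] ∀ n i → I ℕ.≤ n → I ℕ.≤ i →
    ∀ s → ι 4 * leibnizSum i * s ≡ 1ℚ → 0ℚ ≤ s → ∣ ι n * binom² n - s ∣ ≤ ε
  1/π-approximation {ε} 0<ε = m ℕ.⊔ (N ℕ.⊔ 2) , λ n i I≤n I≤i s 4ps≡1 0≤s →
    bound n i (ℕₚ.m⊔n≤o⇒m≤o m (N ℕ.⊔ 2) I≤n) (ℕₚ.m⊔n≤o⇒m≤o N 2 (ℕₚ.m⊔n≤o⇒n≤o m (N ℕ.⊔ 2) I≤n))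
      (ℕₚ.m⊔n≤o⇒m≤o m (N ℕ.⊔ 2) I≤i) (ℕₚ.m⊔n≤o⇒n≤o N 2 (ℕₚ.m⊔n≤o⇒n≤o m (N ℕ.⊔ 2) I≤i)) s 4ps≡1 0≤s
    where
    choice-m = small-ν (ι 4) (0≤ι 4) (*-pos (0<ν 1) 0<ε)
    m : ℕ
    m = proj₁ choice-m
    K : ℚ
    -- The summand 1 pays for Aₙ P ≤ ν n, the error of writing 2n for 2n + 1 in `wallis-product`.
    K = ι 2 * (ι m * (ι m * ι m)) + ι 1
    choice-N = small-ν K (0≤ι 2 ⊗ (0≤ι m ⊗ (0≤ι m ⊗ 0≤ι m)) ⊕ 0≤ι 1) (*-pos (0<ν 1) 0<ε)
    N : ℕ
    N = proj₁ choice-N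
    bound : ∀ n i → m ℕ.≤ n → N ℕ.≤ n → m ℕ.≤ i → 2 ℕ.≤ i →
      ∀ s → ι 4 * leibnizSum i * s ≡ 1ℚ → 0ℚ ≤ s → ∣ ι n * binom² n - s ∣ ≤ ε
    bound n i m≤n N≤n m≤i 2≤i s 4ps≡1 0≤s = ℚₚ.≤-trans
      (∣∣-≡ (modulo 4ps≡1 (ι n * A) (modulo (wallis-product n 0) (- s)
         (solve 5 (λ n A p P s →
             s :* (# 2 :* (n :* A) :* (# 2 :* p :- P) :+ (:- (A :* P))) :=
             n :* A :- s :+ n :* A :* (# 4 :* p :* s :- # 1) :+ (:- s) :* ((# 2 :* n :+ # 1) :* A :* P :- # 1))
             refl (ι n) A p P s)))
        (∣∣-* (∣∣-0≤ 0≤s s≤1) (∣∣-+ (∣∣-* (∣∣-0≤ (0≤ι 2 ⊗ (0≤ι n ⊗ 0≤binom² n)) 2nA≤1) (∣2leibniz-product∣≤ m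
            m≤n m≤i))
          (∣∣-neg (∣∣-0≤ 0≤AP AP≤ν)))))
      (≤-by (gap (proj₂ choice-m m ℕₚ.≤-refl) ⊕ gap (proj₂ choice-N n N≤n)) (modulo (ι*ν 1) (- ε)
        (solve 5 (λ e h v u c →
            e :=
            # 1 :* (# 1 :* (# 4 :* v :+ c :* u) :+ u) :+ (h :* e :- # 4 :* v :+ (h :* e :- (c :+ # 1) :* u)) :+
              (:- e) :* (# 2 :* h :- # 1))
            refl ε (ν 1) (ν m) (ν n) (ι 2 * (ι m * (ι m * ι m))))))
      where
      A p P : ℚ
      A = binom² n
      p = leibnizSum i
      P = wallisSum n (suc n)
      2nA≤1 : ι 2 * (ι n * A) ≤ 1ℚ
      2nA≤1 = ≤-by (gap ([2n+1]*binom²≤1 n) ⊕ 0≤binom² n) (solve 2 (λ n A →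
          # 1 :=
          # 2 :* (n :* A) :+ (# 1 :- (# 2 :* n :+ # 1) :* A :+ A))
          refl (ι n) A)
      0≤AP : 0ℚ ≤ A * P
      0≤AP = *-cancelˡ-≤ (ι 2 * ι n + ι 1) (0<2n+1 n) (≤-by (0≤ι 1) (modulo (wallis-product n 0) 1ℚ
        (solve 3 (λ n A P →
            (# 2 :* n :+ # 1) :* (A :* P) :=
            (# 2 :* n :+ # 1) :* # 0 :+ # 1 :+ # 1 :* ((# 2 :* n :+ # 1) :* A :* P :- # 1))
            refl (ι n) A P)))
      AP≤ν : A * P ≤ ν n
      AP≤ν = *-cancelˡ-≤ (ι n + ι 1) (0<ι+1 n) (≤-by (0≤ι n ⊗ 0≤AP) (modulo (wallis-product n 0) (- 1ℚ)
          (modulo ([n+1]*ν n) 1ℚ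
        (solve 4 (λ n A P v →
            (n :+ # 1) :* v :=
            (n :+ # 1) :* (A :* P) :+ n :* (A :* P) :+ (:- # 1) :* ((# 2 :* n :+ # 1) :* A :* P :- # 1) :+
              # 1 :* ((n :+ # 1) :* v :- # 1))
            refl (ι n) A P (ν n)))))
      s≤1 : s ≤ 1ℚ
      s≤1 = ≤-by (0≤ι 4 ⊗ gap (proj₂ ½≤leibnizSum i 2≤i) ⊗ 0≤s ⊕ 0≤s)
          (modulo 4ps≡1 (- 1ℚ) (modulo ½+½≡1 (ι 2 * s)
        (solve 3 (λ p s h →
            # 1 :=
            s :+ (# 4 :* (p :- h) :* s :+ s) :+ (:- # 1) :* (# 4 :* p :* s :- # 1) :+ # 2 :* s :* (h :+ h :-
              # 1))
            refl p s ½)))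
        where
        ½+½≡1 : ½ + ½ ≡ 1ℚ
        ½+½≡1 = refl

  -- The series at rational k

  cubicSum : ℕ → ℚ → ℚ
  cubicSum N k = ∑ N (λ n → binom² n * Curve.L n k * cubic k (ι n))

  cubicSum-V : ∀ {k} → 0ℚ ≤ k → ∀ N → cubicSum N k ≡
    (ι 1 + k) * M k * (k * k + ι 1) * Wronskian.V N k + boundary k (ι N) (binom² N) (Curve.L N k) (Curve.L⁻ N k)
  cubicSum-V {k} 0≤k zero    = (solve 2 (λ k z →
      # 0 :=
      (# 1 :+ k) :* Mᵖ k :* (k :* k :+ # 1) :* # 0 :+ # 4 :* # 1 :* (# 0 :* # 0) :*
        ((# 0 :+ # 1) :* (z :* z) :* # 0 :- # 0 :* (Mᵖ k :* Mᵖ k) :* # 1))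
      refl k (Z k))
  cubicSum-V {k} 0≤k (suc N) = trans (cong₂ _+_ (cubicSum-V 0≤k N)
      (cubic-telescopes (Wronskian.M*X 0≤k) (Wronskian.M*z 0≤k) (binom²-rec N) (legendreᶻ-rec (Curve.X k)
          (Curve.z k) N)))
    (trans
      (modulo ([1+x]*w 0≤k) (- (M k * (k * k + ι 1) * s))
        (solve 6 (λ k w V s b c →
            (# 1 :+ k) :* Mᵖ k :* (k :* k :+ # 1) :* V :+ b :+ (Mᵖ k :* (k :* k :+ # 1) :* s :+ (c :- b)) :=
            (# 1 :+ k) :* Mᵖ k :* (k :* k :+ # 1) :* (V :+ w :* s) :+ c :+
              (:- (Mᵖ k :* (k :* k :+ # 1) :* s)) :* ((# 1 :+ k) :* w :- # 1))
            refl k (w k) (Wronskian.V N k) s (boundary k (ι N) (binom² N) (Curve.L N k) (Curve.L⁻ N k))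
                (boundary k (ι N + ι 1) (binom² (suc N)) (Curve.L (suc N) k) (Curve.L N k))))
      (cong (λ m → (ι 1 + k) * M k * (k * k + ι 1) * Wronskian.V (suc N) k + boundary k m (binom² (suc N))
          (Curve.L (suc N) k) (Curve.L N k))
        (sym (ι-suc N))))
    where
    s : ℚ
    s = Wronskian.summand N k

  binom²≤ν : ∀ n → binom² n ≤ ν n
  binom²≤ν n = *-cancelˡ-≤ (ι n + ι 1) (0<ι+1 n) (≤-by (gap ([2n+1]*binom²≤1 n) ⊕ 0≤ι n ⊗ 0≤binom² n)
      (modulo ([n+1]*ν n) 1ℚ
    (solve 3 (λ n A v →
        (n :+ # 1) :* v :=
        (n :+ # 1) :* A :+ (# 1 :- (# 2 :* n :+ # 1) :* A :+ n :* A) :+ # 1 :* ((n :+ # 1) :* v :- # 1))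
        refl (ι n) (binom² n) (ν n))))

  1/4p : ∀ {p} → ½ ≤ p → ∃[ s ] ι 4 * p * s ≡ 1ℚ × 0ℚ ≤ s
  1/4p {p} ½≤p = inverse 0<4p , inverseʳ 0<4p , ℚₚ.<⇒≤ (inverse-pos 0<4p)
    where
    0<4p : 0ℚ < ι 4 * p
    0<4p = *-pos (0<ι-suc 3) (ℚₚ.<-≤-trans (ℚₚ.positive⁻¹ ½) ½≤p)

  module Series {lo hi : ℚ} (0<lo : 0ℚ < lo) (lo≤hi : lo ≤ hi) (hi<1 : hi < 1ℚ) {ε : ℚ} (0<ε : 0ℚ < ε) where
    -- One part in 3000: the prefactor (1 + k)³ (k² + 1) is at most 16, and the final estimate
    -- spends 16 (1 + 182 + 2) + 1 = 2961 parts. The 182 is 90 · 2 + 1 + 1 from `∣V₀-2ℓ∣≤`.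
    ε₁ : ℚ
    ε₁ = ν 2999 * ε

    0<ε₁ : 0ℚ < ε₁
    0<ε₁ = *-pos (0<ν 2999) 0<ε

    0≤ε₁ : 0ℚ ≤ ε₁
    0≤ε₁ = ℚₚ.<⇒≤ 0<ε₁

    choice-I = 1/π-approximation 0<ε₁
    choice-A = small-ν 1ℚ (0≤ι 1) 0<ε₁

    I I₂ M₁ : ℕ
    I = proj₁ choice-I
    I₂ = I ℕ.⊔ 2
    M₁ = I₂ ℕ.⊔ proj₁ choice-A

    I≤I₂ : I ℕ.≤ I₂
    I≤I₂ = ℕₚ.m≤m⊔n I 2

    -- A late value of n Aₙ stands in for 1/π, so that 0 ≤ ℓ ≤ 1 is immediate; s₀ mediates the
    -- comparison of ℓ with other late values.
    ℓ s₀ : ℚ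
    ℓ = ι I₂ * binom² I₂
    s₀ = proj₁ (1/4p (proj₂ ½≤leibnizSum I₂ (ℕₚ.m≤n⊔m I 2)))

    ∣q-s₀∣≤ : ∀ n → I ℕ.≤ n → ∣ ι n * binom² n - s₀ ∣ ≤ ε₁
    ∣q-s₀∣≤ n I≤n = let s , eq , 0≤s = 1/4p (proj₂ ½≤leibnizSum I₂ (ℕₚ.m≤n⊔m I 2)) in proj₂ choice-I n I₂ I≤n
        I≤I₂ s eq 0≤s

    ∣q-ℓ∣≤ : ∀ n → M₁ ℕ.≤ n → ∣ ι n * binom² n - ℓ ∣ ≤ ι 2 * ε₁
    ∣q-ℓ∣≤ n M₁≤n = ℚₚ.≤-trans
      (∣∣-≡ (solve 3 (λ q l s → (q :- s) :+ (:- (l :- s)) := q :- l) refl (ι n * binom² n) ℓ s₀)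
        (∣∣-+ (∣q-s₀∣≤ n (ℕₚ.≤-trans I≤I₂ (ℕₚ.m⊔n≤o⇒m≤o I₂ (proj₁ choice-A) M₁≤n))) (∣∣-neg (∣q-s₀∣≤ I₂ I≤I₂))))
      (ℚₚ.≤-reflexive (solve 1 (λ e → e :+ e := # 2 :* e) refl ε₁))

    binom²≤2ε₁ : ∀ n → M₁ ℕ.≤ n → binom² n ≤ ι 2 * ε₁
    binom²≤2ε₁ n M₁≤n = ℚₚ.≤-trans (binom²≤ν n) (≤-by
      (gap (proj₂ choice-A n (ℕₚ.m⊔n≤o⇒n≤o I₂ (proj₁ choice-A) M₁≤n)) ⊕ 0≤ε₁) (solve 2 (λ e v →
          # 2 :* e :=
          v :+ (e :- # 1 :* v :+ e))
          refl ε₁ (ν n)))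

    0≤C : 0ℚ ≤ ι 90 * ι M₁ + ι 89
    0≤C = 0≤ι 90 ⊗ 0≤ι M₁ ⊕ 0≤ι 89

    choice-η₁ = small-ν (ι 11) (0≤ι 11) (0<ι-suc 0)
    choice-η₂ = small-ν 1ℚ (0≤ι 1) 0<lo
    choice-η₃ = small-ν (ι 90 * ι M₁ + ι 89) 0≤C 0<ε₁

    m₁ m₂ m₃ m : ℕ
    m₁ = proj₁ choice-η₁
    m₂ = proj₁ choice-η₂
    m₃ = proj₁ choice-η₃
    m = m₁ ℕ.⊔ (m₂ ℕ.⊔ m₃)

    -- The order of the choices matters: M₁ comes from ε₁ alone, η is small relative to M₁ and lo,
    -- and `N` comes last, because the decay on [η², hi] degenerates as η → 0.
    η : ℚ
    η = ν m

    11η≤1 : ι 11 * η ≤ 1ℚ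
    11η≤1 = proj₂ choice-η₁ m (ℕₚ.m≤m⊔n m₁ (m₂ ℕ.⊔ m₃))

    η≤lo : η ≤ lo
    η≤lo = subst (_≤ lo) (ℚₚ.*-identityˡ η) (proj₂ choice-η₂ m (ℕₚ.≤-trans (ℕₚ.m≤m⊔n m₂ m₃)
        (ℕₚ.m≤n⊔m m₁ (m₂ ℕ.⊔ m₃))))

    Cη≤ε₁ : (ι 90 * ι M₁ + ι 89) * η ≤ ε₁
    Cη≤ε₁ = proj₂ choice-η₃ m (ℕₚ.≤-trans (ℕₚ.m≤n⊔m m₂ m₃) (ℕₚ.m≤n⊔m m₁ (m₂ ℕ.⊔ m₃)))

    module Lim = Limit (0<ν m) 11η≤1
    open Lim using () renaming (k to k₀)

    k₀≤lo : k₀ ≤ lo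
    k₀≤lo = ℚₚ.≤-trans Lim.k≤η η≤lo

    module Range = Curve-range {k₀} {hi} (*-pos (0<ν m) (0<ν m)) hi<1

    k₀≤hi : k₀ ≤ hi
    k₀≤hi = ℚₚ.≤-trans k₀≤lo lo≤hi

    choice-V = Range.V-near-constant {k₀} (ℚₚ.≤-refl , k₀≤hi) 0<ε₁
    choice-B = Range.boundary-small k₀≤hi 0<ε₁
    choice-t = quadratic-decay Lim.0≤ρ Lim.ρ<1 (ι 10) (0≤ι 10) 0<ε₁

    N : ℕ
    N = (proj₁ choice-V ℕ.⊔ proj₁ choice-B) ℕ.⊔ (proj₁ choice-t ℕ.⊔ M₁)

    10t≤ε₁ : ∀ n → proj₁ choice-t ℕ.≤ n → ι 10 * Lim.t n ≤ ε₁
    10t≤ε₁ n N≤n = ℚₚ.≤-trans (≤-by (0≤ι 10 ⊗ (gap (Lim.t≤^ n) ⊕ (0≤ι n ⊗ 0≤ι n ⊕ 0≤ι 2 ⊗ 0≤ι n) ⊗ 0≤^ Lim.0≤ρ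
        n))
      (solve 3 (λ n t r →
          # 10 :* ((n :+ # 1) :* (n :+ # 1) :* r) :=
          # 10 :* t :+ # 10 :* (r :- t :+ (n :* n :+ # 2 :* n) :* r))
          refl (ι n) (Lim.t n) (Lim.ρ ^ n))) (proj₂ choice-t n N≤n)

    module _ (n : ℕ) (N≤n : N ℕ.≤ n) where
      private
        a b : ℕ
        a = proj₁ choice-V ℕ.⊔ proj₁ choice-B
        b = proj₁ choice-t ℕ.⊔ M₁
        V≤n : proj₁ choice-V ℕ.≤ n
        V≤n = ℕₚ.m⊔n≤o⇒m≤o (proj₁ choice-V) (proj₁ choice-B) (ℕₚ.m⊔n≤o⇒m≤o a b N≤n)
        B≤n : proj₁ choice-B ℕ.≤ n
        B≤n = ℕₚ.m⊔n≤o⇒n≤o (proj₁ choice-V) (proj₁ choice-B) (ℕₚ.m⊔n≤o⇒m≤o a b N≤n)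
        t≤n : proj₁ choice-t ℕ.≤ n
        t≤n = ℕₚ.m⊔n≤o⇒m≤o (proj₁ choice-t) M₁ (ℕₚ.m⊔n≤o⇒n≤o a b N≤n)
        M≤n : M₁ ℕ.≤ n
        M≤n = ℕₚ.m⊔n≤o⇒n≤o (proj₁ choice-t) M₁ (ℕₚ.m⊔n≤o⇒n≤o a b N≤n)

      ∣V₀-2ℓ∣≤ : ∣ Wronskian.V (suc n) k₀ - ι 2 * ℓ ∣ ≤ ι 182 * ε₁
      ∣V₀-2ℓ∣≤ = ℚₚ.≤-trans
        (subst (λ j → ∣ Wronskian.V (suc j) k₀ - ι 2 * ℓ ∣ ≤ ι 90 * (η * ι M₁ + ι 2 * ε₁) + ι 89 * η +
            ι 10 * Lim.t j)
          (ℕₚ.m∸n+n≡m M≤n)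
          (Lim.∣V-2ℓ∣≤ {M = M₁} (0≤ι I₂ ⊗ 0≤binom² I₂) (n*binom²≤1 I₂) (0≤ι 2 ⊗ 0≤ε₁) ∣q-ℓ∣≤ binom²≤2ε₁
              (n ℕ.∸ M₁)))
        (≤-by (gap Cη≤ε₁ ⊕ gap (10t≤ε₁ n t≤n))
          (solve 4 (λ h e m t →
              # 182 :* e :=
              # 90 :* (h :* m :+ # 2 :* e) :+ # 89 :* h :+ # 10 :* t :+ ((e :- (# 90 :* m :+ # 89) :* h) :+
                (e :- # 10 :* t)))
              refl η ε₁ (ι M₁) (Lim.t n)))

      series-estimate : ∀ {k} → lo ≤ k → k ≤ hi → ∀ i → I ℕ.≤ i → ∀ s → ι 4 * leibnizSum i * s ≡ 1ℚ → 0ℚ ≤ s →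
        ∣ cubicSum (suc n) k - ι 2 * ((ι 1 + k) * M k) * (k * k + ι 1) * s ∣ ≤ ε
      series-estimate {k} lo≤k k≤hi i I≤i s 4ps≡1 0≤s = ℚₚ.≤-trans
        (∣∣-≡ (trans (solve 7 (λ c d V W l s b →
            c :* d :* ((V :- W) :+ (W :- # 2 :* l) :+ # 2 :* (l :- s)) :+ b :=
            c :* d :* V :+ b :- # 2 :* c :* d :* s)
            refl ((ι 1 + k) * M k) (k * k + ι 1) (Wronskian.V (suc n) k) (Wronskian.V (suc n) k₀) ℓ s bd)
            (cong (_- ι 2 * ((ι 1 + k) * M k) * (k * k + ι 1) * s) (sym (cubicSum-V 0≤k (suc n)))))
          (∣∣-+ (∣∣-* (∣∣-0≤ 0≤c c≤16) (∣∣-+ (∣∣-+ (proj₂ choice-V n V≤n kI (proj₁ kI)) ∣V₀-2ℓ∣≤)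
              (∣∣-* (∣∣-0≤ (0≤ι 2) (ℚₚ.≤-refl {ι 2})) (proj₂ choice-I I₂ i I≤I₂ I≤i s 4ps≡1 0≤s))))
            (proj₂ choice-B n B≤n kI)))
        (≤-by (0≤ι 39 ⊗ 0≤ε₁) (modulo (ι*ν 2999) (- ε)
          (solve 2 (λ e v →
              e :=
              # 16 :* (v :* e :+ # 182 :* (v :* e) :+ # 2 :* (v :* e)) :+ v :* e :+ # 39 :* (v :* e) :+
                (:- e) :* (# 3000 :* v :- # 1))
              refl ε (ν 2999))))
        where
        bd : ℚ
        bd = boundary k (ι (suc n)) (binom² (suc n)) (Curve.L (suc n) k) (Curve.L n k)
        0<k : 0ℚ < k
        0<k = ℚₚ.<-≤-trans 0<lo lo≤k
        k<1 : k < 1ℚ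
        k<1 = ℚₚ.≤-<-trans k≤hi hi<1
        open Curve-bounds 0<k k<1 using (0≤k; 0≤1-k)
        kI : k₀ ≤ k × k ≤ hi
        kI = ℚₚ.≤-trans k₀≤lo lo≤k , k≤hi
        0≤c : 0ℚ ≤ (ι 1 + k) * M k * (k * k + ι 1)
        0≤c = (0≤ι 1 ⊕ 0≤k) ⊗ 0≤p*p (ι 1 + k) ⊗ (0≤k ⊗ 0≤k ⊕ 0≤ι 1)
        c≤16 : (ι 1 + k) * M k * (k * k + ι 1) ≤ ι 16
        c≤16 = ≤-by (0≤1-k ⊗ (0≤ι 15 ⊕ 0≤ι 12 ⊗ 0≤k ⊕ 0≤ι 8 ⊗ (0≤k ⊗ 0≤k) ⊕ 0≤ι 4 ⊗ (0≤k ⊗ 0≤k ⊗ 0≤k) ⊕ 0≤k ⊗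
            0≤k ⊗ 0≤k ⊗ 0≤k))
          (solve 1 (λ k →
              # 16 :=
              (# 1 :+ k) :* Mᵖ k :* (k :* k :+ # 1) :+ (# 1 :- k) :* (# 15 :+ # 12 :* k :+ # 8 :* (k :* k) :+
                # 4 :* (k :* k :* k) :+ k :* k :* k :* k))
              refl k)

  -- Legendre polynomials as hypergeometric sums

  -- risingProduct N j is (−N)ⱼ (N + 1)ⱼ.
  risingProduct : ℚ → ℕ → ℚ
  risingProduct N zero    = 1ℚ
  risingProduct N (suc j) = risingProduct N j * (ι j * (ι j + 1ℚ) - N * (N + 1ℚ))

  -- (-N - 1)ⱼ₊₁ = -(N + 1)(-N)ⱼ and (N + 1)(N + 2)ⱼ₊₁ = (N + 1)ⱼ (N + j + 1)(N + j + 2). Raising j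
  -- along with N keeps the relation free of division.
  risingProduct-suc : ∀ N j → risingProduct (N + 1ℚ) (suc j) ≡ - ((N + ι j + ι 2) * (N + ι j + 1ℚ) *
      risingProduct N j)
  risingProduct-suc N zero    = (solve 1 (λ N →
      # 1 :* (# 0 :* (# 0 :+ # 1) :- (N :+ # 1) :* (N :+ # 1 :+ # 1)) :=
      (:- ((N :+ # 0 :+ # 2) :* (N :+ # 0 :+ # 1) :* # 1)))
      refl N)
  risingProduct-suc N (suc j) = trans
    (cong₂ _*_ (risingProduct-suc N j) (cong (λ J → J * (J + 1ℚ) - (N + 1ℚ) * (N + 1ℚ + 1ℚ)) (ι-suc j)))
    (trans (solve 3 (λ N j e →
        (:- ((N :+ j :+ # 2) :* (N :+ j :+ # 1) :* e)) :* ((j :+ # 1) :* (j :+ # 1 :+ # 1) :- (N :+ # 1) :*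
          (N :+ # 1 :+ # 1)) :=
        (:- ((N :+ (j :+ # 1) :+ # 2) :* (N :+ (j :+ # 1) :+ # 1) :*
          (e :* (j :* (j :+ # 1) :- N :* (N :+ # 1))))))
        refl N (ι j) (risingProduct N j))
      (cong (λ J → - ((N + J + ι 2) * (N + J + 1ℚ) * risingProduct N (suc j))) (sym (ι-suc j))))

  risingProduct-pred : ∀ N j → risingProduct (N - 1ℚ) (suc j) ≡ - ((N - ι j - 1ℚ) * (N - ι j) * risingProduct N
      j)
  risingProduct-pred N zero    = (solve 1 (λ N →
      # 1 :* (# 0 :* (# 0 :+ # 1) :- (N :- # 1) :* (N :- # 1 :+ # 1)) :=
      (:- ((N :- # 0 :- # 1) :* (N :- # 0) :* # 1)))
      refl N)
  risingProduct-pred N (suc j) = trans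
    (cong₂ _*_ (risingProduct-pred N j) (cong (λ J → J * (J + 1ℚ) - (N - 1ℚ) * (N - 1ℚ + 1ℚ)) (ι-suc j)))
    (trans (solve 3 (λ N j e →
        (:- ((N :- j :- # 1) :* (N :- j) :* e)) :* ((j :+ # 1) :* (j :+ # 1 :+ # 1) :- (N :- # 1) :*
          (N :- # 1 :+ # 1)) :=
        (:- ((N :- (j :+ # 1) :- # 1) :* (N :- (j :+ # 1)) :* (e :* (j :* (j :+ # 1) :- N :* (N :+ # 1))))))
        refl N (ι j) (risingProduct N j))
      (cong (λ J → - ((N - J - 1ℚ) * (N - J) * risingProduct N (suc j))) (sym (ι-suc j))))

  1/!² : ℕ → ℚ
  1/!² zero    = 1ℚ
  1/!² (suc j) = 1/!² j * (ν j * ν j)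

  -- Partial sums of ₂F₁(−N, N + 1; 1; y).
  partialLegendre : ℚ → ℚ → ℕ → ℚ
  partialLegendre N y m = ∑ m (λ j → risingProduct N j * 1/!² j * y ^ j)

  -- Bonnet's recurrence holds coefficient by coefficient in y, so it survives truncation, for
  -- arbitrary N, if the sum multiplied by y stops one term earlier. Hence the induction on m with N
  -- fixed.
  partialLegendre-rec : ∀ N y m →
    (N + 1ℚ) * partialLegendre (N + 1ℚ) y (suc m) + N * partialLegendre (N - 1ℚ) y (suc m) ≡
    (ι 2 * N + 1ℚ) * (partialLegendre N y (suc m) - ι 2 * y * partialLegendre N y m)
  partialLegendre-rec N y zero    = (solve 2 (λ N y →
      (N :+ # 1) :* (# 0 :+ # 1 :* # 1 :* # 1) :+ N :* (# 0 :+ # 1 :* # 1 :* # 1) :=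
      (# 2 :* N :+ # 1) :* (# 0 :+ # 1 :* # 1 :* # 1 :- # 2 :* y :* # 0))
      refl N y)
  partialLegendre-rec N y (suc m) =
    modulo (partialLegendre-rec N y m) 1ℚ
    (modulo (risingProduct-suc N m) ((N + 1ℚ) * (g * (v * v)) * (y * Y))
    (modulo (risingProduct-pred N m) (N * (g * (v * v)) * (y * Y))
    (modulo ([n+1]*ν m) (- (ι 2 * (ι 2 * N + 1ℚ) * e * g * (y * Y) * ((ι m + 1ℚ) * v + 1ℚ)))
      (solve 12 (λ N y m v g e Y P⁺ P⁻ P a b →
          (N :+ # 1) :* (P⁺ :+ a :* (g :* (v :* v)) :* (y :* Y)) :+ N :* (P⁻ :+ b :* (g :* (v :* v)) :*
            (y :* Y)) :=
          (# 2 :* N :+ # 1) :* (P :+ e :* g :* Y :+ e :* (m :* (m :+ # 1) :- N :* (N :+ # 1)) :*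
            (g :* (v :* v)) :* (y :* Y) :- # 2 :* y :* (P :+ e :* g :* Y)) :+ # 1 :* ((N :+ # 1) :* P⁺ :+
            N :* P⁻ :- (# 2 :* N :+ # 1) :* (P :+ e :* g :* Y :- # 2 :* y :* P)) :+ (N :+ # 1) :*
            (g :* (v :* v)) :* (y :* Y) :* (a :- (:- ((N :+ m :+ # 2) :* (N :+ m :+ # 1) :* e))) :+
            N :* (g :* (v :* v)) :* (y :* Y) :* (b :- (:- ((N :- m :- # 1) :* (N :- m) :* e))) :+
            (:- (# 2 :* (# 2 :* N :+ # 1) :* e :* g :* (y :* Y) :* ((m :+ # 1) :* v :+ # 1))) :*
            ((m :+ # 1) :* v :- # 1))
          refl N y (ι m) v g e Y (partialLegendre (N + 1ℚ) y (suc m)) (partialLegendre (N - 1ℚ) y (suc m))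
              (partialLegendre N y m) (risingProduct (N + 1ℚ) (suc m)) (risingProduct (N - 1ℚ) (suc m))))))
    where
    v g e Y : ℚ
    v = ν m
    g = 1/!² m
    e = risingProduct N m
    Y = y ^ m

  risingProduct-beyond : ∀ n d → risingProduct (ι n) (suc (d ℕ.+ n)) ≡ 0ℚ
  risingProduct-beyond n zero    = (solve 2 (λ n e →
      e :* (n :* (n :+ # 1) :- n :* (n :+ # 1)) :=
      # 0)
      refl (ι n) (risingProduct (ι n) n))
  risingProduct-beyond n (suc d) = trans
    (cong (_* (ι (suc (d ℕ.+ n)) * (ι (suc (d ℕ.+ n)) + 1ℚ) - ι n * (ι n + 1ℚ))) (risingProduct-beyond n d))
    (ℚₚ.*-zeroˡ (ι (suc (d ℕ.+ n)) * (ι (suc (d ℕ.+ n)) + 1ℚ) - ι n * (ι n + 1ℚ)))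

  legendreℚ : ℕ → ℚ → ℚ
  legendreℚ n y = partialLegendre (ι n) y (suc n)

  partialLegendre-stable : ∀ n y d → partialLegendre (ι n) y (d ℕ.+ suc n) ≡ legendreℚ n y
  partialLegendre-stable n y zero    = refl
  partialLegendre-stable n y (suc d) = modulo (partialLegendre-stable n y d) 1ℚ
    (modulo (trans (cong (risingProduct (ι n)) (ℕₚ.+-suc d n)) (risingProduct-beyond n d)) (1/!² j * y ^ j)
      (solve 5 (λ P Q e g Y →
          P :+ e :* g :* Y :=
          Q :+ # 1 :* (P :- Q) :+ g :* Y :* (e :- # 0))
          refl (partialLegendre (ι n) y j) (legendreℚ n y) (risingProduct (ι n) j) (1/!² j) (y ^ j)))
    where
    j : ℕ
    j = d ℕ.+ suc n

  legendreℚ-1 : ∀ y → legendreℚ 1 y ≡ 1ℚ - ι 2 * y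
  legendreℚ-1 y = modulo (ι*ν 0) (- (ι 2 * y * (ν 0 + 1ℚ)))
    (solve 2 (λ y v →
        # 0 :+ # 1 :* # 1 :* # 1 :+ # 1 :* (# 0 :* (# 0 :+ # 1) :- # 1 :* (# 1 :+ # 1)) :* (# 1 :* (v :* v)) :*
          (y :* # 1) :=
        # 1 :- # 2 :* y :+ (:- (# 2 :* y :* (v :+ # 1))) :* (# 1 :* v :- # 1))
        refl y (ν 0))

  legendreℚ-rec : ∀ n y → (ι (suc n) + 1ℚ) * legendreℚ (suc (suc n)) y + ι (suc n) * legendreℚ n y ≡
    (ι 2 * ι (suc n) + 1ℚ) * (1ℚ - ι 2 * y) * legendreℚ (suc n) y
  legendreℚ-rec n y = begin
    (ι (suc n) + 1ℚ) * legendreℚ (suc (suc n)) y + ι (suc n) * legendreℚ n y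
      ≡⟨ cong₂ (λ p q → (ι (suc n) + 1ℚ) * p + ι (suc n) * q)
           (cong (λ M → partialLegendre M y m) (ι-suc (suc n)))
           (trans (sym (partialLegendre-stable n y 2)) (cong (λ M → partialLegendre M y m) ιn≡)) ⟩
    (ι (suc n) + 1ℚ) * partialLegendre (ι (suc n) + 1ℚ) y m + ι (suc n) * partialLegendre (ι (suc n) - 1ℚ) y m
      ≡⟨ partialLegendre-rec (ι (suc n)) y (suc (suc n)) ⟩
    (ι 2 * ι (suc n) + 1ℚ) * (partialLegendre (ι (suc n)) y m - ι 2 * y * legendreℚ (suc n) y)
      ≡⟨ cong (λ p → (ι 2 * ι (suc n) + 1ℚ) * (p - ι 2 * y * legendreℚ (suc n) y)) (partialLegendre-stable
          (suc n) y 1) ⟩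
    (ι 2 * ι (suc n) + 1ℚ) * (legendreℚ (suc n) y - ι 2 * y * legendreℚ (suc n) y)
      ≡⟨ (solve 3 (λ N y P →
          (# 2 :* N :+ # 1) :* (P :- # 2 :* y :* P) :=
          (# 2 :* N :+ # 1) :* (# 1 :- # 2 :* y) :* P)
          refl (ι (suc n)) y (legendreℚ (suc n) y)) ⟩
    (ι 2 * ι (suc n) + 1ℚ) * (1ℚ - ι 2 * y) * legendreℚ (suc n) y ∎
    where
    open ≡-Reasoning
    m : ℕ
    m = suc (suc (suc n))
    ιn≡ : ι n ≡ ι (suc n) - 1ℚ
    ιn≡ = trans (solve 1 (λ n → n := n :+ # 1 :- # 1) refl (ι n)) (cong (_- 1ℚ) (sym (ι-suc n)))

  -- The hypothesis X = (1 - 2y) z replaces the quotient X / z. Two consecutive indices are proved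
  -- together because the recurrence has order two.
  legendreᶻ≡ : ∀ {X z y} → X ≡ (1ℚ - ι 2 * y) * z → ∀ n →
    legendreᶻ X z n ≡ legendreℚ n y * z ^ n × legendreᶻ X z (suc n) ≡ legendreℚ (suc n) y * z ^ suc n
  legendreᶻ≡ {X} {z} {y} refl zero    = (solve 0 (# 1 := (# 0 :+ # 1 :* # 1 :* # 1) :* # 1) refl) , trans
    (modulo (ι*ν 0) x (solve 3 (λ x z v →
        v :* ((# 2 :* # 0 :+ # 1) :* x :* # 1 :- # 0 :* (z :* z) :* # 0) :=
        x :+ x :* (# 1 :* v :- # 1))
        refl x z (ν 0)))
    (trans (solve 2 (λ y z → (# 1 :- # 2 :* y) :* z := (# 1 :- # 2 :* y) :* (z :* # 1)) refl y z)
      (cong (_* (z * 1ℚ)) (sym (legendreℚ-1 y))))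
    where
    x : ℚ
    x = (1ℚ - ι 2 * y) * z
  legendreᶻ≡ {X} {z} {y} refl (suc n) =
    let eq , eq′ = legendreᶻ≡ {X} {z} {y} refl n
        N = ι (suc n)
    in eq′ , *-cancelˡ-≡ (N + 1ℚ) (0<ι+1 (suc n))
      (modulo (legendreᶻ-rec X z (suc n)) 1ℚ
      (modulo eq (- (N * (z * z)))
      (modulo eq′ ((ι 2 * N + 1ℚ) * X)
      (modulo (legendreℚ-rec n y) (- (z * (z * z ^ n)))
        (solve 10 (λ N y z Z a b c p q r →
            (N :+ # 1) :* c :=
            (N :+ # 1) :* (r :* (z :* (z :* Z))) :+ # 1 :* ((N :+ # 1) :* c :-
              ((# 2 :* N :+ # 1) :* ((# 1 :- # 2 :* y) :* z) :* b :- N :* (z :* z) :* a)) :+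
              (:- (N :* (z :* z))) :* (a :- p :* Z) :+ (# 2 :* N :+ # 1) :* ((# 1 :- # 2 :* y) :* z) :*
              (b :- q :* (z :* Z)) :+ (:- (z :* (z :* Z))) :* ((N :+ # 1) :* r :+ N :* p :-
              (# 2 :* N :+ # 1) :* (# 1 :- # 2 :* y) :* q))
            refl N y z (z ^ n) (legendreᶻ X z n) (legendreᶻ X z (suc n)) (legendreᶻ X z (suc (suc n)))
                (legendreℚ n y) (legendreℚ (suc n) y) (legendreℚ (suc (suc n)) y))))))

  !²*1/!² : ∀ j → ι (j ! ℕ.* j !) * 1/!² j ≡ 1ℚ
  !²*1/!² zero    = refl
  !²*1/!² (suc j) = trans (cong (_* 1/!² (suc j)) (trans (ι-* (suc j ℕ.* j !) (suc j ℕ.* j !))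
      (cong₂ _*_ (ι-* (suc j) (j !)) (ι-* (suc j) (j !)))))
    (modulo (trans (cong (_* 1/!² j) (sym (ι-* (j !) (j !)))) (!²*1/!² j))
        ((ι (suc j) * ν j) * (ι (suc j) * ν j))
    (modulo (ι*ν j) (ι (suc j) * ν j + 1ℚ)
      (solve 4 (λ J f g v →
          J :* f :* (J :* f) :* (g :* (v :* v)) :=
          # 1 :+ J :* v :* (J :* v) :* (f :* f :* g :- # 1) :+ (J :* v :+ # 1) :* (J :* v :- # 1))
          refl (ι (suc j)) (ι (j !)) (1/!² j) (ν j))))

  ratℤ-rising : ∀ n j → ratℤ (rising (ℤ.- + n) j) * ratℤ (rising (+ suc n) j) ≡ risingProduct (ι n) j
  ratℤ-rising n zero    = refl
  ratℤ-rising n (suc j) = trans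
    (cong₂ _*_ (trans (ratℤ-* a (ℤ.- + n ℤ.+ + j)) (cong (ratℤ a *_) (trans (ratℤ-+ (ℤ.- + n) (+ j))
        (cong (λ s → s + ι j) (ratℤ-neg (+ n))))))
               (trans (ratℤ-* b (+ suc n ℤ.+ + j)) (cong (ratℤ b *_) (trans (ratℤ-+ (+ suc n) (+ j))
                   (cong (λ s → s + ι j) (ι-suc n))))))
    (trans (solve 4 (λ a b n j →
        a :* ((:- n) :+ j) :* (b :* (n :+ # 1 :+ j)) :=
        a :* b :* (j :* (j :+ # 1) :- n :* (n :+ # 1)))
        refl (ratℤ a) (ratℤ b) (ι n) (ι j))
      (cong (_* (ι j * (ι j + 1ℚ) - ι n * (ι n + 1ℚ))) (ratℤ-rising n j)))
    where
    a b : ℤ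
    a = rising (ℤ.- + n) j
    b = rising (+ suc n) j

  legendre-coefficient : ∀ n j → ((rising (ℤ.- + n) j ℤ.* rising (+ suc n) j) ℚ./ (j ! ℕ.* j !))
      {{j ℕₚ.!* j !≢0}} ≡ risingProduct (ι n) j * 1/!² j
  legendre-coefficient n j = modulo (!²*1/!² j) (- c) (modulo (trans (ι*/ (j ! ℕ.* j !) {{j ℕₚ.!* j !≢0}} E)
      (trans (ratℤ-* (rising (ℤ.- + n) j) (rising (+ suc n) j)) (ratℤ-rising n j))) (1/!² j)
    (solve 4 (λ c d g e →
        c :=
        e :* g :+ (:- c) :* (d :* g :- # 1) :+ g :* (d :* c :- e))
        refl c (ι (j ! ℕ.* j !)) (1/!² j) (risingProduct (ι n) j)))
    where
    E : ℤ
    E = rising (ℤ.- + n) j ℤ.* rising (+ suc n) j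
    c : ℚ
    c = (E ℚ./ (j ! ℕ.* j !)) {{j ℕₚ.!* j !≢0}}

  module CurveValue where
    open Curve

    numeratorℚ : ℚ → ℚ
    numeratorℚ k = (- (k * k * k * k)) + ι 6 * (k * k * k) - ι 2 * k + ι 1

    -- legendreProduct n k, with ν 15 = 1/16.
    value : ℕ → ℚ → ℚ
    value n k = ν 15 ^ n * L n k

    value-derivation : ∀ n → HasDerivation (value n) (λ k → ν 15 ^ n * L′ n k)
    value-derivation n = derivation-scalar (ν 15 ^ n) (L-derivation n)

    *-^ : ∀ p q n → (p * q) ^ n ≡ p ^ n * q ^ n
    *-^ p q zero    = refl
    *-^ p q (suc n) = trans (cong (p * q *_) (*-^ p q n)) (solve 4 (λ p q a b →
        p :* q :* (a :* b) :=
        p :* a :* (q :* b))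
        refl p q (p ^ n) (q ^ n))

    recip-unique : ∀ {p q} → p * q ≡ 1ℚ → recip p ≡ q
    recip-unique {p} {q} pq≡1 = modulo pq≡1 (- recip p) (modulo (recip-inverseʳ p p≢0) q
      (solve 3 (λ p q r → r := q :+ (:- r) :* (p :* q :- # 1) :+ q :* (p :* r :- # 1)) refl p q (recip p)))
      where
      p≢0 : p ≢ 0ℚ
      p≢0 refl = contradiction (trans (sym pq≡1) (ℚₚ.*-zeroˡ q)) ℚₚ.1≢0

    legendre-value : ∀ n {k} → 0ℚ ≤ k → Z k ≢ 0ℚ →
      legendreℚ n ((1ℚ - numeratorℚ k * recip (Z k)) * ½) * (Z k * recip (ι 16 * M k)) ^ n ≡ value n k
    legendre-value n {k} 0≤k Z≢0 = trans (cong (λ s → legendreℚ n y * s)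
        (trans (cong (_^ n) (trans (cong (Z k *_) (recip-unique {ι 16 * M k} 16M)) (solve 3 (λ Z w v →
            Z :* (w :* w :* v) :=
            v :* (w :* w :* Z))
            refl (Z k) (w k) (ν 15))))
          (*-^ (ν 15) (z k) n)))
      (trans (solve 3 (λ l a b → l :* (a :* b) := a :* (l :* b)) refl (legendreℚ n y) (ν 15 ^ n) (z k ^ n))
        (cong (ν 15 ^ n *_) (sym (proj₁ (legendreᶻ≡ {y = y} X≡ n)))))
      where
      y : ℚ
      y = (1ℚ - numeratorℚ k * recip (Z k)) * ½
      16M : ι 16 * M k * (w k * w k * ν 15) ≡ 1ℚ
      16M = modulo (Wronskian.M*w*w 0≤k) (ι 16 * ν 15) (modulo (ι*ν 15) 1ℚ
        (solve 3 (λ M w v →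
            # 16 :* M :* (w :* w :* v) :=
            # 1 :+ # 16 :* v :* (M :* (w :* w) :- # 1) :+ # 1 :* (# 16 :* v :- # 1))
            refl (M k) (w k) (ν 15)))
      X≡ : X k ≡ (1ℚ - ι 2 * y) * z k
      X≡ = modulo (recip-inverseʳ (Z k) Z≢0) (- (w k * w k * numeratorℚ k))
          (modulo ½+½≡1 ((1ℚ - numeratorℚ k * r) * z k)
        (solve 4 (λ k w r h →
            w :* w :* MXᵖ k :=
            (# 1 :- # 2 :* ((# 1 :- numeratorᵖ k :* r) :* h)) :* (w :* w :* Zᵖ k) :+
              (:- (w :* w :* numeratorᵖ k)) :* (Zᵖ k :* r :- # 1) :+ (# 1 :- numeratorᵖ k :* r) :*
              (w :* w :* Zᵖ k) :* (h :+ h :- # 1))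
            refl k (w k) r ½))
        where
        r : ℚ
        r = recip (Z k)
        ½+½≡1 : ½ + ½ ≡ 1ℚ
        ½+½≡1 = refl

  -- Central binomial coefficients

  [2n]!/n!² : ∀ n → ι ((2 ℕ.* n) C n) ≡ ι ((2 ℕ.* n) !) * 1/!² n
  [2n]!/n!² n = modulo (!²*1/!² n) (- ι c) (modulo eq (1/!² n)
      (solve 4 (λ c d g f →
          c :=
          f :* g :+ (:- c) :* (d :* g :- # 1) :+ g :* (c :* d :- f))
          refl (ι c) (ι (n ! ℕ.* n !)) (1/!² n) (ι ((2 ℕ.* n) !))))
    where
    c : ℕ
    c = (2 ℕ.* n) C n
    n≤2n : n ℕ.≤ 2 ℕ.* n
    n≤2n = ℕₚ.m≤m+n n (n ℕ.+ 0)
    2n∸n : 2 ℕ.* n ℕ.∸ n ≡ n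
    2n∸n = trans (ℕₚ.m+n∸m≡n n (n ℕ.+ 0)) (ℕₚ.+-identityʳ n)
    eqℕ : c ℕ.* (n ! ℕ.* n !) ≡ (2 ℕ.* n) !
    eqℕ = trans (cong (λ j → c ℕ.* (n ! ℕ.* j !)) (sym 2n∸n)) (trans
      (cong (ℕ._* (n ! ℕ.* (2 ℕ.* n ℕ.∸ n) !)) (nCk≡n!/k![n-k]! n≤2n))
      (m/n*n≡m {{n ℕₚ.!* (2 ℕ.* n ℕ.∸ n) !≢0}} (k![n∸k]!∣n! n≤2n)))
    eq : ι c * ι (n ! ℕ.* n !) ≡ ι ((2 ℕ.* n) !)
    eq = trans (sym (ι-* c (n ! ℕ.* n !))) (cong ι eqℕ)

  central-rec : ∀ n → ι ((2 ℕ.* suc n) C suc n) ≡ ι ((2 ℕ.* n) C n) * (ι 2 * (ι 2 * ι n + 1ℚ) * ν n)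
  central-rec n = begin
    ι ((2 ℕ.* suc n) C suc n)                                   ≡⟨ [2n]!/n!² (suc n) ⟩
    ι ((2 ℕ.* suc n) !) * 1/!² (suc n)                          ≡⟨ cong (λ j → ι (j !) * 1/!² (suc n))
        (ℕₚ.*-suc 2 n) ⟩
    ι (suc (suc m) ℕ.* (suc m ℕ.* m !)) * 1/!² (suc n)          ≡⟨ cong (_* 1/!² (suc n)) factorial ⟩
    (ι 2 * ι n + 1ℚ + 1ℚ) * ((ι 2 * ι n + 1ℚ) * ι (m !)) * (1/!² n * (ν n * ν n))
      ≡⟨ modulo ([n+1]*ν n) (ι 2 * (ι 2 * ι n + 1ℚ) * ν n * (ι (m !) * 1/!² n))
           (solve 4 (λ n v f g →
               (# 2 :* n :+ # 1 :+ # 1) :* ((# 2 :* n :+ # 1) :* f) :* (g :* (v :* v)) :=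
               f :* g :* (# 2 :* (# 2 :* n :+ # 1) :* v) :+ # 2 :* (# 2 :* n :+ # 1) :* v :* (f :* g) :*
                 ((n :+ # 1) :* v :- # 1))
               refl (ι n) (ν n) (ι (m !)) (1/!² n)) ⟩
    ι (m !) * 1/!² n * (ι 2 * (ι 2 * ι n + 1ℚ) * ν n)           ≡⟨ cong (_* (ι 2 * (ι 2 * ι n + 1ℚ) * ν n))
        ([2n]!/n!² n) ⟨
    ι ((2 ℕ.* n) C n) * (ι 2 * (ι 2 * ι n + 1ℚ) * ν n)          ∎
    where
    open ≡-Reasoning
    m : ℕ
    m = 2 ℕ.* n
    1+m : ι (suc m) ≡ ι 2 * ι n + 1ℚ
    1+m = trans (ι-suc m) (cong (λ s → s + 1ℚ) (ι-* 2 n))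
    factorial : ι (suc (suc m) ℕ.* (suc m ℕ.* m !)) ≡ (ι 2 * ι n + 1ℚ + 1ℚ) * ((ι 2 * ι n + 1ℚ) * ι (m !))
    factorial = trans (ι-* (suc (suc m)) (suc m ℕ.* m !)) (cong₂ _*_
      (trans (ι-suc (suc m)) (cong (λ s → s + 1ℚ) 1+m)) (trans (ι-* (suc m) (m !)) (cong (_* ι (m !)) 1+m)))

  binom²≡ : ∀ n → ι (((2 ℕ.* n) C n) ℕ.^ 2) * ν 15 ^ n ≡ binom² n
  binom²≡ n = trans (cong (_* ν 15 ^ n) (trans (ι-* c (c ℕ.* 1)) (cong (ι c *_) (cong ι (ℕₚ.*-identityʳ c)))))
      (squared n)
    where
    c : ℕ
    c = (2 ℕ.* n) C n
    squared : ∀ n → ι ((2 ℕ.* n) C n) * ι ((2 ℕ.* n) C n) * ν 15 ^ n ≡ binom² n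
    squared zero    = refl
    squared (suc n) = trans (cong (λ s → s * s * (ν 15 * ν 15 ^ n)) (central-rec n))
      (trans (modulo 4f≡h² (a * a * s * o * o * v * v)
        (solve 6 (λ a s h o v f →
            a :* (# 2 :* o :* v) :* (a :* (# 2 :* o :* v)) :* (f :* s) :=
            a :* a :* s :* (o :* h :* v :* (o :* h :* v)) :+ a :* a :* s :* o :* o :* v :* v :* (# 4 :* f :-
              h :* h))
            refl a s h o v f))
        (cong (_* (o * h * v * (o * h * v))) (squared n)))
      where
      a s h f o v : ℚ
      a = ι ((2 ℕ.* n) C n)
      s = ν 15 ^ n
      h = ν 1
      f = ν 15
      o = ι 2 * ι n + 1ℚ
      v = ν n
      4f≡h² : ι 4 * f ≡ h * h
      4f≡h² = modulo (ι*ν 15) (h * h) (modulo (ι*ν 1) (- (ι 4 * f * (ι 2 * h + 1ℚ)))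
        (solve 2 (λ h f →
            # 4 :* f :=
            h :* h :+ h :* h :* (# 16 :* f :- # 1) :+ (:- (# 4 :* f :* (# 2 :* h :+ # 1))) :* (# 2 :* h :- # 1))
            refl h f))

  -- From rational to real k

  -- At each index a real numeral is `+ n ℚ./ 1`; unfolding identifies it with `ι n` by computation,
  -- so the solver expressions can mirror the formulas of the statement literally.
  opaque
    unfolding ratℤ-opaque

    seq-numerator : ∀ k i → seq (numerator k) i ≡ CurveValue.numeratorℚ (seq k i)
    seq-numerator k i = (solve 1 (λ k →
        (:- (k :^ 4)) :+ # 6 :* k :^ 3 :- # 2 :* k :+ # 1 :=
        numeratorᵖ k)
        refl (seq k i))

    seq-denominator : ∀ k i → seq (denominator k) i ≡ Z (seq k i)
    seq-denominator k i = (solve 1 (λ k →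
        (k :^ 2 :+ # 1) :* (k :^ 2 :+ # 2 :* k :- # 1) :=
        Zᵖ k)
        refl (seq k i))

    seq-16[k+1]² : ∀ k i → seq (fromℕ 16 Defs.* (k Defs.+ fromℕ 1) Defs.^ 2) i ≡ ι 16 * M (seq k i)
    seq-16[k+1]² k i = (solve 1 (λ k → # 16 :* (k :+ # 1) :^ 2 := # 16 :* Mᵖ k) refl (seq k i))

    seq-C₃ : ∀ k i → seq (Defs.C₃ k) i ≡ cubic₃ (seq k i)
    seq-C₃ k i = (solve 1 (λ k →
        # 4 :* (k :- # 1) :^ 2 :* k :^ 2 :* (k :^ 2 :+ # 3 :* k :+ # 4) :^ 2 :=
        C₃ᵖ k)
        refl (seq k i))

    seq-C₂ : ∀ k i → seq (Defs.C₂ k) i ≡ cubic₂ (seq k i)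
    seq-C₂ k i = (solve 1 (λ k →
        # 12 :* (k :- # 1) :* k :* (k :^ 6 :+ # 5 :* k :^ 5 :+ # 10 :* k :^ 4 :+ # 10 :* k :^ 3 :+
          # 5 :* k :^ 2 :- # 3 :* k :+ # 4) :=
        C₂ᵖ k)
        refl (seq k i))

    seq-C₁ : ∀ k i → seq (Defs.C₁ k) i ≡ cubic₁ (seq k i)
    seq-C₁ k i = (solve 1 (λ k →
        # 9 :* k :^ 8 :+ # 36 :* k :^ 7 :+ # 37 :* k :^ 6 :+ # 8 :* k :^ 5 :- # 9 :* k :^ 4 :- # 56 :* k :^
          3 :+ # 63 :* k :^ 2 :- # 28 :* k :+ # 4 :=
        C₁ᵖ k)
        refl (seq k i))

    seq-C₀ : ∀ k i → seq (Defs.C₀ k) i ≡ cubic₀ (seq k i)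
    seq-C₀ k i = (solve 1 (λ k →
        (k :^ 2 :+ # 2 :* k :- # 1) :^ 2 :* (# 2 :* k :^ 4 :+ # 3 :* k :^ 2 :- # 2 :* k :+ # 1) :=
        C₀ᵖ k)
        refl (seq k i))

    seq-closedForm : ∀ k i → seq (fromℕ 2 Defs.* (k Defs.+ fromℕ 1) Defs.^ 3 Defs.* (k Defs.^ 2 Defs.+ fromℕ
        1)) i ≡
      ι 2 * ((ι 1 + seq k i) * M (seq k i)) * (seq k i * seq k i + ι 1)
    seq-closedForm k i = (solve 1 (λ k →
        # 2 :* (k :+ # 1) :^ 3 :* (k :^ 2 :+ # 1) :=
        # 2 :* ((# 1 :+ k) :* Mᵖ k) :* (k :* k :+ # 1))
        refl (seq k i))

    seq-π : ∀ i → seq Defs.π i ≡ ι 4 * leibnizSum i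
    seq-π i = cong (ι 4 *_) (partialSum≡leibnizSum i)

  seq-cubic : ∀ k n i → seq (Defs.C₃ k Defs.* fromℕ n Defs.^ 3 Defs.+ Defs.C₂ k Defs.* fromℕ n Defs.^ 2
                               Defs.+ Defs.C₁ k Defs.* fromℕ n Defs.+ Defs.C₀ k) i ≡ cubic (seq k i) (ι n)
  seq-cubic k n i = begin
    seq (Defs.C₃ k) i * (m * (m * (m * 1ℚ))) + seq (Defs.C₂ k) i * (m * (m * 1ℚ)) + seq (Defs.C₁ k) i * m +
        seq (Defs.C₀ k) i
      ≡⟨ (solve 5 (λ a b c d m →
          a :* (m :* (m :* (m :* # 1))) :+ b :* (m :* (m :* # 1)) :+ c :* m :+ d :=
          a :* (m :* m :* m) :+ b :* (m :* m) :+ c :* m :+ d)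
          refl (seq (Defs.C₃ k) i) (seq (Defs.C₂ k) i) (seq (Defs.C₁ k) i) (seq (Defs.C₀ k) i) m) ⟩
    seq (Defs.C₃ k) i * (m * m * m) + seq (Defs.C₂ k) i * (m * m) + seq (Defs.C₁ k) i * m + seq (Defs.C₀ k) i
      ≡⟨ cong₂ _+_ (cong₂ _+_ (cong₂ _+_ (cong (_* (m * m * m)) (seq-C₃ k i)) (cong (_* (m * m)) (seq-C₂ k i)))
           (cong (_* m) (seq-C₁ k i))) (seq-C₀ k i) ⟩
    cubic (seq k i) m
      ≡⟨ cong (cubic (seq k i)) (ratℤ-def (+ n)) ⟨
    cubic (seq k i) (ι n) ∎
    where
    open ≡-Reasoning
    m : ℚ
    m = + n ℚ./ 1

  seq-∑ : ∀ n f i → seq (∑< (RawRing.+-rawMonoid Defs.ℝ-rawRing) n f) i ≡ ∑ n (λ j → seq (f j) i)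
  seq-∑ zero    f i = refl
  seq-∑ (suc n) f i = cong (_+ seq (f n) i) (seq-∑ n f i)

  seq-^ : ∀ x n i → seq (x Defs.^ n) i ≡ seq x i ^ n
  seq-^ x zero    i = refl
  seq-^ x (suc n) i = cong (seq x i *_) (seq-^ x n i)

  seq-legendre : ∀ n x i → seq (legendre n x) i ≡ legendreℚ n ((1ℚ - seq x i) * ½)
  seq-legendre n x i = trans (seq-∑ (suc n) _ i)
    (∑-cong (suc n) λ j _ → cong₂ _*_ (legendre-coefficient n j) (seq-^ _ j i))

  legendre-value-≡ : ∀ n {k a b c} → a ≡ CurveValue.numeratorℚ k → b ≡ Z k → c ≡ ι 16 * M k → 0ℚ ≤ k →
      Z k ≢ 0ℚ →
    legendreℚ n ((1ℚ - a * recip b) * ½) * (b * recip c) ^ n ≡ CurveValue.value n k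
  legendre-value-≡ n refl refl refl = CurveValue.legendre-value n

  Eventually : (ℕ → Set) → Set
  Eventually P = ∃[ N ] ∀ i → N ℕ.≤ i → P i

  infixr 4 _&_
  _&_ : ∀ {P Q : ℕ → Set} → Eventually P → Eventually Q → Eventually (λ i → P i × Q i)
  (M , p) & (N , q) = M ℕ.⊔ N , λ i M⊔N≤i → p i (ℕₚ.m⊔n≤o⇒m≤o M N M⊔N≤i) , q i (ℕₚ.m⊔n≤o⇒n≤o M N M⊔N≤i)

  eventually-map : ∀ {P Q : ℕ → Set} → (∀ i → P i → Q i) → Eventually P → Eventually Q
  eventually-map f (N , p) = N , λ i N≤i → f i (p i N≤i)

  lower-bound : ∀ k → 0ℝ Defs.< k → ∃[ lo ] 0ℚ < lo × Eventually (λ i → lo < seq k i)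
  lower-bound k (lo , 0<lo , N , p) = lo , 0<lo , N , λ i N≤i → subst (_< seq k i) (ℚₚ.+-identityˡ lo) (p i N≤i)

  upper-bound : ∀ k → k Defs.< 1ℝ → ∃[ hi ] hi < 1ℚ × Eventually (λ i → seq k i < hi)
  upper-bound k (δ , 0<δ , N , p) = 1ℚ - δ ,
    subst₂ _<_ (ℚₚ.+-identityʳ (1ℚ - δ)) (solve 1 (λ δ → # 1 :- δ :+ δ := # 1) refl δ) (ℚₚ.+-monoʳ-< (1ℚ - δ)
      0<δ) , N ,
    λ i N≤i → subst (_< 1ℚ - δ) (solve 2 (λ δ k → k :+ δ :- δ := k) refl δ (seq k i))
      (ℚₚ.+-monoˡ-< (- δ) (p i N≤i))

  eventually-unit : ∀ k → 0ℝ Defs.< k → k Defs.< 1ℝ → Eventually (λ i → InUnit (seq k i))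
  eventually-unit k 0<k k<1 =
    let lo , 0<lo , k> = lower-bound k 0<k
        hi , hi<1 , k< = upper-bound k k<1
    in eventually-map (λ i (lo<k , k<hi) → ℚₚ.<⇒≤ (ℚₚ.<-trans 0<lo lo<k) , ℚₚ.<⇒≤ (ℚₚ.<-trans k<hi hi<1))
        (k> & k<)

  denominator-nonzero : ∀ k → denominator k Defs.# 0ℝ → Eventually (λ i → Z (seq k i) ≢ 0ℚ)
  denominator-nonzero k d#0 =
    let δ , 0<δ , N , δ< = Defs.bounded-away (denominator k) d#0
    in N , λ i N≤i Z≡0 → ℚₚ.<-asym 0<δ (subst (λ d → δ < ∣ d ∣) (trans (seq-denominator k i) Z≡0) (δ< i N≤i))

  lipschitz-modulus : ∀ {f f′} (D : HasDerivation f f′) {ε} → 0ℚ < ε → ∃[ η ] 0ℚ < η ×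
    (∀ {x y} → InUnit x → InUnit y → ∣ y - x ∣ ≤ η → ∣ f y - f x ∣ ≤ ε)
  lipschitz-modulus {f} D {ε} 0<ε =
    let N , small = small-ν (B D) (0≤B D) 0<ε
    in ν N , 0<ν N , λ xI yI ∣y-x∣≤η → ℚₚ.≤-trans (lipschitz D xI yI)
         (ℚₚ.≤-trans (*-monoˡ-0≤ (0≤B D) ∣y-x∣≤η) (small N ℕₚ.≤-refl))

  map-ℝ : ∀ {f f′} → HasDerivation f f′ → (k : ℝ) → Eventually (λ i → InUnit (seq k i)) → ℝ
  map-ℝ {f} D k (N , unit) = mkℝ (λ i → f (seq k i)) λ ε 0<ε →
    let η , 0<η , close = lipschitz-modulus D (half-pos 0<ε)
        M , near = cauchy k η 0<η
    in N ℕ.⊔ M , λ m n ≤m ≤n → ℚₚ.≤-<-trans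
         (close (unit n (ℕₚ.m⊔n≤o⇒m≤o N M ≤n)) (unit m (ℕₚ.m⊔n≤o⇒m≤o N M ≤m))
           (ℚₚ.<⇒≤ (near m n (ℕₚ.m⊔n≤o⇒n≤o N M ≤m) (ℕₚ.m⊔n≤o⇒n≤o N M ≤n))))
         (half< 0<ε)

  eventually≡⇒≈ : ∀ {x y} → Eventually (λ i → seq x i ≡ seq y i) → x Defs.≈ y
  eventually≡⇒≈ {x} {y} (N , eq) ε 0<ε = N , λ i N≤i →
    subst (λ d → ∣ d ∣ < ε) (sym (trans (cong (_- seq y i) (eq i N≤i)) (ℚₚ.+-inverseʳ (seq y i)))) 0<ε

  ≤-weaken : ∀ {d e η} → 0ℚ < e → d + e < η → d ≤ η
  ≤-weaken 0<e d+e<η = ℚₚ.≤-trans (≤-by (ℚₚ.<⇒≤ 0<e) refl) (ℚₚ.<⇒≤ d+e<η)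

  -- The strict order of the reals demands a uniform margin: half of e bounds the distance and the
  -- other half is that margin.
  transfer-bound : ∀ {p p′ q q′ e ε} → p ≡ p′ → q ≡ q′ → ∣ p′ - q′ ∣ ≤ ½ * e → e < ε → ∣ p - q ∣ + ½ * e < ε
  transfer-bound {p} {q = q} {e = e} refl refl p-q≤½e e<ε = ℚₚ.≤-<-trans (≤-by (gap p-q≤½e) (modulo ½+½≡1 (- e)
    (solve 3 (λ h e d → e := d :+ h :* e :+ (h :* e :- d) :+ (:- e) :* (h :+ h :- # 1)) refl ½ e (∣ p - q ∣))))
      e<ε
    where
    ½+½≡1 : ½ + ½ ≡ 1ℚ
    ½+½≡1 = refl

  strict-bound : ∀ f L ε {e} → 0ℚ < e → Eventually (λ i → ∣ seq f i - seq L i ∣ ≤ ½ * e × e < seq ε i) →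
    Defs.∣ f Defs.- L ∣ Defs.< ε
  strict-bound f L ε {e} 0<e close = ½ * e , half-pos 0<e , eventually-map
    (λ i (≤½e , e<ε) → transfer-bound {seq f i} {q = seq L i} refl refl ≤½e e<ε) close

  seq-summand : ∀ n k {c x} i → c ≡ ((2 ℕ.* n) C n) ℕ.^ 2 → x ≡ cubic (seq k i) (ι n) →
    + c ℚ./ 1 * CurveValue.value n (seq k i) * x ≡ binom² n * Curve.L n (seq k i) * cubic (seq k i) (ι n)
  seq-summand n k i refl refl = trans (cong (λ b → b * CurveValue.value n κ * cubic κ (ι n))
      (sym (ratℤ-def (+ c))))
    (modulo (binom²≡ n) (Curve.L n κ * cubic κ (ι n))
      (solve 5 (λ b v l a x →
          b :* (v :* l) :* x :=
          a :* l :* x :+ l :* x :* (b :* v :- a))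
          refl (ι c) (ν 15 ^ n) (Curve.L n κ) (binom² n) (cubic κ (ι n))))
    where
    κ : ℚ
    κ = seq k i
    c : ℕ
    c = ((2 ℕ.* n) C n) ℕ.^ 2

  recip-4leibniz : ∀ {p π} → π ≡ ι 4 * p → ½ ≤ p → ι 4 * p * recip π ≡ 1ℚ × 0ℚ ≤ recip π
  recip-4leibniz {p} refl ½≤p =
    let s , eq , 0≤s = 1/4p ½≤p
        recip≡s = CurveValue.recip-unique {ι 4 * p} eq
    in trans (cong (ι 4 * p *_) recip≡s) eq , subst (0ℚ ≤_) (sym recip≡s) 0≤s

  module RealSeries (k : ℝ) (0<k : 0ℝ Defs.< k) (k<1 : k Defs.< 1ℝ) {ε : ℚ} (0<ε : 0ℚ < ε) where
    lo hi : ℚ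
    lo = proj₁ (lower-bound k 0<k)
    hi = proj₁ (upper-bound k k<1)

    eventually-in-range : Eventually (λ i → lo < seq k i × seq k i < hi)
    eventually-in-range = proj₂ (proj₂ (lower-bound k 0<k)) & proj₂ (proj₂ (upper-bound k k<1))

    lo≤hi : lo ≤ hi
    lo≤hi = let N , p = eventually-in-range ; lo<k , k<hi = p N ℕₚ.≤-refl in ℚₚ.<⇒≤ (ℚₚ.<-trans lo<k k<hi)

    module S = Series (proj₁ (proj₂ (lower-bound k 0<k))) lo≤hi (proj₁ (proj₂ (upper-bound k k<1))) 0<ε

    partial-sum-close : ∀ n → S.N ℕ.≤ n → Eventually (λ i →
      ∣ cubicSum (suc n) (seq k i) - ι 2 * ((ι 1 + seq k i) * M (seq k i)) * (seq k i * seq k i + ι 1) * recip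
          (seq Defs.π i) ∣ ≤ ε)
    partial-sum-close n N≤n = eventually-map
      (λ i ((lo<k , k<hi) , I≤i , ½≤p) → let eq , 0≤s = recip-4leibniz (seq-π i) ½≤p in
        S.series-estimate n N≤n (ℚₚ.<⇒≤ lo<k) (ℚₚ.<⇒≤ k<hi) i I≤i (recip (seq Defs.π i)) eq 0≤s)
      (eventually-in-range & (S.I , λ i I≤i → I≤i) & ½≤leibnizSum)

-- The theorem for real k

open import Defs
open import Data.Nat as ℕ using (ℕ; suc)
open import Data.Nat.Combinatorics using (_C_)
open import Data.Product using (Σ-syntax; _×_; _,_; proj₁; proj₂)
open import Data.Rational as ℚ using (ℚ; 0ℚ; ½)
import Data.Rational.Properties as ℚₚ
open import Relation.Binary.PropositionalEquality
open ℝ using (seq)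
open ℚ-Lemmas using (half-pos)
open Rational using
  ( ∑-cong; seq-∑; Z; module CurveValue; _&_; eventually-map
  ; lower-bound; eventually-unit; denominator-nonzero; lipschitz-modulus; ≤-weaken; map-ℝ; eventually≡⇒≈;
        strict-bound; transfer-bound
  ; seq-legendre; seq-^; legendre-value-≡; seq-numerator; seq-denominator; seq-16[k+1]²; seq-summand; seq-cubic
  ; seq-closedForm; module RealSeries )

seq-legendreProduct : ∀ n k 0<k d#0 i → 0ℚ ℚ.≤ seq k i → Z (seq k i) ≢ 0ℚ →
  seq (legendreProduct n k 0<k d#0) i ≡ CurveValue.value n (seq k i)
seq-legendreProduct n k 0<k d#0 i 0≤k Z≢0 = trans
  (cong₂ ℚ._*_ (seq-legendre n (numerator k / denominator k [ d#0 ]) i) (seq-^ _ n i))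
  (legendre-value-≡ n (seq-numerator k i) (seq-denominator k i) (seq-16[k+1]² k i) 0≤k Z≢0)

-- Since `value` is defined across the zero of the denominator, it is applied termwise to the
-- sequence of k; whether k is √2 - 1 never has to be decided.
extendedProduct : ∀ k → 0ℝ < k → k < 1ℝ → ℕ → ℝ
extendedProduct k 0<k k<1 n = map-ℝ (CurveValue.value-derivation n) k (eventually-unit k 0<k k<1)

extendedProduct≈ : ∀ n k 0<k k<1 d#0 → extendedProduct k 0<k k<1 n ≈ legendreProduct n k 0<k d#0
extendedProduct≈ n k 0<k k<1 d#0 = eventually≡⇒≈ {extendedProduct k 0<k k<1 n} {legendreProduct n k 0<k d#0}
  (eventually-map (λ i ((0≤k , _) , Z≢0) → sym (seq-legendreProduct n k 0<k d#0 i 0≤k Z≢0))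
    (eventually-unit k 0<k k<1 & denominator-nonzero k d#0))

legendreProductOn : ∀ n k → InDomain k → ℝ
legendreProductOn n k d = legendreProduct n k (proj₁ d) (proj₂ (proj₂ d))

extendedProduct-limit : ∀ n k 0<k k<1 → HasLimit InDomain (legendreProductOn n) k (extendedProduct k 0<k k<1 n)
extendedProduct-limit n k 0<k k<1 ε 0<ε =
  let e , 0<e , e<ε = lower-bound ε 0<ε
      η , 0<η , close = lipschitz-modulus (CurveValue.value-derivation n) (half-pos 0<e)
  in fromℚ η , 0<fromℚ η 0<η , λ x d _ (_ , 0<e′ , near) →
    let 0<x , x<1 , d#0 = d in
    strict-bound (legendreProductOn n x d) (extendedProduct k 0<k k<1 n) ε 0<e (eventually-map
      (λ i (xI , kI , Z≢0 , ∣x-k∣ , e<εᵢ) →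
        subst (λ v → ℚ.∣ v ℚ.- CurveValue.value n (seq k i) ∣ ℚ.≤ ½ ℚ.* e)
          (sym (seq-legendreProduct n x 0<x d#0 i (proj₁ xI) Z≢0)) (close kI xI (≤-weaken 0<e′ ∣x-k∣)) , e<εᵢ)
      (eventually-unit x 0<x x<1 & eventually-unit k 0<k k<1 & denominator-nonzero x d#0 & near & e<ε))

theorem1 : (k : ℝ) (0<k : 0ℝ < k) → k < 1ℝ →
    Σ[ t ∈ (ℕ → ℝ) ] (∀ n → IsLegendreProduct n k 0<k (t n)) ×
    HasSum
    (λ n → fromℕ (((2 ℕ.* n) C n) ℕ.^ 2) * t n *
    (C₃ k * fromℕ n ^ 3 + C₂ k * fromℕ n ^ 2 + C₁ k * fromℕ n + C₀ k))
    ((2 * (k + 1) ^ 3 * (k ^ 2 + 1)) / π [ 0<⇒# π 0<π ])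
theorem1 k 0<k k<1 =
  extendedProduct k 0<k k<1 ,
  (λ n → extendedProduct≈ n k 0<k k<1 , λ _ → extendedProduct-limit n k 0<k k<1) ,
  λ ε 0<ε →
    let e , 0<e , e<ε = lower-bound ε 0<ε
        module R = RealSeries k 0<k k<1 (half-pos 0<e)
    -- The estimates concern sums of n + 1 terms, hence the `suc` in the threshold and in the
    -- pattern.
    in suc R.S.N , λ { (suc n) (ℕ.s≤s N≤n) →
      let I , close = R.partial-sum-close n N≤n & e<ε
      in ½ ℚ.* e , half-pos 0<e , I , λ i I≤i → transfer-bound
           (trans (seq-∑ (suc n) _ i) (∑-cong (suc n) λ j _ → seq-summand j k i refl (seq-cubic k j i)))
           (cong (ℚ._* recip (seq π i)) (seq-closedForm k i))
           (proj₁ (close i I≤i)) (proj₂ (close i I≤i)) }
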